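{- Let $q\ge 2$ and $c\ge 1$ be fixed integers. There exist an integer $n_0=n_0(q,c)$ and a constant $K=K(q,c)$ such that for every $n\ge n_0$, $$MB(n,q,c)\le Kn,\qquad MC(n,q,c)\le Kn,\qquad PB(n,q,c)\le Kn,\qquad PC(n,q,c)\le Kn.$$ That is, for all $n\ge n_0$ each of these four search problems can be solved by an adaptive algorithm using at most $Kn$ queries of size exactly $q$ in the worst case.
   Context: Setting. We are given a set $X$ of $n$ distinguishable balls. Each ball has one color from a set of $c$ colors; the coloring is unknown and arbitrary (not every color needs to be used), while $X$ and $c$ are known. Definitions. Let $Y$ be a finite set of colored balls and $x\in Y$. - $x$ is a majority ball in $Y$ if more than $|Y|/2$ balls of $Y$ have the color of $x$. - $x$ is a non-minority ball in $Y$ if at least $|Y|/2$ balls of $Y$ have the color of $x$. - $x$ is a plurality ball in $Y$ if there are more balls of the color of $x$ in $Y$ than of any other color. - $x$ is an almost plurality ball in $Y$ if it is a plurality ball in $Y$ or a non-minority ball in $Y$. (The color of $x$ is counted including $x$ itself.) Queries. A query is a subset $Q\subseteq X$ with $|Q|=q$. - Majority query $Q$: the answer is NO if there is no majority ball in $Q$; otherwise the answer is YES together with some majority ball of $Q$. - Plurality query $Q$: the answer is NO if there is no plurality ball in $Q$; otherwise the answer is YES together with some plurality ball of $Q$. If several balls of $Q$ are valid answers, the answerer may present any one of them (the choice is adversarial). No other information about the colors is revealed. Algorithms. An algorithm asks queries adaptively: each query may depend on the previous answers. It must succeed for every coloring of $X$ and every valid choice of answers. At the end, based only on the queries and answers,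 it must either output a ball of $X$ that is of the required type in $X$ for every coloring consistent with the answers, or state that $X$ contains no ball of the required type, where this statement is true for every coloring consistent with the answers. Functions. Each of the following is the minimum, over all such algorithms, of the worst-case number of queries of size $q$ asked, for $n=|X|$ balls and $c$ colors (the value is $\infty$ if no algorithm exists, which may happen for small $n$). - $MB(n,q,c)$: majority queries are used; the required type is a non-minority ball in $X$. - $MC(n,q,c)$: majority queries are used; the required type is an almost plurality ball in $X$. - $PB(n,q,c)$: plurality queries are used; the required type is a non-minority ball in $X$. - $PC(n,q,c)$: plurality queries are used; the required type is an almost plurality ball in $X$. -}

module Defs where

open import Data.Nat.Base using (ℕ; suc; _*_; _<_; _≤_)
open import Data.Fin.Base using (Fin)
open import Data.Fin.Properties using (_≟_)
open import Data.Fin.Subset using (Subset; _∈_; _∩_; ∣_∣; ⊤)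
open import Data.Vec.Base using (tabulate)
open import Data.Maybe.Base using (Maybe; just; nothing)
open import Data.Product.Base using (_×_; ∃-syntax)
open import Data.Sum.Base using (_⊎_)
open import Relation.Nullary using (¬_; does)
open import Relation.Binary.PropositionalEquality using (_≡_; _≢_)

Coloring : ℕ → ℕ → Set
Coloring n c = Fin n → Fin c

module _ {n c : ℕ} (χ : Coloring n c) where

  colorClass : Fin c → Subset n
  colorClass k = tabulate λ y → does (χ y ≟ k)

  count : Subset n → Fin c → ℕ
  count Y k = ∣ Y ∩ colorClass k ∣

BallType : ℕ → ℕ → Set₁
BallType n c = Coloring n c → Subset n → Fin n → Set

module _ {n c : ℕ} where

  Majority : BallType n c
  Majority χ Y x = x ∈ Y × ∣ Y ∣ < 2 * count χ Y (χ x)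

  NonMinority : BallType n c
  NonMinority χ Y x = x ∈ Y × ∣ Y ∣ ≤ 2 * count χ Y (χ x)

  Plurality : BallType n c
  Plurality χ Y x = x ∈ Y × (∀ k → k ≢ χ x → count χ Y k < count χ Y (χ x))

  AlmostPlurality : BallType n c
  AlmostPlurality χ Y x = Plurality χ Y x ⊎ NonMinority χ Y x

-- `nothing` is the answer NO (for a query), or the claim that no ball of the
-- required type exists (for the final output).
Reply : ℕ → Set
Reply n = Maybe (Fin n)

ValidReply : ∀ {n c} → BallType n c → Coloring n c → Subset n → Reply n → Set
ValidReply T χ Y (just x) = T χ Y x
ValidReply T χ Y nothing  = ∀ x → ¬ T χ Y x

-- An adaptive algorithm is a decision tree: it sees the coloring only through
-- the replies.
data Algorithm (n q : ℕ) : Set where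
  output : Reply n → Algorithm n q
  ask    : (Q : Subset n) → ∣ Q ∣ ≡ q → (Reply n → Algorithm n q) → Algorithm n q

-- Run T χ A o m: when queries are answered according to T under the coloring χ,
-- with the answerer free to choose among valid replies, A may end with output o
-- after exactly m queries.
data Run {n q c : ℕ} (T : BallType n c) (χ : Coloring n c) :
         Algorithm n q → Reply n → ℕ → Set where
  done : ∀ {o} → Run T χ (output o) o 0
  step : ∀ {Q size next a o m} → ValidReply T χ Q a →
         Run T χ (next a) o m → Run T χ (ask Q size next) o (suc m)

-- The output at a leaf is determined by the queries and replies leading to it,
-- and the colorings consistent with these are exactly those having a run to that
-- leaf. So quantifying over all colorings and runs says that each output is
-- correct for every coloring consistent with the replies.
Solves : ∀ {n q c} → (T R : BallType n c) → Algorithm n q → Set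
Solves {n} {q} {c} T R A =
  ∀ (χ : Coloring n c) o m → Run T χ A o m → ValidReply R χ ⊤ o

WorstCase≤ : ∀ {n q c} → BallType n c → Algorithm n q → ℕ → Set
WorstCase≤ {n} {q} {c} T A b = ∀ (χ : Coloring n c) o m → Run T χ A o m → m ≤ b

-- The minimum worst-case number of queries is at most b, i.e. some algorithm
-- attains a worst case of at most b; in particular the minimum is not ∞.
MinQueries≤ : (n q c : ℕ) → (T R : BallType n c) → ℕ → Set
MinQueries≤ n q c T R b = ∃[ A ] (Solves {n} {q} T R A × WorstCase≤ T A b)

MB≤ MC≤ PB≤ PC≤ : (n q c b : ℕ) → Set
MB≤ n q c = MinQueries≤ n q c Majority  NonMinority
MC≤ n q c = MinQueries≤ n q c Majority  AlmostPlurality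
PB≤ n q c = MinQueries≤ n q c Plurality NonMinority
PC≤ n q c = MinQueries≤ n q c Plurality AlmostPlurality

{-# OPTIONS --safe #-}

-- Keep a window of q - 1 balls. For each new ball, ask all queries within the window,
-- the new ball and a fixed bounded set Y in which some colour D is frequent; if all
-- answers are YES, discard a ball of the reply's colour from the window.
--
-- If some query Q has answer NO, then balls x and y are told apart, whenever the
-- colour of x is frequent in a bounded set S containing Q, by a query B ∪ {x} and
-- B ∪ {y} with B ⊆ S exactly one of which has answer NO. So colour classes can be
-- found one after the other, up to boundedly many balls, with O(n) queries each.
--
-- If all answers are YES, then either all discarded balls have the same colour, or
-- there are only two colours, the window is balanced and q = 2d + 1 is odd, so that
-- replies are just majority balls. They determine majority balls of sets of q + 2
-- balls, by a Helly-type argument. With these, balanced sets of q + 1 balls are split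
-- off in the same way as the window; asking all balls but one of such a set yields a
-- ball of the other colour, thus a pair of balls of different colours. Adding d - 1
-- pairs to a query asks for the majority of three balls, unless the reply lies in one
-- of the pairs; if this happens for d disjoint groups of pairs, then the replies have
-- the same colour and their partners the other one, and pairs of known orientation
-- can be used instead. Majorities with the balls o and i of a further pair, viewed as
-- colours 0 and 1, show that x ≤ y, y ≤ x or x ≠ y. In the last case compare all other
-- balls with x and y: each of them gets a known colour (in terms of that of x) until
-- one between x and y reveals the colour of x, so the number of queries is linear in
-- the number of balls whose colour becomes known. Hence the median with respect to ≤
-- is found by linear-time selection, and it is a non-minority ball.
module Submission where

open import Data.Bool.Base as Bool using (Bool; true; false; not; _∧_; _∨_; if_then_else_; T)
open import Data.Bool.Properties using (not-involutive; ∧-comm)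
  renaming (_≟_ to _≟ᵇ_)
open import Data.Empty using (⊥; ⊥-elim)
open import Data.Fin.Base as Fin using (Fin; zero; suc)
open import Data.Fin.Properties using (_≟_; nonZeroIndex; any?; all?)
import Data.Fin.Subset as Sub
import Data.Fin.Subset.Properties as SubP
open import Data.Integer.Base as ℤ using (ℤ; -[1+_]) renaming (+_ to int)
open import Data.List.Base using (List; []; _∷_; [_]; _++_; map; length; take; drop; replicate; concatMap; allFin; cartesianProduct)
import Data.List.Membership.DecPropositional as DecMem
open import Data.List.Membership.Propositional using (_∈_; _∉_; find; lose)
open import Data.List.Membership.Propositional.Properties using (∈-++⁺ˡ; ∈-++⁺ʳ; ∈-++⁻; ∈-map⁺; ∈-map⁻; ∈-∃++; ∈-allFin; ∈-concatMap⁺; ∈-cartesianProduct⁺; ∈-cartesianProduct⁻)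
open import Data.List.Properties using (length-map; length-++; length-take; length-drop; take++drop≡id; length-replicate; ++-assoc; ++-identityʳ; map-tabulate; length-tabulate)
open import Data.List.Relation.Binary.Permutation.Propositional
  using (_↭_; ↭-refl; ↭-sym; ↭-trans; ↭-prep; ↭-swap; ↭-reflexive)
import Data.List.Relation.Binary.Permutation.Propositional as Perm
open import Data.List.Relation.Binary.Permutation.Propositional.Properties as PermP
  using (∈-resp-↭; All-resp-↭; ↭-length; shift; shifts)
open import Data.List.Relation.Unary.All as All using (All; []; _∷_)
import Data.List.Relation.Unary.All.Properties as AllP
open import Data.List.Relation.Unary.AllPairs using ([]; _∷_)
open import Data.List.Relation.Unary.Any as Any using (Any; here; there)
import Data.List.Relation.Unary.Unique.DecPropositional as DecUnique
open import Data.List.Relation.Unary.Unique.Propositional using (Unique)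
import Data.List.Relation.Unary.Unique.Propositional.Properties as UniqueP
open import Data.Maybe.Base using (Maybe; just; nothing)
open import Data.Nat.Base
open import Data.Nat.Properties hiding (_≟_)
import Data.Nat.Properties as ℕₚ
open import Data.Product.Base using (Σ; ∃; ∃-syntax; _×_; _,_; proj₁; proj₂)
open import Data.Sum.Base using (_⊎_; inj₁; inj₂; [_,_]′)
open import Data.Unit.Base using (⊤; tt)
import Data.Vec.Base as Vec
import Data.Vec.Properties as VecP
open import Function.Base using (_∘_; id; case_of_)
open import Relation.Binary.Definitions using (tri<; tri≈; tri>)
open import Relation.Binary.PropositionalEquality hiding ([_])
open import Relation.Nullary using (¬_; Dec; yes; no; does; ¬?; _×-dec_; _→-dec_)
open import Relation.Nullary.Decidable using (dec-true; dec-false)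
open import Defs

-- Linear arithmetic over ℕ by Fourier–Motzkin elimination

-- The main obstacle is that the algorithm cannot observe which situation it is in. Whether a colour
-- is frequent in a sample is invisible, so a ball is compared with the whole sample and the one
-- with the largest apparent class is taken: an infrequent colour cannot produce a large class.
-- Likewise, when all answers are YES, the program does not learn whether the discarded balls share
-- a colour. So running times are proved unconditionally, and correctness only under the hypothesis
-- of two colours and a balanced window; in the other situation any discarded ball is a valid
-- output. Windows become balanced because a discarded colour had a strict lead: it keeps half of
-- the window, and loses balls there only by being discarded again. Two discarded colours thus hold
-- exactly half each, and balanced sets can be set aside without changing who is in the minority.
-- Sets of q + 2 balls are needed because a balanced window of q - 1 balls is too small for a query,
-- whereas a balanced set of q + 1 balls minus one ball is a query whose majority colour is opposite
-- to that ball's. No ball ever has a known absolute colour; colours are meant relative to a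
-- reference ball o.

data Exp : Set where
  # : ℕ → Exp
  con : ℕ → Exp
  _⊕_ : Exp → Exp → Exp
  _⊛_ : ℕ → Exp → Exp

infixl 6 _⊕_
infixr 7 _⊛_
infix 4 _≼_ _≺_ _≈_

data Rel : Set where
  _≼_ _≈_ : Exp → Exp → Rel

_≺_ : Exp → Exp → Rel
a ≺ b = con 1 ⊕ a ≼ b

module LinearArithmetic where
  Lin : Set
  Lin = List ℕ

  addL : Lin → Lin → Lin
  addL [] bs = bs
  addL (a ∷ as) [] = a ∷ as
  addL (a ∷ as) (b ∷ bs) = a + b ∷ addL as bs

  scaleL : ℕ → Lin → Lin
  scaleL c = map (c *_)

  unitL : ℕ → Lin
  unitL zero = 1 ∷ []
  unitL (suc i) = 0 ∷ unitL i

  norm : Exp → Lin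
  norm (# i) = 0 ∷ unitL i
  norm (con c) = c ∷ []
  norm (a ⊕ b) = addL (norm a) (norm b)
  norm (c ⊛ a) = scaleL c (norm a)

  atom : List ℕ → ℕ → ℕ
  atom [] _ = 0
  atom (x ∷ ρ) zero = x
  atom (x ∷ ρ) (suc i) = atom ρ i

  dot : List ℕ → Lin → ℕ
  dot ρ [] = 0
  dot [] (a ∷ as) = 0
  dot (x ∷ ρ) (a ∷ as) = a * x + dot ρ as

  ⟦_⟧ : Exp → List ℕ → ℕ
  ⟦ # i ⟧ ρ = atom ρ i
  ⟦ con c ⟧ ρ = c
  ⟦ a ⊕ b ⟧ ρ = ⟦ a ⟧ ρ + ⟦ b ⟧ ρ
  ⟦ c ⊛ a ⟧ ρ = c * ⟦ a ⟧ ρ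

  ⟦_⟧ᵣ : Rel → List ℕ → Set
  ⟦ a ≼ b ⟧ᵣ ρ = ⟦ a ⟧ ρ ≤ ⟦ b ⟧ ρ
  ⟦ a ≈ b ⟧ᵣ ρ = ⟦ a ⟧ ρ ≡ ⟦ b ⟧ ρ

  interchange : ∀ a b c d → (a + b) + (c + d) ≡ (a + c) + (b + d)
  interchange a b c d = trans (+-assoc a b (c + d)) (trans (cong (a +_)
    (trans (sym (+-assoc b c d)) (trans (cong (_+ d) (+-comm b c)) (+-assoc c b d)))) (sym (+-assoc a c (b + d))))

  dot-add : ∀ ρ as bs → dot ρ (addL as bs) ≡ dot ρ as + dot ρ bs
  dot-add ρ [] bs = refl
  dot-add ρ (a ∷ as) [] = sym (+-identityʳ _)
  dot-add [] (a ∷ as) (b ∷ bs) = refl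
  dot-add (x ∷ ρ) (a ∷ as) (b ∷ bs) = trans
    (cong₂ _+_ (*-distribʳ-+ x a b) (dot-add ρ as bs)) (interchange (a * x) (b * x) _ _)

  dot-scale : ∀ ρ c as → dot ρ (scaleL c as) ≡ c * dot ρ as
  dot-scale ρ c [] = sym (*-zeroʳ c)
  dot-scale [] c (a ∷ as) = sym (*-zeroʳ c)
  dot-scale (x ∷ ρ) c (a ∷ as) = trans (cong₂ _+_ (*-assoc c a x) (dot-scale ρ c as))
    (sym (*-distribˡ-+ c (a * x) (dot ρ as)))

  dot-unit : ∀ ρ i → dot ρ (unitL i) ≡ atom ρ i
  dot-unit [] zero = refl
  dot-unit [] (suc i) = refl
  dot-unit (x ∷ ρ) zero = trans (+-identityʳ _) (trans (+-identityʳ x) refl)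
  dot-unit (x ∷ ρ) (suc i) = dot-unit ρ i

  dot-norm : ∀ ρ e → dot (1 ∷ ρ) (norm e) ≡ ⟦ e ⟧ ρ
  dot-norm ρ (# i) = dot-unit ρ i
  dot-norm ρ (con c) = trans (+-identityʳ _) (*-identityʳ c)
  dot-norm ρ (a ⊕ b) = trans (dot-add (1 ∷ ρ) (norm a) (norm b)) (cong₂ _+_ (dot-norm ρ a) (dot-norm ρ b))
  dot-norm ρ (c ⊛ a) = trans (dot-scale (1 ∷ ρ) c (norm a)) (cong (c *_) (dot-norm ρ a))

  Ineq : Set
  Ineq = Lin × Lin

  holds : List ℕ → Ineq → Set
  holds ρ (a , b) = dot (1 ∷ ρ) a ≤ dot (1 ∷ ρ) b

  combine : List ℕ → List Ineq → Ineq
  combine (m ∷ ms) ((a , b) ∷ hs) with combine ms hs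
  ... | (c , d) = addL (scaleL m a) c , addL (scaleL m b) d
  combine _ _ = [] , []

  combine-holds : ∀ ρ ms {hs} → All (holds ρ) hs → holds ρ (combine ms hs)
  combine-holds ρ [] _ = ≤-refl
  combine-holds ρ (m ∷ ms) [] = ≤-refl
  combine-holds ρ (m ∷ ms) {(a , b) ∷ hs} (h ∷ hh) with combine ms hs | combine-holds ρ ms hh
  ... | (c , d) | ih = subst₂ _≤_
    (sym (trans (dot-add (1 ∷ ρ) (scaleL m a) c) (cong (_+ _) (dot-scale (1 ∷ ρ) m a))))
    (sym (trans (dot-add (1 ∷ ρ) (scaleL m b) d) (cong (_+ _) (dot-scale (1 ∷ ρ) m b))))
    (+-mono-≤ (*-monoʳ-≤ m h) ih)

  below : Lin → Lin → Bool
  below [] _ = true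
  below (a ∷ as) [] = (a ≡ᵇ 0) ∧ below as []
  below (a ∷ as) (b ∷ bs) = (a ≤ᵇ b) ∧ below as bs

  -- Strictness is demanded of the constant terms only, since every atom may be zero.
  strictlyBelow : Lin → Lin → Bool
  strictlyBelow as [] = false
  strictlyBelow [] (b ∷ bs) = 1 ≤ᵇ b
  strictlyBelow (a ∷ as) (b ∷ bs) = (a <ᵇ b) ∧ below as bs

  T-∧ˡ : ∀ {a b} → T (a ∧ b) → T a
  T-∧ˡ {true} _ = tt

  T-∧ʳ : ∀ {a b} → T (a ∧ b) → T b
  T-∧ʳ {true} t = t

  below-dot : ∀ ρ as bs → T (below as bs) → dot ρ as ≤ dot ρ bs
  below-dot ρ [] bs _ = z≤n
  below-dot [] (a ∷ as) bs _ = z≤n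
  below-dot (x ∷ ρ) (zero ∷ as) [] t = below-dot ρ as [] t
  below-dot (x ∷ ρ) (a ∷ as) (b ∷ bs) t =
    +-mono-≤ (*-monoˡ-≤ x (≤ᵇ⇒≤ a b (T-∧ˡ t))) (below-dot ρ as bs (T-∧ʳ {a ≤ᵇ b} t))

  strictlyBelow-dot : ∀ ρ as bs → T (strictlyBelow as bs) → dot (1 ∷ ρ) as < dot (1 ∷ ρ) bs
  strictlyBelow-dot ρ [] (suc b ∷ bs) _ = s≤s z≤n
  strictlyBelow-dot ρ (a ∷ as) (b ∷ bs) t =
    +-mono-<-≤ (*-monoˡ-< 1 (<ᵇ⇒< a b (T-∧ˡ t))) (below-dot ρ as bs (T-∧ʳ {a <ᵇ b} t))

  -- A constraint Σ aᵢxᵢ ≤ 0 (the coefficient of the constant last), together with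
  -- the multipliers deriving it from the hypotheses.
  Row : Set
  Row = List ℤ × List ℕ

  subL : Lin → Lin → List ℤ
  subL [] [] = []
  subL [] (b ∷ bs) = ℤ.- (int b) ∷ subL [] bs
  subL (a ∷ as) [] = int a ∷ subL as []
  subL (a ∷ as) (b ∷ bs) = (a ℤ.⊖ b) ∷ subL as bs

  addZ : List ℤ → List ℤ → List ℤ
  addZ [] bs = bs
  addZ (a ∷ as) [] = a ∷ as
  addZ (a ∷ as) (b ∷ bs) = a ℤ.+ b ∷ addZ as bs

  padTo : ℕ → List ℤ → List ℤ
  padTo zero as = []
  padTo (suc k) [] = int 0 ∷ padTo k []
  padTo (suc k) (a ∷ as) = a ∷ padTo k as

  rotate : List ℤ → List ℤ
  rotate [] = []
  rotate (a ∷ as) = as ++ [ a ]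

  rows : ℕ → ℕ → List Ineq → List Row
  rows n i [] = []
  rows n i ((a , b) ∷ hs) = (rotate (padTo (suc n) (subL a b)) , unitL i) ∷ rows n (suc i) hs

  data Sign : Set where
    pos neg : ℕ → Sign
    nul : Sign

  headSign : List ℤ → Sign
  headSign [] = nul
  headSign (int zero ∷ _) = nul
  headSign (int (suc k) ∷ _) = pos (suc k)
  headSign (-[1+ k ] ∷ _) = neg (suc k)

  tailZ : List ℤ → List ℤ
  tailZ [] = []
  tailZ (_ ∷ as) = as

  split : List Row → List (ℕ × Row) × List (ℕ × Row) × List Row
  split [] = [] , [] , []
  split ((a , m) ∷ rs) with headSign a | split rs
  ... | pos k | (p , n , z) = (k , tailZ a , m) ∷ p , n , z
  ... | neg k | (p , n , z) = p , (k , tailZ a , m) ∷ n , z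
  ... | nul | (p , n , z) = p , n , (tailZ a , m) ∷ z

  eliminate : List Row → List Row
  eliminate rs with split rs
  ... | (p , n , z) = z ++ concatMap (λ { (k , a , m) → map (λ { (l , b , m′) →
          addZ (map ((int l) ℤ.*_) a) (map ((int k) ℤ.*_) b) , addL (scaleL l m) (scaleL k m′) }) n }) p

  contradictory : List Row → Maybe (List ℕ)
  contradictory [] = nothing
  contradictory ((int (suc _) ∷ _ , m) ∷ rs) = just m
  contradictory (_ ∷ rs) = contradictory rs

  search : ℕ → List Row → Maybe (List ℕ)
  search zero rs = contradictory rs
  search (suc k) rs = search k (eliminate rs)

  nonneg : ℕ → ℕ → List Ineq
  nonneg i zero = []
  nonneg i (suc k) = ([] , 0 ∷ unitL i) ∷ nonneg (suc i) k

  nonneg-holds : ∀ ρ i k → All (holds ρ) (nonneg i k)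
  nonneg-holds ρ i zero = []
  nonneg-holds ρ i (suc k) = z≤n ∷ nonneg-holds ρ (suc i) k

  ineqs : List Rel → List Ineq
  ineqs [] = []
  ineqs ((a ≼ b) ∷ hs) = (norm a , norm b) ∷ ineqs hs
  ineqs ((a ≈ b) ∷ hs) = (norm a , norm b) ∷ (norm b , norm a) ∷ ineqs hs

  -- Only the check of the certificate needs a proof. The search over ℤ is unverified: its
  -- multipliers are accepted just when the combined inequality, read over ℕ, has a smaller right
  -- side coefficient by coefficient. The inequalities 0 ≤ atom are added because elimination would
  -- otherwise range over all integers.
  refuted : ℕ → List Ineq → Bool
  refuted k hs with search k (rows k 0 (hs ++ nonneg 0 k))
  ... | nothing = false
  ... | just ms with combine ms (hs ++ nonneg 0 k)
  ...   | (a , b) = strictlyBelow b a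

  refuted-sound : ∀ ρ k hs → T (refuted k hs) → All (holds ρ) hs → ⊥
  refuted-sound ρ k hs t hh with search k (rows k 0 (hs ++ nonneg 0 k))
  ... | just ms with combine ms (hs ++ nonneg 0 k)
                   | combine-holds ρ ms (AllP.++⁺ hh (nonneg-holds ρ 0 k))
  ...   | (a , b) | le = <⇒≱ (strictlyBelow-dot ρ b a t) le

  proves : ℕ → List Rel → Rel → Bool
  proves k hs (a ≼ b) = refuted k ((norm (con 1 ⊕ b) , norm a) ∷ ineqs hs)
  proves k hs (a ≈ b) = proves k hs (a ≼ b) ∧ proves k hs (b ≼ a)

  Curried : List ℕ → List Rel → Set → Set
  Curried ρ [] G = G
  Curried ρ (h ∷ hs) G = ⟦ h ⟧ᵣ ρ → Curried ρ hs G

  curry : ∀ ρ hs {G} → (All (holds ρ) (ineqs hs) → G) → Curried ρ hs G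
  curry ρ [] f = f []
  curry ρ ((a ≼ b) ∷ hs) f h = curry ρ hs λ hh →
    f (subst₂ _≤_ (sym (dot-norm ρ a)) (sym (dot-norm ρ b)) h ∷ hh)
  curry ρ ((a ≈ b) ∷ hs) f h = curry ρ hs λ hh →
    f (subst₂ _≤_ (sym (dot-norm ρ a)) (sym (dot-norm ρ b)) (≤-reflexive h)
      ∷ subst₂ _≤_ (sym (dot-norm ρ b)) (sym (dot-norm ρ a)) (≤-reflexive (sym h)) ∷ hh)

  prove≤ : ∀ ρ k hs a b → T (proves k hs (a ≼ b)) → All (holds ρ) (ineqs hs) → ⟦ a ⟧ ρ ≤ ⟦ b ⟧ ρ
  prove≤ ρ k hs a b t hh with ⟦ a ⟧ ρ ≤? ⟦ b ⟧ ρ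
  ... | yes p = p
  ... | no ¬p = ⊥-elim (refuted-sound ρ k _ t
    (subst₂ _≤_ (sym (dot-norm ρ (con 1 ⊕ b))) (sym (dot-norm ρ a)) (≰⇒> ¬p) ∷ hh))

  prove : ∀ ρ k hs g → T (proves k hs g) → All (holds ρ) (ineqs hs) → ⟦ g ⟧ᵣ ρ
  prove ρ k hs (a ≼ b) t hh = prove≤ ρ k hs a b t hh
  prove ρ k hs (a ≈ b) t hh = ≤-antisym
    (prove≤ ρ k hs a b (T-∧ˡ t) hh) (prove≤ ρ k hs b a (T-∧ʳ {proves k hs (a ≼ b)} t) hh)

  -- The implicit argument computes to the unit type when a refutation of the negated goal is found,
  -- so it is filled in without being written.
  lia : ∀ ρ hs g → {T (proves (length ρ) hs g)} → Curried ρ hs (⟦ g ⟧ᵣ ρ)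
  lia ρ hs g {t} = curry ρ hs (prove ρ (length ρ) hs g t)

  lia⊥ : ∀ ρ hs → {T (refuted (length ρ) (ineqs hs))} → Curried ρ hs ⊥
  lia⊥ ρ hs {t} = curry ρ hs (refuted-sound ρ (length ρ) _ t)

pattern x₀ = # 0
pattern x₁ = # 1
pattern x₂ = # 2
pattern x₃ = # 3
pattern x₄ = # 4
pattern x₅ = # 5
pattern x₆ = # 6
pattern x₇ = # 7
pattern x₈ = # 8

open LinearArithmetic using (lia; lia⊥)

-- Counting and permuting lists

bit : Bool → ℕ
bit true = 1
bit false = 0

private variable
  Elem Elem′ : Set

cnt : (Elem → Bool) → List Elem → ℕ
cnt p [] = 0
cnt p (x ∷ xs) = bit (p x) + cnt p xs

cnt-++ : ∀ (p : Elem → Bool) xs ys → cnt p (xs ++ ys) ≡ cnt p xs + cnt p ys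
cnt-++ p [] ys = refl
cnt-++ p (x ∷ xs) ys = trans (cong (bit (p x) +_) (cnt-++ p xs ys)) (sym (+-assoc (bit (p x)) _ _))

cnt-↭ : ∀ (p : Elem → Bool) {xs ys} → xs ↭ ys → cnt p xs ≡ cnt p ys
cnt-↭ p Perm.refl = refl
cnt-↭ p (Perm.prep x h) = cong (bit (p x) +_) (cnt-↭ p h)
cnt-↭ p (Perm.swap {xs} {ys} x y h) = trans (cong (λ m → bit (p x) + (bit (p y) + m)) (cnt-↭ p h))
  (lia (bit (p x) ∷ bit (p y) ∷ cnt p ys ∷ []) [] (x₀ ⊕ (x₁ ⊕ x₂) ≈ x₁ ⊕ (x₀ ⊕ x₂)))
cnt-↭ p (Perm.trans h k) = trans (cnt-↭ p h) (cnt-↭ p k)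

cnt-map : ∀ (p : Elem′ → Bool) (f : Elem → Elem′) xs → cnt p (map f xs) ≡ cnt (p ∘ f) xs
cnt-map p f [] = refl
cnt-map p f (x ∷ xs) = cong (bit (p (f x)) +_) (cnt-map p f xs)

cnt-cong : ∀ {p q : Elem → Bool} xs → (∀ {x} → x ∈ xs → p x ≡ q x) → cnt p xs ≡ cnt q xs
cnt-cong [] h = refl
cnt-cong (x ∷ xs) h = cong₂ _+_ (cong bit (h (here refl))) (cnt-cong xs (h ∘ there))

bit≤1 : ∀ b → bit b ≤ 1
bit≤1 true = ≤-refl
bit≤1 false = z≤n

cnt≤length : ∀ (p : Elem → Bool) xs → cnt p xs ≤ length xs
cnt≤length p [] = z≤n
cnt≤length p (x ∷ xs) = +-mono-≤ (bit≤1 (p x)) (cnt≤length p xs)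

cnt-not : ∀ (p : Elem → Bool) xs → cnt p xs + cnt (not ∘ p) xs ≡ length xs
cnt-not p [] = refl
cnt-not p (x ∷ xs) with p x
... | true = cong suc (cnt-not p xs)
... | false = trans (+-suc _ _) (cong suc (cnt-not p xs))

bit-mono : ∀ {a b} → (a ≡ true → b ≡ true) → bit a ≤ bit b
bit-mono {false} h = z≤n
bit-mono {true} {true} h = ≤-refl
bit-mono {true} {false} h = case h refl of λ ()

cnt-mono : ∀ {p q : Elem → Bool} xs → (∀ {x} → x ∈ xs → p x ≡ true → q x ≡ true) → cnt p xs ≤ cnt q xs
cnt-mono [] h = z≤n
cnt-mono (x ∷ xs) h = +-mono-≤ (bit-mono (h (here refl))) (cnt-mono xs (h ∘ there))

cnt-full : ∀ (p : Elem → Bool) xs → (∀ {x} → x ∈ xs → p x ≡ true) → cnt p xs ≡ length xs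
cnt-full p [] h = refl
cnt-full p (x ∷ xs) h rewrite h (here refl) = cong suc (cnt-full p xs (h ∘ there))

cnt-none : ∀ (p : Elem → Bool) xs → (∀ {x} → x ∈ xs → p x ≡ false) → cnt p xs ≡ 0
cnt-none p [] h = refl
cnt-none p (x ∷ xs) h rewrite h (here refl) = cnt-none p xs (h ∘ there)

cnt-witness : ∀ (p : Elem → Bool) xs → 0 < cnt p xs → ∃[ x ] x ∈ xs × p x ≡ true
cnt-witness p (x ∷ xs) h with p x in e
... | true = x , here refl , e
... | false with cnt-witness p xs h
...   | y , y∈ , py = y , there y∈ , py

cnt-pos : ∀ (p : Elem → Bool) {xs x} → x ∈ xs → p x ≡ true → 0 < cnt p xs
cnt-pos p {y ∷ ys} (here refl) e rewrite e = s≤s z≤n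
cnt-pos p {y ∷ ys} (there x∈) e = ≤-trans (cnt-pos p x∈ e) (m≤n+m _ (bit (p y)))

cnt-zero⁻ : ∀ (p : Elem → Bool) {xs} → cnt p xs ≡ 0 → ∀ {x} → x ∈ xs → p x ≡ false
cnt-zero⁻ p {xs} h {x} x∈ with p x in e
... | false = refl
... | true = ⊥-elim (<⇒≱ (cnt-pos p x∈ e) (≤-reflexive h))

∈⇒↭ : ∀ {x : Elem} {xs} → x ∈ xs → ∃[ ys ] xs ↭ x ∷ ys
∈⇒↭ x∈ with ∈-∃++ x∈
... | as , bs , refl = as ++ bs , shift _ as bs

Unique-↭ : ∀ {xs ys : List Elem} → xs ↭ ys → Unique xs → Unique ys
Unique-↭ Perm.refl u = u
Unique-↭ (Perm.prep x h) (a ∷ u) = All-resp-↭ h a ∷ Unique-↭ h u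
Unique-↭ (Perm.swap x y h) ((xy ∷ a) ∷ (b ∷ u)) =
  ((xy ∘ sym) ∷ All-resp-↭ h b) ∷ (All-resp-↭ h a ∷ Unique-↭ h u)
Unique-↭ (Perm.trans h k) u = Unique-↭ k (Unique-↭ h u)

Unique-++⁻ʳ : ∀ (xs : List Elem) {ys} → Unique (xs ++ ys) → Unique ys
Unique-++⁻ʳ [] u = u
Unique-++⁻ʳ (x ∷ xs) (_ ∷ u) = Unique-++⁻ʳ xs u

Unique-++⁻ˡ : ∀ (xs : List Elem) {ys} → Unique (xs ++ ys) → Unique xs
Unique-++⁻ˡ [] u = []
Unique-++⁻ˡ (x ∷ xs) (a ∷ u) = AllP.++⁻ˡ xs a ∷ Unique-++⁻ˡ xs u

Unique-++-disjoint : ∀ (xs : List Elem) {ys x} → Unique (xs ++ ys) → x ∈ xs → x ∉ ys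
Unique-++-disjoint (x ∷ xs) (a ∷ u) (here refl) y∈ = All.lookup (AllP.++⁻ʳ xs a) y∈ refl
Unique-++-disjoint (x ∷ xs) (a ∷ u) (there x∈) y∈ = Unique-++-disjoint xs u x∈ y∈

Unique-++⁺ : ∀ {xs ys : List Elem} → Unique xs → Unique ys → (∀ {x} → x ∈ xs → x ∉ ys) → Unique (xs ++ ys)
Unique-++⁺ u v d = UniqueP.++⁺ u v (λ { (a , b) → d a b })

Unique-∉ : ∀ {x : Elem} {xs} → Unique (x ∷ xs) → x ∉ xs
Unique-∉ (a ∷ _) x∈ = All.lookup a x∈ refl

Unique-⊆-cnt : ∀ (p : Elem → Bool) {xs} ys → Unique xs → (∀ {x} → x ∈ xs → x ∈ ys) → cnt p xs ≤ cnt p ys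
Unique-⊆-cnt p {[]} ys u s = z≤n
Unique-⊆-cnt p {x ∷ xs} ys (a ∷ u) s with ∈⇒↭ (s (here refl))
... | zs , h = ≤-trans (+-monoʳ-≤ (bit (p x)) (Unique-⊆-cnt p zs u sub)) (≤-reflexive (sym (cnt-↭ p h)))
  where
  sub : ∀ {y} → y ∈ xs → y ∈ zs
  sub y∈ with ∈-resp-↭ h (s (there y∈))
  ... | here refl = ⊥-elim (All.lookup a y∈ refl)
  ... | there y∈zs = y∈zs

filterᵇ : (Elem → Bool) → List Elem → List Elem
filterᵇ p [] = []
filterᵇ p (x ∷ xs) = if p x then x ∷ filterᵇ p xs else filterᵇ p xs

length-filterᵇ : ∀ (p : Elem → Bool) xs → length (filterᵇ p xs) ≡ cnt p xs
length-filterᵇ p [] = refl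
length-filterᵇ p (x ∷ xs) with p x
... | true = cong suc (length-filterᵇ p xs)
... | false = length-filterᵇ p xs

∈-filterᵇ⁻ : ∀ (p : Elem → Bool) {xs x} → x ∈ filterᵇ p xs → x ∈ xs × p x ≡ true
∈-filterᵇ⁻ p {y ∷ ys} x∈ with p y in e
∈-filterᵇ⁻ p {y ∷ ys} (here refl) | true = here refl , e
∈-filterᵇ⁻ p {y ∷ ys} (there x∈) | true = let a , b = ∈-filterᵇ⁻ p x∈ in there a , b
∈-filterᵇ⁻ p {y ∷ ys} x∈ | false = let a , b = ∈-filterᵇ⁻ p x∈ in there a , b

∈-filterᵇ⁺ : ∀ (p : Elem → Bool) {xs x} → x ∈ xs → p x ≡ true → x ∈ filterᵇ p xs
∈-filterᵇ⁺ p {y ∷ ys} (here refl) e rewrite e = here refl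
∈-filterᵇ⁺ p {y ∷ ys} (there x∈) e with p y
... | true = there (∈-filterᵇ⁺ p x∈ e)
... | false = ∈-filterᵇ⁺ p x∈ e

Unique-filterᵇ : ∀ (p : Elem → Bool) {xs} → Unique xs → Unique (filterᵇ p xs)
Unique-filterᵇ p [] = []
Unique-filterᵇ p {x ∷ xs} (a ∷ u) with p x
... | true = All.tabulate (λ y∈ → All.lookup a (proj₁ (∈-filterᵇ⁻ p y∈))) ∷ Unique-filterᵇ p u
... | false = Unique-filterᵇ p u

filterᵇ-↭ : ∀ (p : Elem → Bool) xs → xs ↭ filterᵇ p xs ++ filterᵇ (not ∘ p) xs
filterᵇ-↭ p [] = ↭-refl
filterᵇ-↭ p (x ∷ xs) with p x
... | true = ↭-prep x (filterᵇ-↭ p xs)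
... | false = ↭-trans (↭-prep x (filterᵇ-↭ p xs)) (↭-sym (shift x (filterᵇ p xs) _))

cnt-filterᵇ : ∀ (p q : Elem → Bool) xs → cnt p (filterᵇ q xs) ≡ cnt (λ x → q x ∧ p x) xs
cnt-filterᵇ p q [] = refl
cnt-filterᵇ p q (x ∷ xs) with q x
... | true = cong (bit (p x) +_) (cnt-filterᵇ p q xs)
... | false = cnt-filterᵇ p q xs

cnt-take : ∀ (p : Elem → Bool) k xs → cnt p (take k xs) ≤ cnt p xs
cnt-take p zero xs = z≤n
cnt-take p (suc k) [] = z≤n
cnt-take p (suc k) (x ∷ xs) = +-monoʳ-≤ (bit (p x)) (cnt-take p k xs)

take-⊆ : ∀ k {xs : List Elem} {x} → x ∈ take k xs → x ∈ xs
take-⊆ (suc k) {y ∷ ys} (here e) = here e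
take-⊆ (suc k) {y ∷ ys} (there x∈) = there (take-⊆ k x∈)

length-take≤ : ∀ k (xs : List Elem) → k ≤ length xs → length (take k xs) ≡ k
length-take≤ k xs h = trans (length-take k xs) (m≤n⇒m⊓n≡m h)

tuples : ℕ → List Elem → List (List Elem)
tuples zero xs = [ [] ]
tuples (suc k) xs = concatMap (λ ys → map (_∷ ys) xs) (tuples k xs)

∈-tuples : ∀ k {xs : List Elem} {ys} → length ys ≡ k → (∀ {y} → y ∈ ys → y ∈ xs) → ys ∈ tuples k xs
∈-tuples zero {ys = []} e s = here refl
∈-tuples (suc k) {xs} {y ∷ ys} e s =
  ∈-concatMap⁺ (λ zs → map (_∷ zs) xs) (lose (∈-tuples k (suc-injective e) (s ∘ there)) (∈-map⁺ (_∷ ys) (s (here refl))))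

length-concatMap : ∀ (f : Elem → List Elem′) m xs → (∀ x → length (f x) ≡ m) → length (concatMap f xs) ≡ length xs * m
length-concatMap f m [] h = refl
length-concatMap f m (x ∷ xs) h = trans (length-++ (f x)) (cong₂ _+_ (h x) (length-concatMap f m xs h))

length-tuples : ∀ k (xs : List Elem) → length (tuples k xs) ≡ length xs ^ k
length-tuples zero xs = refl
length-tuples (suc k) xs = trans (length-concatMap _ (length xs) (tuples k xs) (λ ys → length-map _ xs))
  (trans (cong (_* length xs) (length-tuples k xs)) (*-comm (length xs ^ k) (length xs)))

-- This is the passage from colours back to balls: queries are designed as lists of colours, and any
-- list whose multiplicities are available can be asked with actual balls.
realise : ∀ {c} (f : Elem → Fin c) (V : List (Fin c)) S →
  (∀ k → cnt (λ l → does (l ≟ k)) V ≤ cnt (λ s → does (f s ≟ k)) S) →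
  ∃[ B ] ∃[ R ] S ↭ B ++ R × map f B ≡ V
realise f [] S h = [] , S , ↭-refl , refl
realise f (v ∷ V) S h with cnt-witness (λ s → does (f s ≟ v)) S
    (≤-trans (cnt-pos (λ l → does (l ≟ v)) {v ∷ V} (here refl) (dec-true (v ≟ v) refl)) (h v))
... | s , s∈ , e with f s ≟ v
...   | yes refl with ∈⇒↭ s∈
...     | S′ , p with realise f V S′ (λ k → +-cancelˡ-≤ (bit (does (v ≟ k))) _ _
                        (≤-trans (h k) (≤-reflexive (cnt-↭ (λ s → does (f s ≟ k)) p))))
...       | B , R , p′ , refl = s ∷ B , R , ↭-trans p (↭-prep s p′) , refl

-- Queries as duplicate-free lists of balls

mult : ∀ {c} → Fin c → List (Fin c) → ℕ
mult k V = cnt (λ l → does (l ≟ k)) V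

has : ∀ {n c} → Coloring n c → Fin c → Fin n → Bool
has χ k x = does (χ x ≟ k)

mult-map : ∀ {n c} (χ : Coloring n c) k L → mult k (map χ L) ≡ cnt (has χ k) L
mult-map χ k L = cnt-map (λ l → does (l ≟ k)) χ L

mult-∈ : ∀ {c} {k : Fin c} {V} → k ∈ V → 0 < mult k V
mult-∈ {k = k} k∈ = cnt-pos _ k∈ (dec-true (k ≟ k) refl)

∈-mult : ∀ {c} {k : Fin c} {V} → 0 < mult k V → k ∈ V
∈-mult {k = k} {V} h with cnt-witness _ V h
... | l , l∈ , e with l ≟ k
...   | yes refl = l∈

toSet : ∀ {n} → List (Fin n) → Sub.Subset n
toSet L = Vec.tabulate (λ x → does (DecMem._∈?_ _≟_ x L))

map-suc-allFin : ∀ n → allFin (suc n) ≡ zero ∷ map suc (allFin n)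
map-suc-allFin n = cong (zero ∷_) (sym (map-tabulate id suc))

size-∩ : ∀ {n} (f g : Fin n → Bool) →
  Sub.∣ Vec.tabulate f Sub.∩ Vec.tabulate g ∣ ≡ cnt (λ x → f x ∧ g x) (allFin n)
size-∩ {zero} f g = refl
size-∩ {suc n} f g = trans (lemma (f zero ∧ g zero) (Vec.tabulate (f ∘ suc) Sub.∩ Vec.tabulate (g ∘ suc))) (sym (trans (cong (cnt _) (map-suc-allFin n))
  (cong (bit (f zero ∧ g zero) +_) (trans (cnt-map _ suc (allFin n)) (sym (size-∩ (f ∘ suc) (g ∘ suc)))))))
  where
  lemma : ∀ b {m} (v : Sub.Subset m) → Sub.∣ b Vec.∷ v ∣ ≡ bit b + Sub.∣ v ∣
  lemma true v = refl
  lemma false v = refl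

∈-toSet⁻ : ∀ {n} {L : List (Fin n)} {x} → x Sub.∈ toSet L → x ∈ L
∈-toSet⁻ {L = L} {x} h with DecMem._∈?_ _≟_ x L in e
... | yes p = p
... | no _ with trans (sym (VecP.[]=⇒lookup h)) (trans (VecP.lookup∘tabulate _ x) (cong does e))
...   | ()

∈-toSet⁺ : ∀ {n} {L : List (Fin n)} {x} → x ∈ L → x Sub.∈ toSet L
∈-toSet⁺ {L = L} {x} h = VecP.lookup⇒[]= x _ (trans (VecP.lookup∘tabulate _ x) (dec-true (DecMem._∈?_ _≟_ x L) h))

module _ {n : ℕ} {L : List (Fin n)} (u : Unique L) where
  private
    mem : Fin n → Bool
    mem x = does (DecMem._∈?_ _≟_ x L)

    mem⁻ : ∀ x → mem x ≡ true → x ∈ L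
    mem⁻ x e with DecMem._∈?_ _≟_ x L
    ... | yes p = p

    cnt-mem : ∀ p → cnt (λ x → mem x ∧ p x) (allFin n) ≡ cnt p L
    cnt-mem p = trans (sym (cnt-filterᵇ p mem (allFin n))) (≤-antisym
      (Unique-⊆-cnt p L (Unique-filterᵇ mem (UniqueP.allFin⁺ n)) (λ {x} x∈ → mem⁻ x (proj₂ (∈-filterᵇ⁻ mem {allFin n} x∈))))
      (Unique-⊆-cnt p _ u (λ {x} x∈ → ∈-filterᵇ⁺ mem (∈-allFin x) (dec-true (DecMem._∈?_ _≟_ x L) x∈))))

  count-toSet : ∀ {c} (χ : Coloring n c) k → count χ (toSet L) k ≡ mult k (map χ L)
  count-toSet χ k = trans (size-∩ mem (has χ k)) (trans (cnt-mem (has χ k)) (sym (mult-map χ k L)))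

  size-toSet : Sub.∣ toSet L ∣ ≡ length L
  size-toSet = trans (cong Sub.∣_∣ (sym (SubP.∩-idem (toSet L))))
    (trans (size-∩ mem mem) (trans (cnt-mem mem) (cnt-full mem L (λ {x} x∈ → dec-true (DecMem._∈?_ _≟_ x L) x∈))))

count-⊤ : ∀ {n c} (χ : Coloring n c) k → count χ Sub.⊤ k ≡ cnt (has χ k) (allFin n)
count-⊤ {n} χ k = trans (cong Sub.∣_∣ (SubP.∩-identityˡ (colorClass χ k)))
  (trans (cong Sub.∣_∣ (sym (SubP.∩-idem (colorClass χ k))))
  (trans (size-∩ (has χ k) (has χ k)) (cnt-cong (allFin n) (λ {x} _ → idem (has χ k x)))))
  where
  idem : ∀ b → b ∧ b ≡ b
  idem true = refl
  idem false = refl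

Strict : ∀ {c} → List (Fin c) → Fin c → Set
Strict V k = ∀ l → l ≢ k → mult l V < mult k V

Absolute : ∀ {c} → List (Fin c) → Fin c → Set
Absolute V k = length V < 2 * mult k V

mult-two : ∀ {c} {k l : Fin c} V → k ≢ l → mult k V + mult l V ≤ length V
mult-two {k = k} {l} V k≢l = ≤-trans (+-monoʳ-≤ (mult k V) (cnt-mono V λ {x} _ → excl x)) (≤-reflexive (cnt-not _ V))
  where
  excl : ∀ x → does (x ≟ l) ≡ true → not (does (x ≟ k)) ≡ true
  excl x e with x ≟ l | x ≟ k
  ... | yes refl | yes p = ⊥-elim (k≢l (sym p))
  ... | yes _ | no _ = refl

Absolute⇒Strict : ∀ {c} {V : List (Fin c)} {k} → Absolute V k → Strict V k
Absolute⇒Strict {V = V} {k} h l l≢k = lia (mult l V ∷ mult k V ∷ length V ∷ [])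
  ((x₂ ≺ 2 ⊛ x₁) ∷ (x₁ ⊕ x₀ ≼ x₂) ∷ []) (x₀ ≺ x₁) h (mult-two V (l≢k ∘ sym))

None : ∀ {c} → (List (Fin c) → Fin c → Set) → List (Fin c) → Set
None Wins V = ∀ {k} → k ∈ V → ¬ Wins V k

-- The multiplicity of `D` in `B` is left free, because `D` will be a colour of which the sample has
-- plenty; every other colour must be taken from the balls already forming `V`.
Detects : ∀ {c} → (List (Fin c) → Fin c → Set) → Fin c → Fin c → List (Fin c) → Set
Detects Wins D E V = ∃[ B ] suc (length B) ≡ length V × (∀ k → k ≢ D → mult k B ≤ mult k V) ×
  ((None Wins (D ∷ B) × ¬ None Wins (E ∷ B)) ⊎ (¬ None Wins (D ∷ B) × None Wins (E ∷ B)))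

-- A reply rule depends on a query only through the list of its colours.
record Rule (c : ℕ) : Set₁ where
  field
    Type    : ∀ {n} → BallType n c
    Wins    : List (Fin c) → Fin c → Set
    wins⁻   : ∀ {n} {χ : Coloring n c} {L x} → Unique L → Type χ (toSet L) x → x ∈ L × Wins (map χ L) (χ x)
    wins⁺   : ∀ {n} {χ : Coloring n c} {L x} → Unique L → x ∈ L → Wins (map χ L) (χ x) → Type χ (toSet L) x
    -- The rule is squeezed between absolute majority and strict plurality. With two colours and odd
    -- `q` these bounds coincide, which is why both rules can then be treated alike.
    fromAbs : ∀ {V k} → Absolute V k → Wins V k
    strict  : ∀ {V k} → Wins V k → Strict V k
    perm    : ∀ {V V′ k} → V ↭ V′ → Wins V k → Wins V′ k

  NO : List (Fin c) → Set
  NO = None Wins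

  field
    -- Assuming `E` absent is harmless: if `D` and `E` could not be told apart, the balls of colour
    -- `E` could be traded away beforehand.
    detect : ∀ {V} D E → D ≢ E → 2 ≤ length V → mult E V ≡ 0 → NO V → Detects Wins D E V

-- Programs asking queries, their running time and postconditions

data Tree (n q : ℕ) (A : Set) : Set where
  ret : A → Tree n q A
  ask : (Q : Sub.Subset n) → Sub.∣ Q ∣ ≡ q → (Reply n → Tree n q A) → Tree n q A

infixl 1 _>>=_
_>>=_ : ∀ {n q} {A B : Set} → Tree n q A → (A → Tree n q B) → Tree n q B
ret a >>= f = f a
ask Q s k >>= f = ask Q s (λ a → k a >>= f)

toAlgorithm : ∀ {n q} → Tree n q (Reply n) → Algorithm n q
toAlgorithm (ret a) = output a
toAlgorithm (ask Q s k) = ask Q s (λ a → toAlgorithm (k a))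

-- Distinctness and size are tested when the program runs, so programs need not carry proofs of
-- them; an illegal list costs no query.
query : ∀ {n q} → List (Fin n) → Tree n q (Maybe (Reply n))
query {q = q} L with DecUnique.unique? _≟_ L | length L ℕₚ.≟ q
... | yes u | yes e = ask (toSet L) (trans (size-toSet u) e) (ret ∘ just)
... | _ | _ = ret nothing

findNO : ∀ {n q} → List (List (Fin n)) → Tree n q (Maybe (List (Fin n)))
findNO [] = ret nothing
findNO (L ∷ Ls) = query L >>= λ where
  (just nothing) → ret (just L)
  _ → findNO Ls

module Runs {c : ℕ} (rule : Rule c) {n q : ℕ} (χ : Coloring n c) where
  open Rule rule

  -- Cost and postcondition are tracked together over all valid replies under a fixed colouring. The
  -- tree itself does not mention the colouring, so proving this for every `χ` gives a worst-case
  -- bound.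
  Sat : ∀ {A : Set} → Tree n q A → ℕ → (A → Set) → Set
  Sat (ret a) b φ = φ a
  Sat (ask Q s k) zero φ = ⊥
  Sat (ask Q s k) (suc b) φ = ∀ a → ValidReply Type χ Q a → Sat (k a) b φ

  Sat-mono : ∀ {A : Set} (t : Tree n q A) {b b′} {φ ψ : A → Set} →
    b ≤ b′ → Sat t b φ → (∀ a → φ a → ψ a) → Sat t b′ ψ
  Sat-mono (ret a) _ s f = f a s
  Sat-mono (ask Q _ k) {suc b} (s≤s b≤) s f a v = Sat-mono (k a) b≤ (s a v) f

  Sat-bind : ∀ {A B : Set} (t : Tree n q A) {k : A → Tree n q B} {b b′} {φ : A → Set} {ψ : B → Set} →
    Sat t b φ → (∀ a → φ a → Sat (k a) b′ ψ) → Sat (t >>= k) (b + b′) ψ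
  Sat-bind (ret a) {k} {b} {b′} s f = Sat-mono (k a) (m≤n+m b′ b) (f a s) (λ _ h → h)
  Sat-bind (ask Q _ k) {b = suc b} s f a v = Sat-bind (k a) (s a v) f

  Sat-run : ∀ {t : Tree n q (Reply n)} {b φ o m} → Sat t b φ → Run Type χ (toAlgorithm t) o m → φ o × m ≤ b
  Sat-run {ret a} s done = s , z≤n
  Sat-run {ask Q _ k} {suc b} s (step {a = a} v r) = let p , m≤ = Sat-run (s a v) r in p , s≤s m≤

  Legal : List (Fin n) → Set
  Legal L = Unique L × length L ≡ q

  Answer : List (Fin n) → Maybe (Reply n) → Set
  Answer L nothing = ¬ Legal L
  Answer L (just nothing) = Legal L × NO (map χ L)
  Answer L (just (just x)) = Legal L × x ∈ L × Wins (map χ L) (χ x)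

  Sat-query : ∀ L → Sat (query L) 1 (Answer L)
  Sat-query L with DecUnique.unique? _≟_ L | length L ℕₚ.≟ q
  ... | no ¬u | _ = λ { (u , _) → ¬u u }
  ... | yes _ | no ¬e = λ { (_ , e) → ¬e e }
  ... | yes u | yes e = λ where
    nothing v → (u , e) , λ k∈ w → case ∈-map⁻ χ k∈ of λ { (x , x∈ , refl) → v x (wins⁺ u x∈ w) }
    (just x) v → (u , e) , wins⁻ u v

  FoundNO : List (List (Fin n)) → Maybe (List (Fin n)) → Set
  FoundNO Ls (just Q) = Legal Q × NO (map χ Q)
  FoundNO Ls nothing = ∀ {L} → L ∈ Ls → Legal L → ¬ NO (map χ L)

  Sat-findNO : ∀ Ls → Sat (findNO Ls) (length Ls) (FoundNO Ls)
  Sat-findNO [] ()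
  Sat-findNO (L ∷ Ls) = Sat-bind (query L) (Sat-query L) λ where
    (just nothing) h → h
    nothing h → Sat-mono (findNO Ls) ≤-refl (Sat-findNO Ls) λ where
      (just Q) g → g
      nothing g (here refl) l → ⊥-elim (h l)
      nothing g (there L∈) l → g L∈ l
    (just (just x)) (_ , x∈ , w) → Sat-mono (findNO Ls) ≤-refl (Sat-findNO Ls) λ where
      (just Q) g → g
      nothing g (here refl) l none → none (∈-map⁺ χ x∈) w
      nothing g (there L∈) l → g L∈ l

  Fits : List (Fin c) → List (Fin n) → Set
  Fits V S = ∀ k → mult k V ≤ cnt (has χ k) S

  -- Stated for lists of colours rather than of balls, since contradictions arise from constructed
  -- colour patterns containing a tie.
  Pass : List (Fin n) → Set
  Pass S = ∀ V → length V ≡ q → Fits V S → ¬ NO V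

  pass : ∀ {S} → Unique S → FoundNO (tuples q S) nothing → Pass S
  pass {S} u h V e fits none with realise χ V S fits
  ... | B , R , p , refl = h (∈-tuples q len sub) (Unique-++⁻ˡ B (Unique-↭ p u) , len) none
    where
    len = trans (sym (length-map χ B)) e
    sub : ∀ {y} → y ∈ B → y ∈ S
    sub y∈ = ∈-resp-↭ (↭-sym p) (∈-++⁺ˡ y∈)

-- Lists of colours

halve : ∀ m → ∃[ h ] (m ≡ h + h ⊎ m ≡ suc (h + h))
halve zero = 0 , inj₁ refl
halve (suc m) with halve m
... | h , inj₁ e = h , inj₂ (cong suc e)
... | h , inj₂ e = suc h , inj₁ (cong suc (trans e (sym (+-suc h h))))

maximum : ∀ {A : Set} (f : A → ℕ) x xs → ∃[ y ] y ∈ x ∷ xs × (∀ {z} → z ∈ x ∷ xs → f z ≤ f y)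
maximum f x [] = x , here refl , λ { (here refl) → ≤-refl }
maximum f x (y ∷ ys) with maximum f y ys
... | m , m∈ , h with f x ≤? f m
...   | yes le = m , there m∈ , λ { (here refl) → le ; (there z∈) → h z∈ }
...   | no gt = x , here refl , λ { (here refl) → ≤-refl ; (there z∈) → ≤-trans (h z∈) (<⇒≤ (≰⇒> gt)) }

module _ {c : ℕ} where

  mult-∷-same : ∀ (k : Fin c) V → mult k (k ∷ V) ≡ suc (mult k V)
  mult-∷-same k V = cong (λ b → bit b + mult k V) (dec-true (k ≟ k) refl)

  mult-∷-other : ∀ {k l : Fin c} V → k ≢ l → mult k (l ∷ V) ≡ mult k V
  mult-∷-other {k} {l} V k≢l = cong (λ b → bit b + mult k V) (dec-false (l ≟ k) (k≢l ∘ sym))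

  mult-replicate-same : ∀ m (k : Fin c) → mult k (replicate m k) ≡ m
  mult-replicate-same zero k = refl
  mult-replicate-same (suc m) k = trans (mult-∷-same k (replicate m k)) (cong suc (mult-replicate-same m k))

  mult-replicate-other : ∀ m {k l : Fin c} → k ≢ l → mult k (replicate m l) ≡ 0
  mult-replicate-other zero _ = refl
  mult-replicate-other (suc m) k≢l = trans (mult-∷-other (replicate m _) k≢l) (mult-replicate-other m k≢l)

  blend : ℕ → Fin c → ℕ → Fin c → List (Fin c) → List (Fin c)
  blend a D b E L = replicate a D ++ replicate b E ++ L

  length-blend : ∀ a D b E L → length (blend a D b E L) ≡ a + (b + length L)
  length-blend a D b E L = trans (length-++ (replicate a D)) (cong₂ _+_ (length-replicate a)
    (trans (length-++ (replicate b E)) (cong (_+ length L) (length-replicate b))))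

  private
    mult-blend : ∀ l a D b E L → mult l (blend a D b E L) ≡ mult l (replicate a D) + (mult l (replicate b E) + mult l L)
    mult-blend l a D b E L = trans (cnt-++ _ (replicate a D) _) (cong (mult l (replicate a D) +_) (cnt-++ _ (replicate b E) L))

  mult-blend₁ : ∀ a {D} b {E} L → D ≢ E → mult D (blend a D b E L) ≡ a + mult D L
  mult-blend₁ a {D} b {E} L D≢E = trans (mult-blend D a D b E L) (cong₂ _+_ (mult-replicate-same a D)
    (cong (_+ mult D L) (mult-replicate-other b D≢E)))

  mult-blend₂ : ∀ a {D} b {E} L → D ≢ E → mult E (blend a D b E L) ≡ b + mult E L
  mult-blend₂ a {D} b {E} L D≢E = trans (mult-blend E a D b E L) (cong₂ _+_ (mult-replicate-other a (D≢E ∘ sym))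
    (cong (_+ mult E L) (mult-replicate-same b E)))

  mult-blend₃ : ∀ a {D} b {E} L {l} → l ≢ D → l ≢ E → mult l (blend a D b E L) ≡ mult l L
  mult-blend₃ a {D} b {E} L {l} n₁ n₂ = trans (mult-blend l a D b E L)
    (cong₂ (λ x y → x + (y + mult l L)) (mult-replicate-other a n₁) (mult-replicate-other b n₂))

  others : Fin c → Fin c → List (Fin c) → List (Fin c)
  others D E = filterᵇ (λ l → not (does (l ≟ D)) ∧ not (does (l ≟ E)))

  mult-others : ∀ D E V l → mult l (others D E V) ≤ mult l V
  mult-others D E V l = ≤-trans (≤-reflexive (cnt-filterᵇ _ _ V))
    (cnt-mono V λ {x} _ e → proj₂ (∧-true {not (does (x ≟ D)) ∧ not (does (x ≟ E))} e))
    where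
    ∧-true : ∀ {a b} → a ∧ b ≡ true → a ≡ true × b ≡ true
    ∧-true {true} {true} _ = refl , refl

  others-D : ∀ D E V → mult D (others D E V) ≡ 0
  others-D D E V = cnt-none _ _ λ {x} x∈ → lemma x (proj₂ (∈-filterᵇ⁻ _ {V} x∈))
    where
    lemma : ∀ x → not (does (x ≟ D)) ∧ not (does (x ≟ E)) ≡ true → does (x ≟ D) ≡ false
    lemma x e with x ≟ D
    ... | no _ = refl

  others-E : ∀ D E V → mult E (others D E V) ≡ 0
  others-E D E V = cnt-none _ _ λ {x} x∈ → lemma x (proj₂ (∈-filterᵇ⁻ _ {V} x∈))
    where
    lemma : ∀ x → not (does (x ≟ D)) ∧ not (does (x ≟ E)) ≡ true → does (x ≟ E) ≡ false
    lemma x e with x ≟ D | x ≟ E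
    ... | no _ | no _ = refl

  length-others : ∀ {D E} V → D ≢ E → length (others D E V) + (mult D V + mult E V) ≡ length V
  length-others [] _ = refl
  length-others {D} {E} (x ∷ V) D≢E with x ≟ D | x ≟ E | length-others {D} {E} V D≢E
  ... | yes refl | yes refl | _ = ⊥-elim (D≢E refl)
  ... | yes _ | no _ | ih = trans (+-suc _ _) (cong suc ih)
  ... | no _ | yes _ | ih = trans (cong (length (others D E V) +_) (+-suc (mult D V) (mult E V))) (trans (+-suc _ _) (cong suc ih))
  ... | no _ | no _ | ih = cong suc ih

  -- Colours other than `D` and `E` occur at most as often as in `V`, so wherever `V` can be asked,
  -- this list can be too once `D` and `E` are supplied.
  remix : ℕ → Fin c → ℕ → Fin c → ℕ → List (Fin c) → List (Fin c)
  remix a D b E r V = blend a D b E (take r (others D E V))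

  module _ (a : ℕ) {D : Fin c} (b : ℕ) {E : Fin c} (r : ℕ) (V : List (Fin c)) (D≢E : D ≢ E) where
    private
      small : ∀ l → mult l (take r (others D E V)) ≤ mult l (others D E V)
      small l = cnt-take _ r (others D E V)

    remix-D : mult D (remix a D b E r V) ≡ a
    remix-D = trans (mult-blend₁ a b (take r (others D E V)) D≢E) (trans (cong (a +_) (n≤0⇒n≡0 (≤-trans (small D) (≤-reflexive (others-D D E V))))) (+-identityʳ a))

    remix-E : mult E (remix a D b E r V) ≡ b
    remix-E = trans (mult-blend₂ a b (take r (others D E V)) D≢E) (trans (cong (b +_) (n≤0⇒n≡0 (≤-trans (small E) (≤-reflexive (others-E D E V))))) (+-identityʳ b))

    remix-other : ∀ {l} → l ≢ D → l ≢ E → mult l (remix a D b E r V) ≤ mult l V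
    remix-other {l} n₁ n₂ = ≤-trans (≤-reflexive (mult-blend₃ a b (take r (others D E V)) n₁ n₂)) (≤-trans (small l) (mult-others D E V l))

    length-remix : r + (mult D V + mult E V) ≤ length V → length (remix a D b E r V) ≡ a + (b + r)
    length-remix h = trans (length-blend a D b E _) (cong (λ m → a + (b + m)) (length-take≤ r _
      (+-cancelʳ-≤ (mult D V + mult E V) _ _ (≤-trans h (≤-reflexive (sym (length-others V D≢E)))))))

  mult-absent : ∀ {k : Fin c} {V} → k ∉ V → mult k V ≡ 0
  mult-absent {k} {V} k∉ with mult k V in e
  ... | zero = refl
  ... | suc _ = ⊥-elim (k∉ (∈-mult (subst (0 <_) (sym e) (s≤s z≤n))))

  most : ∀ (V : List (Fin c)) → 0 < length V → ∃[ k ] (∀ l → mult l V ≤ mult k V)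
  most (x ∷ xs) _ with maximum (λ k → mult k (x ∷ xs)) x xs
  ... | k , _ , h = k , λ l → case DecMem._∈?_ _≟_ l (x ∷ xs) of λ where
    (yes l∈) → h l∈
    (no l∉) → ≤-trans (≤-reflexive (mult-absent {V = x ∷ xs} l∉)) z≤n

module _ {c : ℕ} (rule : Rule c) where
  open Rule rule

  tie-NO : ∀ {D E V} → D ≢ E → mult D V ≡ mult E V → (∀ l → mult l V ≤ mult D V) → NO V
  tie-NO {D} {E} {V} D≢E e h {k} _ w with k ≟ D
  ... | yes refl = <⇒≱ (strict w E (D≢E ∘ sym)) (≤-reflexive e)
  ... | no k≢D = <⇒≱ (strict w D (k≢D ∘ sym)) (h k)

  module _ {q : ℕ} {s : Fin c → ℕ} (pass : ∀ V → length V ≡ q → (∀ k → mult k V ≤ s k) → ¬ NO V)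
           {D : Fin c} (many : q ≤ s D) where

    -- Otherwise trading balls of the query for balls of colour D would lead to a tie of D and E.
    foreign-reply : ∀ {E V} → E ≢ D → length V ≡ q → (∀ k → mult k V ≤ s k) → Strict V E →
      ∃[ d ] q ≡ suc (d + d) × suc d ≤ mult E V
    foreign-reply {E} {V} E≢D len fits str with 2 * mult E V ≤? q
    ... | yes le = ⊥-elim (pass V* len* fits* (tie-NO D≢E (trans eD (sym eE)) top))
      where
      D≢E : D ≢ E
      D≢E = E≢D ∘ sym
      e = mult E V
      -- With `e` balls each, `D` and `E` tie at the top. Enough other balls exist because `D` has
      -- fewer than `e` balls in `V`.
      V* = remix e D e E (q ∸ 2 * e) V
      eD : mult D V* ≡ e
      eD = remix-D e e (q ∸ 2 * e) V D≢E
      eE : mult E V* ≡ e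
      eE = remix-E e e (q ∸ 2 * e) V D≢E
      len* : length V* ≡ q
      len* = trans (length-remix e e (q ∸ 2 * e) V D≢E (lia (q ∸ 2 * e ∷ mult D V ∷ e ∷ length V ∷ q ∷ [])
          ((x₀ ⊕ 2 ⊛ x₂ ≈ x₄) ∷ (x₁ ≺ x₂) ∷ (x₃ ≈ x₄) ∷ []) (x₀ ⊕ (x₁ ⊕ x₂) ≼ x₃) (m∸n+n≡m le) (str D D≢E) len))
        (lia (q ∸ 2 * e ∷ e ∷ q ∷ []) ((x₀ ⊕ 2 ⊛ x₁ ≈ x₂) ∷ []) (x₁ ⊕ (x₁ ⊕ x₀) ≈ x₂) (m∸n+n≡m le))
      fits* : ∀ k → mult k V* ≤ s k
      fits* k with k ≟ D | k ≟ E
      ... | yes refl | _ = ≤-trans (≤-reflexive eD) (≤-trans (lia (e ∷ q ∷ []) ((2 ⊛ x₀ ≼ x₁) ∷ []) (x₀ ≼ x₁) le) many)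
      ... | no _ | yes refl = ≤-trans (≤-reflexive eE) (fits E)
      ... | no n₁ | no n₂ = ≤-trans (remix-other e e (q ∸ 2 * e) V D≢E n₁ n₂) (fits k)
      top : ∀ l → mult l V* ≤ mult D V*
      top l with l ≟ D | l ≟ E
      ... | yes refl | _ = ≤-refl
      ... | no _ | yes refl = ≤-reflexive (trans eE (sym eD))
      ... | no n₁ | no n₂ = ≤-trans (remix-other e e (q ∸ 2 * e) V D≢E n₁ n₂)
                              (≤-trans (<⇒≤ (str l n₂)) (≤-reflexive (sym eD)))
    ... | no gt with halve q
    ...   | d , inj₂ e = d , e , lia (d ∷ mult E V ∷ q ∷ []) ((x₂ ≈ con 1 ⊕ (x₀ ⊕ x₀)) ∷ (x₂ ≺ 2 ⊛ x₁) ∷ [])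
                                   (x₀ ≺ x₁) e (≰⇒> gt)
    -- `E` has more than half of an even query, so half of it can be given to `D` and half to `E`:
    -- again a tie. Only odd `q` survives.
    ...   | h , inj₁ e = ⊥-elim (pass V* len* fits* (tie-NO D≢E (trans eD (sym eE)) top))
      where
      D≢E : D ≢ E
      D≢E = E≢D ∘ sym
      V* = blend h D h E []
      eD : mult D V* ≡ h
      eD = trans (mult-blend₁ h h [] D≢E) (+-identityʳ h)
      eE : mult E V* ≡ h
      eE = trans (mult-blend₂ h h [] D≢E) (+-identityʳ h)
      len* : length V* ≡ q
      len* = trans (length-blend h D h E []) (trans (cong (h +_) (+-identityʳ h)) (sym e))
      rest : ∀ {l} → l ≢ D → l ≢ E → mult l V* ≡ 0
      rest n₁ n₂ = mult-blend₃ h h [] n₁ n₂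
      fits* : ∀ k → mult k V* ≤ s k
      fits* k with k ≟ D | k ≟ E
      ... | yes refl | _ = ≤-trans (≤-reflexive eD) (≤-trans (lia (h ∷ q ∷ []) ((x₁ ≈ x₀ ⊕ x₀) ∷ []) (x₀ ≼ x₁) e) many)
      ... | no _ | yes refl = ≤-trans (≤-reflexive eE) (≤-trans
              (lia (h ∷ mult E V ∷ q ∷ []) ((x₂ ≈ x₀ ⊕ x₀) ∷ (x₂ ≺ 2 ⊛ x₁) ∷ []) (x₀ ≼ x₁) e (≰⇒> gt)) (fits E))
      ... | no n₁ | no n₂ = ≤-trans (≤-reflexive (rest n₁ n₂)) z≤n
      top : ∀ l → mult l V* ≤ mult D V*
      top l with l ≟ D | l ≟ E
      ... | yes refl | _ = ≤-refl
      ... | no _ | yes refl = ≤-reflexive (trans eE (sym eD))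
      ... | no n₁ | no n₂ = ≤-trans (≤-reflexive (rest n₁ n₂)) z≤n

    -- Otherwise d balls of `D`, d of `E` and one of `F` form a query of size 2d + 1 tied between
    -- `D` and `E`; `1 ≤ d` keeps `F` from winning it.
    no-third-colour : ∀ {E F d} → E ≢ D → F ≢ D → F ≢ E → q ≡ suc (d + d) → 1 ≤ d → d ≤ s E → s F ≡ 0
    no-third-colour {E} {F} {d} E≢D F≢D F≢E e d≥1 enough with s F in sF
    ... | zero = refl
    ... | suc _ = ⊥-elim (pass V* len* fits* (tie-NO D≢E (trans eD (sym eE)) top))
      where
      D≢E : D ≢ E
      D≢E = E≢D ∘ sym
      V* = blend d D d E (F ∷ [])
      eD : mult D V* ≡ d
      eD = trans (mult-blend₁ d d (F ∷ []) D≢E) (trans (cong (d +_) (mult-∷-other [] (F≢D ∘ sym))) (+-identityʳ d))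
      eE : mult E V* ≡ d
      eE = trans (mult-blend₂ d d (F ∷ []) D≢E) (trans (cong (d +_) (mult-∷-other [] (F≢E ∘ sym))) (+-identityʳ d))
      len* : length V* ≡ q
      len* = trans (length-blend d D d E _) (lia (d ∷ q ∷ []) ((x₁ ≈ con 1 ⊕ (x₀ ⊕ x₀)) ∷ []) (x₀ ⊕ (x₀ ⊕ con 1) ≈ x₁) e)
      rest : ∀ {l} → l ≢ D → l ≢ E → mult l V* ≤ 1
      rest n₁ n₂ = ≤-trans (≤-reflexive (mult-blend₃ d d (F ∷ []) n₁ n₂)) (cnt≤length (λ l → does (l ≟ _)) (F ∷ []))
      fits* : ∀ k → mult k V* ≤ s k
      fits* k with k ≟ D | k ≟ E | k ≟ F
      ... | yes refl | _ | _ = ≤-trans (≤-reflexive eD) (≤-trans (lia (d ∷ q ∷ []) ((x₁ ≈ con 1 ⊕ (x₀ ⊕ x₀)) ∷ []) (x₀ ≼ x₁) e) many)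
      ... | no _ | yes refl | _ = ≤-trans (≤-reflexive eE) enough
      ... | no n₁ | no n₂ | yes refl = ≤-trans (rest n₁ n₂) (subst (1 ≤_) (sym sF) (s≤s z≤n))
      ... | no n₁ | no n₂ | no n₃ = ≤-trans (≤-reflexive (trans (mult-blend₃ d d (F ∷ []) n₁ n₂) (mult-∷-other [] n₃))) z≤n
      top : ∀ l → mult l V* ≤ mult D V*
      top l with l ≟ D | l ≟ E
      ... | yes refl | _ = ≤-refl
      ... | no _ | yes refl = ≤-reflexive (trans eE (sym eD))
      ... | no n₁ | no n₂ = ≤-trans (rest n₁ n₂) (≤-trans d≥1 (≤-reflexive (sym eD)))

-- Majority and plurality replies

majorityRule pluralityRule : ∀ c → Rule c

majorityRule c = record
  { Type = Majority
  ; Wins = Absolute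
  ; wins⁻ = λ { {χ = χ} {L} {x} u (x∈ , h) → ∈-toSet⁻ x∈ ,
      subst₂ _<_ (trans (size-toSet u) (sym (length-map χ L))) (cong (2 *_) (count-toSet u χ (χ x))) h }
  ; wins⁺ = λ { {χ = χ} {L} {x} u x∈ h → ∈-toSet⁺ x∈ ,
      subst₂ _<_ (sym (trans (size-toSet u) (sym (length-map χ L)))) (cong (2 *_) (sym (count-toSet u χ (χ x)))) h }
  ; fromAbs = id
  ; strict = λ {V} → Absolute⇒Strict {V = V}
  ; perm = λ p → subst₂ (λ l m → l < 2 * m) (↭-length p) (cnt-↭ _ p)
  ; detect = detect
  }
  where
  -- Take h = ⌊q/2⌋ balls of colour `D` and fill up from `V`. One more `D` is a majority, while with
  -- `E` instead no colour exceeds half: `D` has h, `E` has one and q ≥ 2, and the others have no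
  -- more than in `V`. As `V` has at most h balls of colour `D`, enough others are available.
  detect : ∀ {V} D E → D ≢ E → 2 ≤ length V → mult E V ≡ 0 → None Absolute V → Detects Absolute D E V
  detect {V} D E D≢E q≥2 noE none with halve (length V)
  ... | h , eq = B , lenB , below , inj₂ ((λ f → f (here refl) D-wins) , λ {k} _ w → <⇒≱ w (few k))
    where
    q = length V
    q≤ : q ≤ 1 + 2 * h
    q≤ = [ (λ e → lia (q ∷ h ∷ []) ((x₀ ≈ x₁ ⊕ x₁) ∷ []) (x₀ ≼ con 1 ⊕ 2 ⊛ x₁) e)
         , (λ e → lia (q ∷ h ∷ []) ((x₀ ≈ con 1 ⊕ (x₁ ⊕ x₁)) ∷ []) (x₀ ≼ con 1 ⊕ 2 ⊛ x₁) e) ]′ eq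
    ≤q : 2 * h ≤ q
    ≤q = [ (λ e → lia (q ∷ h ∷ []) ((x₀ ≈ x₁ ⊕ x₁) ∷ []) (2 ⊛ x₁ ≼ x₀) e)
         , (λ e → lia (q ∷ h ∷ []) ((x₀ ≈ con 1 ⊕ (x₁ ⊕ x₁)) ∷ []) (2 ⊛ x₁ ≼ x₀) e) ]′ eq
    h≥1 : 1 ≤ h
    h≥1 = n≢0⇒n>0 λ h≡0 → lia⊥ (q ∷ h ∷ []) ((x₁ ≈ con 0) ∷ (x₀ ≼ con 1 ⊕ 2 ⊛ x₁) ∷ (con 2 ≼ x₀) ∷ []) h≡0 q≤ q≥2
    r = q ∸ suc h
    B = remix h D 0 E r V
    r+ : r + suc h ≡ q
    r+ = m∸n+n≡m (lia (q ∷ h ∷ []) ((2 ⊛ x₁ ≼ x₀) ∷ (con 1 ≼ x₁) ∷ []) (con 1 ⊕ x₁ ≼ x₀) ≤q h≥1)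
    half : ∀ k → 2 * mult k V ≤ q
    half k with DecMem._∈?_ _≟_ k V
    ... | yes k∈ = ≮⇒≥ (none k∈)
    ... | no k∉ = ≤-trans (≤-reflexive (cong (2 *_) (mult-absent {V = V} k∉))) z≤n
    D≤ : mult D V ≤ h
    D≤ with mult D V ≤? h
    ... | yes le = le
    ... | no gt = lia (mult D V ∷ h ∷ q ∷ []) ((x₁ ≺ x₀) ∷ (2 ⊛ x₀ ≼ x₂) ∷ (x₂ ≼ con 1 ⊕ 2 ⊛ x₁) ∷ []) (x₀ ≼ x₁)
                    (≰⇒> gt) (half D) q≤
    lenB₀ : length B ≡ h + (0 + r)
    lenB₀ = length-remix h 0 r V D≢E (lia (r ∷ h ∷ mult D V ∷ mult E V ∷ q ∷ [])
      ((x₀ ⊕ (con 1 ⊕ x₁) ≈ x₄) ∷ (x₃ ≈ con 0) ∷ (x₂ ≼ x₁) ∷ [])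
      (x₀ ⊕ (x₂ ⊕ x₃) ≼ x₄) r+ noE D≤)
    lenB : suc (length B) ≡ q
    lenB = lia (length B ∷ h ∷ r ∷ q ∷ []) ((x₀ ≈ x₁ ⊕ (con 0 ⊕ x₂)) ∷ (x₂ ⊕ (con 1 ⊕ x₁) ≈ x₃) ∷ [])
      (con 1 ⊕ x₀ ≈ x₃) lenB₀ r+
    below : ∀ k → k ≢ D → mult k B ≤ mult k V
    below k k≢D with k ≟ E
    ... | yes refl = ≤-trans (≤-reflexive (remix-E h 0 r V D≢E)) z≤n
    ... | no k≢E = remix-other h 0 r V D≢E k≢D k≢E
    D-wins : Absolute (D ∷ B) D
    D-wins = subst (λ m → suc (length B) < 2 * m) (sym (trans (mult-∷-same D B) (cong suc (remix-D h 0 r V D≢E))))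
      (lia (length B ∷ q ∷ h ∷ []) ((con 1 ⊕ x₀ ≈ x₁) ∷ (x₁ ≼ con 1 ⊕ 2 ⊛ x₂) ∷ [])
        (con 2 ⊕ x₀ ≼ 2 ⊛ (con 1 ⊕ x₂)) lenB q≤)
    few : ∀ k → 2 * mult k (E ∷ B) ≤ suc (length B)
    few k = ≤-trans (lemma k) (≤-reflexive (sym lenB))
      where
      lemma : ∀ k → 2 * mult k (E ∷ B) ≤ q
      lemma k with E ≟ k
      ... | yes refl = subst (λ m → 2 * suc m ≤ q) (sym (remix-E h 0 r V D≢E)) q≥2
      ... | no E≢k with k ≟ D
      ...   | yes refl = subst (λ m → 2 * m ≤ q) (sym (remix-D h 0 r V D≢E)) ≤q
      ...   | no k≢D = ≤-trans (*-monoʳ-≤ 2 (below k k≢D)) (half k)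

pluralityRule c = record
  { Type = Plurality
  ; Wins = Strict
  ; wins⁻ = λ { {χ = χ} {L} {x} u (x∈ , h) → ∈-toSet⁻ x∈ ,
      λ l l≢ → subst₂ _<_ (count-toSet u χ l) (count-toSet u χ (χ x)) (h l l≢) }
  ; wins⁺ = λ { {χ = χ} {L} {x} u x∈ h → ∈-toSet⁺ x∈ ,
      λ l l≢ → subst₂ _<_ (sym (count-toSet u χ l)) (sym (count-toSet u χ (χ x))) (h l l≢) }
  ; fromAbs = λ {V} → Absolute⇒Strict {V = V}
  ; strict = id
  ; perm = λ p h l l≢k → subst₂ _<_ (cnt-↭ _ p) (cnt-↭ _ p) (h l l≢k)
  ; detect = detect
  }
  where
  tie : ∀ {D E V} → D ≢ E → mult D V ≡ mult E V → (∀ l → mult l V ≤ mult D V) → None Strict V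
  tie {D} {E} {V} D≢E e h {k} _ w with k ≟ D
  ... | yes refl = <⇒≱ (w E (D≢E ∘ sym)) (≤-reflexive e)
  ... | no k≢D = <⇒≱ (w D (k≢D ∘ sym)) (h k)

  rival : ∀ {V} k → 0 < mult k V → None Strict V → (∀ l → mult l V ≤ mult k V) → ∃[ l ] l ≢ k × mult l V ≡ mult k V
  rival {V} k pos none top with any? (λ l → ¬? (l ≟ k) ×-dec (mult k V ≤? mult l V))
  ... | yes (l , l≢ , le) = l , l≢ , ≤-antisym (top l) le
  ... | no ¬any = ⊥-elim (none (∈-mult {V = V} pos) λ l l≢ → ≰⇒> λ le → ¬any (l , l≢ , le))

  -- Without a plurality the maximum is attained twice, so one of the leaders differs from `D`; two
  -- leaders also fit into the query together.
  leaders : ∀ {V} D → 0 < length V → None Strict V → ∃[ G ] G ≢ D × 0 < mult G V × (∀ l → mult l V ≤ mult G V) × 2 * mult G V ≤ length V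
  leaders {V} D pos none with most V pos
  ... | k , top with 0 <? mult k V
  ...   | no ¬p = ⊥-elim (¬p (nonempty V pos top))
    where
    nonempty : ∀ V → 0 < length V → (∀ l → mult l V ≤ mult k V) → 0 < mult k V
    nonempty (x ∷ V) _ h = ≤-trans (mult-∈ {V = x ∷ V} (here refl)) (h x)
  ...   | yes p with rival {V} k p none top
  ...     | l , l≢ , e with k ≟ D
  ...       | no k≢D = k , k≢D , p , top , lia (mult k V ∷ mult l V ∷ length V ∷ [])
                ((x₁ ≈ x₀) ∷ (x₀ ⊕ x₁ ≼ x₂) ∷ []) (2 ⊛ x₀ ≼ x₂) e (mult-two V (l≢ ∘ sym))
  ...       | yes refl = l , l≢ , subst (0 <_) (sym e) p , (λ j → ≤-trans (top j) (≤-reflexive (sym e))) ,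
                lia (mult k V ∷ mult l V ∷ length V ∷ []) ((x₁ ≈ x₀) ∷ (x₀ ⊕ x₁ ≼ x₂) ∷ []) (2 ⊛ x₁ ≼ x₂) e (mult-two V (l≢ ∘ sym))

  -- Let m be the multiplicity of a leader `G` other than `D`. If 2m < q, take m balls each of `D`
  -- and `G` and fill up: another `D` wins, and `E` leaves a tie. If 2m = q and m > 1, take m - 1 of
  -- `D` and m of `G`: now `D` creates the tie and `E` lets `G` win. If q = 2, a single `D` does it.
  detect : ∀ {V} D E → D ≢ E → 2 ≤ length V → mult E V ≡ 0 → None Strict V → Detects Strict D E V
  detect {V} D E D≢E q≥2 noE none with leaders {V} D (≤-trans (s≤s z≤n) q≥2) none
  ... | G , G≢D , m≥1 , top , 2m≤q = main (length V ∸ 2 * m) refl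
    where
    m = mult G V
    q = length V
    D≢G : D ≢ G
    D≢G = G≢D ∘ sym
    E≢G : E ≢ G
    E≢G refl = <⇒≱ m≥1 (≤-reflexive noE)
    module _ (r : ℕ) (r≤ : r ≤ q ∸ 2 * m) (a : ℕ) where
      B = remix a D m G r V
      r+ : (q ∸ 2 * m) + 2 * m ≡ q
      r+ = m∸n+n≡m 2m≤q
      lenB : length B ≡ a + (m + r)
      lenB = length-remix a m r V D≢G (lia (r ∷ q ∸ 2 * m ∷ m ∷ q ∷ mult D V ∷ [])
        ((x₀ ≼ x₁) ∷ (x₁ ⊕ 2 ⊛ x₂ ≈ x₃) ∷ (x₄ ≼ x₂) ∷ []) (x₀ ⊕ (x₄ ⊕ x₂) ≼ x₃) r≤ r+ (top D))
      below : ∀ k → k ≢ D → mult k B ≤ mult k V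
      below k k≢D with k ≟ G
      ... | yes refl = ≤-reflexive (remix-E a m r V D≢G)
      ... | no k≢G = remix-other a m r V D≢G k≢D k≢G
      noE′ : mult E B ≡ 0
      noE′ = n≤0⇒n≡0 (≤-trans (below E (D≢E ∘ sym)) (≤-reflexive noE))
      atD : mult D B ≡ a
      atD = remix-D a m r V D≢G
      atG : mult G B ≡ m
      atG = remix-E a m r V D≢G
    main : ∀ r → r ≡ q ∸ 2 * m → Detects Strict D E V
    main (suc r) e = B′ , len , below r r≤ m , inj₂ ((λ f → f (here refl) D-wins) , tie {V = E ∷ B′} D≢G D=G E-top)
      where
      r≤ : r ≤ q ∸ 2 * m
      r≤ = ≤-trans (n≤1+n r) (≤-reflexive e)
      B′ = B r r≤ m
      len : suc (length B′) ≡ q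
      len = lia (length B′ ∷ m ∷ r ∷ q ∸ 2 * m ∷ q ∷ [])
        ((x₀ ≈ x₁ ⊕ (x₁ ⊕ x₂)) ∷ (con 1 ⊕ x₂ ≈ x₃) ∷ (x₃ ⊕ 2 ⊛ x₁ ≈ x₄) ∷ []) (con 1 ⊕ x₀ ≈ x₄)
        (lenB r r≤ m) e (r+ r r≤ m)
      D-wins : Strict (D ∷ B′) D
      D-wins l l≢D = subst₂ _<_ (sym (mult-∷-other B′ l≢D)) (sym (trans (mult-∷-same D B′) (cong suc (atD r r≤ m))))
        (s≤s (≤-trans (below r r≤ m l l≢D) (top l)))
      D-at : mult D (E ∷ B′) ≡ m
      D-at = trans (mult-∷-other B′ D≢E) (atD r r≤ m)
      D=G : mult D (E ∷ B′) ≡ mult G (E ∷ B′)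
      D=G = trans D-at (sym (trans (mult-∷-other B′ (E≢G ∘ sym)) (atG r r≤ m)))
      E-top : ∀ l → mult l (E ∷ B′) ≤ mult D (E ∷ B′)
      E-top l with l ≟ E
      ... | yes refl = subst₂ _≤_ (sym (trans (mult-∷-same E B′) (cong suc (noE′ r r≤ m)))) (sym D-at) m≥1
      ... | no l≢E with l ≟ D
      ...   | yes refl = ≤-refl
      ...   | no l≢D = subst₂ _≤_ (sym (mult-∷-other B′ l≢E)) (sym D-at) (≤-trans (below r r≤ m l l≢D) (top l))
    main zero e with m ≤? 1
    ... | no m≰1 = B′ , len , below 0 z≤n a , inj₁ (tie {V = D ∷ B′} D≢G D=G D-top , (λ f → f (∈-mult {V = E ∷ B′} posG) G-wins))
      where
      a = pred m
      a+ : suc a ≡ m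
      a+ = suc-pred m {{>-nonZero m≥1}}
      B′ = B 0 z≤n a
      len : suc (length B′) ≡ q
      len = lia (length B′ ∷ m ∷ a ∷ q ∸ 2 * m ∷ q ∷ [])
        ((x₀ ≈ x₂ ⊕ (x₁ ⊕ con 0)) ∷ (con 0 ≈ x₃) ∷ (x₃ ⊕ 2 ⊛ x₁ ≈ x₄) ∷ (con 1 ⊕ x₂ ≈ x₁) ∷ []) (con 1 ⊕ x₀ ≈ x₄)
        (lenB 0 z≤n a) e (r+ 0 z≤n a) a+
      D-at : mult D (D ∷ B′) ≡ m
      D-at = trans (mult-∷-same D B′) (trans (cong suc (atD 0 z≤n a)) a+)
      D=G : mult D (D ∷ B′) ≡ mult G (D ∷ B′)
      D=G = trans D-at (sym (trans (mult-∷-other B′ G≢D) (atG 0 z≤n a)))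
      D-top : ∀ l → mult l (D ∷ B′) ≤ mult D (D ∷ B′)
      D-top l with l ≟ D
      ... | yes refl = ≤-refl
      ... | no l≢D = subst₂ _≤_ (sym (mult-∷-other B′ l≢D)) (sym D-at) (≤-trans (below 0 z≤n a l l≢D) (top l))
      G-at : mult G (E ∷ B′) ≡ m
      G-at = trans (mult-∷-other B′ (E≢G ∘ sym)) (atG 0 z≤n a)
      posG : 0 < mult G (E ∷ B′)
      posG = subst (0 <_) (sym G-at) m≥1
      none-left : ∀ l → l ≢ D → l ≢ G → mult l B′ ≡ 0
      none-left l n₁ n₂ = mult-blend₃ a m (take 0 (others D G V)) n₁ n₂
      G-wins : Strict (E ∷ B′) G
      G-wins l l≢G = subst (mult l (E ∷ B′) <_) (sym G-at) (lemma l l≢G)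
        where
        lemma : ∀ l → l ≢ G → mult l (E ∷ B′) < m
        lemma l l≢G with l ≟ E
        ... | yes refl = subst (_< m) (sym (trans (mult-∷-same E B′) (cong suc (noE′ 0 z≤n a)))) (≰⇒> m≰1)
        ... | no l≢E with l ≟ D
        ...   | yes refl = subst (_< m) (sym (trans (mult-∷-other B′ D≢E) (atD 0 z≤n a))) (≤-reflexive a+)
        ...   | no l≢D = subst (_< m) (sym (trans (mult-∷-other B′ l≢E) (none-left l l≢D l≢G))) m≥1
    ... | yes m≤1 = [ D ] , lia (m ∷ q ∸ 2 * m ∷ q ∷ [])
            ((x₀ ≼ con 1) ∷ (con 1 ≼ x₀) ∷ (con 0 ≈ x₁) ∷ (x₁ ⊕ 2 ⊛ x₀ ≈ x₂) ∷ []) (con 2 ≈ x₂) m≤1 m≥1 e (r+ 0 z≤n 0)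
          , (λ k k≢D → ≤-trans (≤-reflexive (mult-∷-other [] k≢D)) z≤n)
          , inj₂ ((λ f → f (here refl) λ l l≢D → subst₂ _<_
                (sym (trans (mult-∷-other [ D ] l≢D) (mult-∷-other [] l≢D)))
                (sym (trans (mult-∷-same D [ D ]) (cong suc (mult-∷-same D [])))) (s≤s z≤n))
              , tie {V = E ∷ [ D ]} D≢E D=E top′)
      where
      one : mult D (E ∷ [ D ]) ≡ 1
      one = trans (mult-∷-other [ D ] D≢E) (mult-∷-same D [])
      D=E : mult D (E ∷ [ D ]) ≡ mult E (E ∷ [ D ])
      D=E = trans one (sym (trans (mult-∷-same E [ D ]) (cong suc (mult-∷-other [] (D≢E ∘ sym)))))
      top′ : ∀ l → mult l (E ∷ [ D ]) ≤ mult D (E ∷ [ D ])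
      top′ l with l ≟ E
      ... | yes refl = ≤-reflexive (sym D=E)
      ... | no l≢E = subst₂ _≤_ (sym (mult-∷-other [ D ] l≢E)) (sym one) (cnt≤length (λ j → does (j ≟ l)) [ D ])

-- Colour classes, once a query with answer NO is known

sum : ∀ {A : Set} → (A → ℕ) → List A → ℕ
sum f [] = 0
sum f (x ∷ xs) = f x + sum f xs

sum-+ : ∀ {A : Set} (f g : A → ℕ) xs → sum (λ x → f x + g x) xs ≡ sum f xs + sum g xs
sum-+ f g [] = refl
sum-+ f g (x ∷ xs) = trans (cong (f x + g x +_) (sum-+ f g xs))
  (lia (f x ∷ g x ∷ sum f xs ∷ sum g xs ∷ []) [] (x₀ ⊕ x₁ ⊕ (x₂ ⊕ x₃) ≈ x₀ ⊕ x₂ ⊕ (x₁ ⊕ x₃)))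

sum-bit : ∀ {A : Set} (p : A → Bool) xs → sum (bit ∘ p) xs ≡ cnt p xs
sum-bit p [] = refl
sum-bit p (x ∷ xs) = cong (bit (p x) +_) (sum-bit p xs)

sum-≤ : ∀ {A : Set} (f : A → ℕ) m xs → (∀ x → f x ≤ m) → sum f xs ≤ length xs * m
sum-≤ f m [] h = z≤n
sum-≤ f m (x ∷ xs) h = +-mono-≤ (h x) (sum-≤ f m xs h)

length≤sum-mult : ∀ {c} (V : List (Fin c)) → length V ≤ sum (λ k → mult k V) (allFin c)
length≤sum-mult [] = z≤n
length≤sum-mult {c} (x ∷ V) = ≤-trans (+-mono-≤ one (length≤sum-mult V))
  (≤-reflexive (sym (sum-+ (λ k → bit (does (x ≟ k))) (λ k → mult k V) (allFin c))))
  where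
  one : 1 ≤ sum (λ k → bit (does (x ≟ k))) (allFin c)
  one = ≤-trans (cnt-pos (λ k → does (x ≟ k)) (∈-allFin x) (dec-true (x ≟ x) refl))
          (≤-reflexive (sym (sum-bit (λ k → does (x ≟ k)) (allFin c))))

length-allFin : ∀ c → length (allFin c) ≡ c
length-allFin c = length-tabulate {n = c} id

pigeonhole : ∀ {c} p (V : List (Fin c)) → (∀ k → mult k V ≤ p) → length V ≤ c * p
pigeonhole {c} p V h = ≤-trans (length≤sum-mult V) (≤-trans (sum-≤ (λ k → mult k V) p (allFin c) h)
  (≤-reflexive (cong (_* p) (length-allFin c))))

popular : ∀ {c} p (V : List (Fin c)) → c * p < length V → ∃[ k ] p < mult k V
popular p V h with any? (λ k → p <? mult k V)
... | yes r = r
... | no ¬r = ⊥-elim (<⇒≱ h (pigeonhole p V λ k → ≮⇒≥ λ lt → ¬r (k , lt)))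

-- Illegal queries give no evidence of a difference.
agree : ∀ {n} → Maybe (Reply n) → Maybe (Reply n) → Bool
agree (just nothing) (just (just _)) = false
agree (just (just _)) (just nothing) = false
agree _ _ = true

interchangeable : ∀ {n q} → List (List (Fin n)) → Fin n → Fin n → Tree n q Bool
interchangeable [] x y = ret true
interchangeable (B ∷ Bs) x y = query (x ∷ B) >>= λ r → query (y ∷ B) >>= λ r′ →
  if agree r r′ then interchangeable Bs x y else ret false

partitionM : ∀ {n q} {A : Set} → (A → Tree n q Bool) → List A → Tree n q (List A × List A)
partitionM f [] = ret ([] , [])
partitionM f (x ∷ xs) = f x >>= λ b → partitionM f xs >>= λ (ys , zs) →
  ret (if b then (x ∷ ys , zs) else (ys , x ∷ zs))

largestM : ∀ {n q} {A : Set} → (A → Tree n q ℕ) → A → List A → Tree n q (A × ℕ)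
largestM f z [] = f z >>= λ m → ret (z , m)
largestM f z (z′ ∷ zs) = f z >>= λ m → largestM f z′ zs >>= λ (y , m′) →
  ret (if m′ ≤ᵇ m then (z , m) else (y , m′))

sample : ∀ {n} → List (Fin n) → List (Fin n) → List (Fin n)
sample Q Z = Z ++ filterᵇ (λ x → not (does (DecMem._∈?_ _≟_ x Z))) Q

sample-unique : ∀ {n} {Q Z : List (Fin n)} → Unique Z → Unique Q → Unique (sample Q Z)
sample-unique {Q = Q} {Z} uZ uQ = Unique-++⁺ uZ (Unique-filterᵇ _ uQ) λ {x} x∈Z x∈ → lemma x x∈Z (proj₂ (∈-filterᵇ⁻ _ {Q} x∈))
  where
  lemma : ∀ x → x ∈ Z → not (does (DecMem._∈?_ _≟_ x Z)) ≡ true → ⊥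
  lemma x x∈ e with DecMem._∈?_ _≟_ x Z
  ... | no x∉ = x∉ x∈

⊆-sample : ∀ {n} {Q Z : List (Fin n)} {x} → x ∈ Q → x ∈ sample Q Z
⊆-sample {Q = Q} {Z} {x} x∈ with DecMem._∈?_ _≟_ x Z in e
... | yes x∈Z = ∈-++⁺ˡ x∈Z
... | no x∉Z = ∈-++⁺ʳ Z (∈-filterᵇ⁺ _ x∈ (cong (not ∘ does) e))

length-sample : ∀ {n} (Q Z : List (Fin n)) → length (sample Q Z) ≤ length Z + length Q
length-sample Q Z = ≤-trans (≤-reflexive (length-++ Z)) (+-monoʳ-≤ (length Z)
  (≤-trans (≤-reflexive (length-filterᵇ _ Q)) (cnt≤length _ Q)))

module Classification (n q c : ℕ) where

  -- Pigeonhole constant: some colour has more than c(q + 1) balls in a sample of this size, which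
  -- is more than infrequent colours can reach altogether.
  size₀ : ℕ
  size₀ = suc (c * (c * suc q))

  same : List (Fin n) → Fin n → Fin n → Tree n q Bool
  same S = interchangeable (tuples (pred q) S)

  round : List (Fin n) → List (Fin n) → List (Fin n) → Tree n q (List (Fin n) × List (Fin n))
  round Q R [] = ret ([] , R)
  round Q R (z₀ ∷ Z) = let S = sample Q (z₀ ∷ Z) in
    largestM (λ z → partitionM (same S z) (z₀ ∷ Z) >>= λ (C , _) → ret (length C)) z₀ Z >>= λ (z , _) →
    partitionM (same S z) R

  rounds : List (Fin n) → ℕ → List (Fin n) → Tree n q (List (List (Fin n)) × List (Fin n))
  rounds Q zero R = ret ([] , R)
  rounds Q (suc j) R = if length R <ᵇ size₀ then ret ([] , R) else
    (round Q R (take size₀ R) >>= λ (C , R′) → rounds Q j R′ >>= λ (Cs , R″) → ret (C ∷ Cs , R″))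

  timeSame : ℕ
  timeSame = 2 * (size₀ + q) ^ pred q

  timeRound : ℕ
  timeRound = size₀ * (size₀ * timeSame) + n * timeSame

module RichLemma {c : ℕ} (rule : Rule c) {n q : ℕ} (χ : Coloring n c) (q≥2 : 2 ≤ q) where
  open Rule rule
  open Runs rule {n} {q} χ
  open Classification n q c

  _⇄_ : List (Fin c) → List (Fin c) → Set
  V ⇄ V′ = (NO V → NO V′) × (NO V′ → NO V)

  Interchangeable : List (List (Fin n)) → Fin n → Fin n → Set
  Interchangeable Bs x y = ∀ {B} → B ∈ Bs → Legal (x ∷ B) → Legal (y ∷ B) → map χ (x ∷ B) ⇄ map χ (y ∷ B)

  Sat-interchangeable : ∀ Bs x y → Sat (interchangeable Bs x y) (length Bs * 2) λ b →
    (χ x ≡ χ y → b ≡ true) × (b ≡ true → Interchangeable Bs x y)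
  Sat-interchangeable [] x y = (λ _ → refl) , λ _ ()
  Sat-interchangeable (B ∷ Bs) x y = Sat-bind (query (x ∷ B)) (Sat-query (x ∷ B)) λ r a →
    Sat-bind (query (y ∷ B)) (Sat-query (y ∷ B)) λ r′ a′ → verdict r r′ a a′
    where
    continue : (Legal (x ∷ B) → Legal (y ∷ B) → map χ (x ∷ B) ⇄ map χ (y ∷ B)) →
      Sat (interchangeable Bs x y) (length Bs * 2) λ b →
        (χ x ≡ χ y → b ≡ true) × (b ≡ true → Interchangeable (B ∷ Bs) x y)
    continue h = Sat-mono (interchangeable Bs x y) ≤-refl (Sat-interchangeable Bs x y) λ b (e , i) →
      e , λ { t (here refl) → h ; t (there B∈) → i t B∈ }
    verdict : ∀ r r′ → Answer (x ∷ B) r → Answer (y ∷ B) r′ →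
      Sat (if agree r r′ then interchangeable Bs x y else ret false) (length Bs * 2) λ b →
        (χ x ≡ χ y → b ≡ true) × (b ≡ true → Interchangeable (B ∷ Bs) x y)
    verdict nothing r′ a a′ = continue λ l _ → ⊥-elim (a l)
    verdict (just nothing) nothing a a′ = continue λ _ l → ⊥-elim (a′ l)
    verdict (just (just _)) nothing a a′ = continue λ _ l → ⊥-elim (a′ l)
    verdict (just nothing) (just nothing) (_ , no₁) (_ , no₂) = continue λ _ _ → (λ _ → no₂) , (λ _ → no₁)
    verdict (just (just u)) (just (just v)) (_ , u∈ , w) (_ , v∈ , w′) = continue λ _ _ →
      (λ f → ⊥-elim (f (∈-map⁺ χ u∈) w)) , (λ f → ⊥-elim (f (∈-map⁺ χ v∈) w′))
    verdict (just nothing) (just (just v)) (_ , none) (_ , v∈ , w) =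
      (λ e → ⊥-elim (subst (λ k → NO (k ∷ map χ B)) e none (∈-map⁺ χ v∈) w)) , λ ()
    verdict (just (just u)) (just nothing) (_ , u∈ , w) (_ , none) =
      (λ e → ⊥-elim (subst (λ k → NO (k ∷ map χ B)) (sym e) none (∈-map⁺ χ u∈) w)) , λ ()

  module _ {S Q : List (Fin n)} (uS : Unique S) (legalQ : Legal Q) (noQ : NO (map χ Q)) (Q⊆S : ∀ {x} → x ∈ Q → x ∈ S) where

    -- At least q + 2 balls, so that q remain when `x` and `y` are kept apart.
    Rich : Fin c → Set
    Rich k = suc q < cnt (has χ k) S

    module _ {x y : Fin n} (rich : Rich (χ x)) (x≁y : χ x ≢ χ y)
             (inter : Interchangeable (tuples (pred q) S) x y ⊎ Interchangeable (tuples (pred q) S) y x) where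
      private
        D = χ x
        E = χ y

        isXY : Fin n → Bool
        isXY z = does (z ≟ x) ∨ does (z ≟ y)

        S′ : List (Fin n)
        S′ = filterᵇ (not ∘ isXY) S

        isXY⁻ : ∀ z → isXY z ≡ true → z ∈ x ∷ y ∷ []
        isXY⁻ z e with z ≟ x | z ≟ y
        ... | yes refl | _ = here refl
        ... | no _ | yes refl = there (here refl)

        S′∌ : ∀ {z} → z ∈ S′ → z ≢ x × z ≢ y
        S′∌ {z} z∈ with z ≟ x | z ≟ y | proj₂ (∈-filterᵇ⁻ (not ∘ isXY) {S} z∈)
        ... | no n₁ | no n₂ | _ = n₁ , n₂
        ... | yes _ | _ | ()
        ... | no _ | yes _ | ()

        split : ∀ k → cnt (has χ k) S ≤ (bit (does (D ≟ k)) + (bit (does (E ≟ k)) + 0)) + cnt (has χ k) S′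
        split k = ≤-trans (≤-reflexive (trans (cnt-↭ (has χ k) (filterᵇ-↭ isXY S)) (cnt-++ _ (filterᵇ isXY S) _)))
          (+-monoˡ-≤ _ (Unique-⊆-cnt (has χ k) (x ∷ y ∷ []) (Unique-filterᵇ isXY uS)
            (λ {z} z∈ → isXY⁻ z (proj₂ (∈-filterᵇ⁻ isXY {S} z∈)))))

        manyD : q ≤ cnt (has χ D) S′
        manyD = lia (q ∷ bit (does (D ≟ D)) ∷ bit (does (E ≟ D)) ∷ cnt (has χ D) S ∷ cnt (has χ D) S′ ∷ [])
          ((con 2 ⊕ x₀ ≼ x₃) ∷ (x₃ ≼ (x₁ ⊕ (x₂ ⊕ con 0)) ⊕ x₄) ∷ (x₁ ≼ con 1) ∷ (x₂ ≼ con 1) ∷ []) (x₀ ≼ x₄)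
          rich (split D) (bit≤1 (does (D ≟ D))) (bit≤1 (does (E ≟ D)))

        -- Realising `B` outside `x` and `y` makes both queries legal, and the test has asked
        -- exactly such pairs. The multiplicity of `D` needs no bound since `S′` has `q` balls of
        -- it.
        exchange : ∀ B → suc (length B) ≡ q → (∀ k → k ≢ D → mult k B ≤ cnt (has χ k) S′) → (D ∷ B) ⇄ (E ∷ B)
        exchange B len h with realise χ B S′ fits
          where
          fits : ∀ k → mult k B ≤ cnt (has χ k) S′
          fits k with k ≟ D
          ... | yes refl = ≤-trans (cnt≤length _ B) (≤-trans (≤-trans (n≤1+n _) (≤-reflexive len)) manyD)
          ... | no k≢ = h k k≢
        ... | B′ , _ , p , refl = swap inter
          where
          B′⊆S′ : ∀ {z} → z ∈ B′ → z ∈ S′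
          B′⊆S′ z∈ = ∈-resp-↭ (↭-sym p) (∈-++⁺ˡ z∈)
          uB : Unique B′
          uB = Unique-++⁻ˡ B′ (Unique-↭ p (Unique-filterᵇ (not ∘ isXY) uS))
          lenB : suc (length B′) ≡ q
          lenB = trans (cong suc (sym (length-map χ B′))) len
          B∈ : B′ ∈ tuples (pred q) S
          B∈ = ∈-tuples (pred q) (cong pred lenB) (λ z∈ → proj₁ (∈-filterᵇ⁻ (not ∘ isXY) {S} (B′⊆S′ z∈)))
          legal : ∀ {w} → (∀ {z} → z ∈ S′ → z ≢ w) → Legal (w ∷ B′)
          legal ne = (All.tabulate (λ z∈ e → ne (B′⊆S′ z∈) (sym e)) ∷ uB) , lenB
          swap : Interchangeable (tuples (pred q) S) x y ⊎ Interchangeable (tuples (pred q) S) y x → (D ∷ map χ B′) ⇄ (E ∷ map χ B′)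
          swap (inj₁ i) = i B∈ (legal (proj₁ ∘ S′∌)) (legal (proj₂ ∘ S′∌))
          swap (inj₂ i) = let f , g = i B∈ (legal (proj₂ ∘ S′∌)) (legal (proj₁ ∘ S′∌)) in g , f

        NO-↭ : ∀ {V V′} → V ↭ V′ → NO V → NO V′
        NO-↭ p none k∈ w = none (∈-resp-↭ (↭-sym p) k∈) (perm (↭-sym p) w)

        -- Balls of colour E may be replaced by balls of colour D one at a time.
        purge : ∀ m V → mult E V ≡ m → m ≤ suc (cnt (has χ E) S′) → length V ≡ q → NO V →
          (∀ k → k ≢ D → k ≢ E → mult k V ≤ cnt (has χ k) S′) → ⊥
        purge zero V noE m≤ len none fits with detect {V} D E x≁y (subst (2 ≤_) (sym len) q≥2) noE none
        ... | B , lenB , below , differ = conflict differ (exchange B (trans lenB len) fitsB)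
          where
          fitsB : ∀ k → k ≢ D → mult k B ≤ cnt (has χ k) S′
          fitsB k k≢D with k ≟ E
          ... | yes refl = ≤-trans (below k k≢D) (≤-trans (≤-reflexive noE) z≤n)
          ... | no k≢E = ≤-trans (below k k≢D) (fits k k≢D k≢E)
          conflict : (NO (D ∷ B) × ¬ NO (E ∷ B)) ⊎ (¬ NO (D ∷ B) × NO (E ∷ B)) → (D ∷ B) ⇄ (E ∷ B) → ⊥
          conflict (inj₁ (a , b)) (f , g) = b (f a)
          conflict (inj₂ (a , b)) (f , g) = a (g b)
        purge (suc m) V e m≤ len none fits with ∈⇒↭ (∈-mult {k = E} {V} (subst (0 <_) (sym e) (s≤s z≤n)))
        ... | B , p = purge m (D ∷ B) (trans (mult-∷-other B (x≁y ∘ sym)) multB) (≤-trans (n≤1+n m) m≤) lenB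
                        (proj₂ (exchange B lenB fitsB) (NO-↭ p none))
                        λ k k≢D k≢E → ≤-trans (≤-reflexive (mult-∷-other B k≢D)) (fitsB k k≢D)
          where
          multB : mult E B ≡ m
          multB = suc-injective (trans (sym (mult-∷-same E B)) (trans (sym (cnt-↭ _ p)) e))
          lenB : suc (length B) ≡ q
          lenB = trans (sym (↭-length p)) len
          fitsB : ∀ k → k ≢ D → mult k B ≤ cnt (has χ k) S′
          fitsB k k≢D with k ≟ E
          ... | yes refl = ≤-trans (≤-reflexive multB) (s≤s⁻¹ m≤)
          ... | no k≢E = ≤-trans (≤-reflexive (trans (sym (mult-∷-other B k≢E)) (sym (cnt-↭ _ p)))) (fits k k≢D k≢E)

        -- The query `Q` may itself contain `x` or `y`, which `S′` lacks; this is where the slack of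
        -- one for `E` in `purge` comes from.
        start : ∀ k → mult k (map χ Q) ≤ (bit (does (D ≟ k)) + (bit (does (E ≟ k)) + 0)) + cnt (has χ k) S′
        start k = ≤-trans (≤-reflexive (mult-map χ k Q)) (≤-trans (Unique-⊆-cnt (has χ k) S (proj₁ legalQ) Q⊆S) (split k))

      -- Interchangeability would carry the answer NO from `Q` to a query without the colour of `y`,
      -- where `detect` exhibits a difference. It is symmetric in the order of the test, but
      -- richness is required of the colour of `x` only.
      distinguished : ⊥
      distinguished = purge (mult E (map χ Q)) (map χ Q) refl
        (≤-trans (start E) (+-monoˡ-≤ _ (≤-trans (≤-reflexive (cong₂ (λ a b → bit a + (bit b + 0)) (dec-false (D ≟ E) x≁y) refl))
          (≤-trans (≤-reflexive (+-identityʳ _)) (bit≤1 (does (E ≟ E)))))))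
        (trans (length-map χ Q) (proj₂ legalQ)) noQ
        λ k k≢D k≢E → ≤-trans (start k) (≤-reflexive (cong₂ (λ a b → bit a + (bit b + 0) + cnt (has χ k) S′)
          (dec-false (D ≟ k) (k≢D ∘ sym)) (dec-false (E ≟ k) (k≢E ∘ sym))))

module Classify {c : ℕ} (rule : Rule c) {n q : ℕ} (χ : Coloring n c) (q≥2 : 2 ≤ q) where
  open Rule rule
  open Runs rule {n} {q} χ
  open Classification n q c
  open RichLemma rule {n} {q} χ q≥2

  Sat-partitionM : ∀ {A : Set} (f : A → Tree n q Bool) t (φ : A → Bool → Set) xs →
    (∀ x → Sat (f x) t (φ x)) →
    Sat (partitionM f xs) (length xs * t) λ (ys , zs) →
      xs ↭ ys ++ zs × (∀ {y} → y ∈ ys → φ y true) × (∀ {z} → z ∈ zs → φ z false)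
  Sat-partitionM f t φ [] h = ↭-refl , (λ ()) , (λ ())
  Sat-partitionM f t φ (x ∷ xs) h = Sat-bind (f x) (h x) λ b φb →
    Sat-mono (partitionM f xs >>= _) (≤-reflexive (+-identityʳ _))
      (Sat-bind (partitionM f xs) {b′ = 0} (Sat-partitionM f t φ xs h) λ (ys , zs) r → combine b φb ys zs r) λ _ r → r
    where
    combine : ∀ b → φ x b → ∀ ys zs → xs ↭ ys ++ zs × (∀ {y} → y ∈ ys → φ y true) × (∀ {z} → z ∈ zs → φ z false) →
      let (ys′ , zs′) = if b then (x ∷ ys , zs) else (ys , x ∷ zs) in
      x ∷ xs ↭ ys′ ++ zs′ × (∀ {y} → y ∈ ys′ → φ y true) × (∀ {z} → z ∈ zs′ → φ z false)
    combine true φb ys zs (p , g , g′) = ↭-prep x p , (λ { (here refl) → φb ; (there y∈) → g y∈ }) , g′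
    combine false φb ys zs (p , g , g′) = ↭-trans (↭-prep x p) (↭-sym (shift x ys zs)) , g ,
      λ { (here refl) → φb ; (there z∈) → g′ z∈ }

  Sat-largestM : ∀ {A : Set} (f : A → Tree n q ℕ) t (ψ : A → ℕ → Set) z zs → (∀ x → Sat (f x) t (ψ x)) →
    Sat (largestM f z zs) (length (z ∷ zs) * t) λ (y , m) →
      y ∈ z ∷ zs × ψ y m × (∀ {w} → w ∈ z ∷ zs → ∃[ m′ ] ψ w m′ × m′ ≤ m)
  Sat-largestM f t ψ z [] h = Sat-bind (f z) (h z) λ m ψm →
    here refl , ψm , λ { (here refl) → m , ψm , ≤-refl }
  Sat-largestM f t ψ z (z′ ∷ zs) h = Sat-bind (f z) (h z) λ m ψm →
    Sat-mono (largestM f z′ zs >>= _) (≤-reflexive (+-identityʳ _))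
      (Sat-bind (largestM f z′ zs) {b′ = 0} (Sat-largestM f t ψ z′ zs h) λ (y , m′) r → choose m ψm y m′ r) λ _ r → r
    where
    choose : ∀ m → ψ z m → ∀ y m′ → y ∈ z′ ∷ zs × ψ y m′ × (∀ {w} → w ∈ z′ ∷ zs → ∃[ m″ ] ψ w m″ × m″ ≤ m′) →
      let (y₀ , m₀) = if m′ ≤ᵇ m then (z , m) else (y , m′) in
      y₀ ∈ z ∷ z′ ∷ zs × ψ y₀ m₀ × (∀ {w} → w ∈ z ∷ z′ ∷ zs → ∃[ m″ ] ψ w m″ × m″ ≤ m₀)
    choose m ψm y m′ (y∈ , ψy , top) with m′ ≤ᵇ m in e
    ... | true = here refl , ψm , λ where
      (here refl) → m , ψm , ≤-refl
      (there w∈) → let m″ , ψw , le = top w∈ in m″ , ψw , ≤-trans le (≤ᵇ⇒≤ m′ m (subst T (sym e) tt))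
    ... | false = there y∈ , ψy , λ where
      (here refl) → m , ψm , <⇒≤ (≰⇒> λ le → subst T e (≤⇒≤ᵇ le))
      (there w∈) → top w∈

  module _ {Q : List (Fin n)} (legalQ : Legal Q) (noQ : NO (map χ Q)) where

    Sat-same : ∀ Z x y → length Z ≤ size₀ → Sat (same (sample Q Z) x y) timeSame λ b →
      (χ x ≡ χ y → b ≡ true) × (b ≡ true → Interchangeable (tuples (pred q) (sample Q Z)) x y)
    Sat-same Z x y h = Sat-mono (same (sample Q Z) x y) time
      (Sat-interchangeable (tuples (pred q) (sample Q Z)) x y) λ _ r → r
      where
      size : length (sample Q Z) ≤ size₀ + q
      size = ≤-trans (length-sample Q Z) (+-mono-≤ h (≤-reflexive (proj₂ legalQ)))
      time : length (tuples (pred q) (sample Q Z)) * 2 ≤ timeSame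
      time = ≤-trans (≤-reflexive (trans (*-comm (length (tuples (pred q) (sample Q Z))) 2) (cong (2 *_) (length-tuples (pred q) (sample Q Z)))))
        (*-monoʳ-≤ 2 (^-monoˡ-≤ (pred q) size))

    module _ {Z : List (Fin n)} (uZ : Unique Z) where
      RichIn : Fin c → Set
      RichIn k = suc q < cnt (has χ k) (sample Q Z)

      tells : ∀ {x y} → RichIn (χ x) →
        Interchangeable (tuples (pred q) (sample Q Z)) x y ⊎ Interchangeable (tuples (pred q) (sample Q Z)) y x → χ x ≡ χ y
      tells {x} {y} rich i with χ x ≟ χ y
      ... | yes e = e
      ... | no ne = ⊥-elim (distinguished (sample-unique uZ (proj₁ legalQ)) legalQ noQ ⊆-sample rich ne i)

      -- A ball of the colour of `z` always passes the test. Conversely, a ball of a rich colour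
      -- passes only if it has the colour of `z`; so if the latter is poor, all colours that pass
      -- are poor, with at most q + 1 balls each.
      Score : Fin n → ℕ → Set
      Score z m = cnt (has χ (χ z)) Z ≤ m × (¬ RichIn (χ z) → m ≤ c * suc q)

      Sat-score : length Z ≤ size₀ → ∀ z →
        Sat (partitionM (same (sample Q Z) z) Z >>= λ (C , _) → ret (length C)) (size₀ * timeSame) (Score z)
      Sat-score lenZ z = Sat-mono (partitionM (same (sample Q Z) z) Z >>= _)
        (≤-trans (≤-reflexive (+-identityʳ _)) (*-monoˡ-≤ timeSame lenZ))
        (Sat-bind (partitionM (same (sample Q Z) z) Z) {b′ = 0}
          (Sat-partitionM _ timeSame _ Z (λ w → Sat-same Z z w lenZ)) λ (C , C′) r → score C C′ r) λ _ r → r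
        where
        Test : Fin n → Bool → Set
        Test w b = (χ z ≡ χ w → b ≡ true) × (b ≡ true → Interchangeable (tuples (pred q) (sample Q Z)) z w)
        score : ∀ C C′ → Z ↭ C ++ C′ × (∀ {y} → y ∈ C → Test y true) × (∀ {y} → y ∈ C′ → Test y false) → Score z (length C)
        score C C′ (p , yes! , no!) =
          subst (_≤ length C) (sym (trans (cnt-↭ _ p) (cnt-++ _ C C′)))
            (subst (λ m → cnt (has χ (χ z)) C + m ≤ length C) (sym (cnt-none _ C′ outside))
              (≤-trans (≤-reflexive (+-identityʳ _)) (cnt≤length _ C)))
          , λ poor → subst (_≤ c * suc q) (length-map χ C) (pigeonhole (suc q) (map χ C) λ k →
              subst (_≤ suc q) (sym (mult-map χ k C)) (few poor k))
          where
          outside : ∀ {w} → w ∈ C′ → has χ (χ z) w ≡ false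
          outside {w} w∈ with χ w ≟ χ z
          ... | no _ = refl
          ... | yes e = case proj₁ (no! w∈) (sym e) of λ ()
          few : ¬ RichIn (χ z) → ∀ k → cnt (has χ k) C ≤ suc q
          few poor k with suc q <? cnt (has χ k) (sample Q Z)
          ... | no ¬r = ≤-trans (≤-trans (≤-trans (m≤m+n _ (cnt (has χ k) C′)) (≤-reflexive (sym (trans (cnt-↭ _ p) (cnt-++ _ C C′)))))
                  (≤-trans (m≤m+n _ _) (≤-reflexive (sym (cnt-++ _ Z _))))) (≮⇒≥ ¬r)
          ... | yes r = ≤-trans (≤-reflexive (cnt-none _ C absent)) z≤n
            where
            absent : ∀ {w} → w ∈ C → has χ k w ≡ false
            absent {w} w∈ with χ w ≟ k
            ... | no _ = refl
            ... | yes refl = ⊥-elim (poor (subst RichIn (tells r (inj₂ (proj₂ (yes! w∈) refl))) r))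

    IsClass : List (Fin n) → List (Fin n) → List (Fin n) → Fin n → Set
    IsClass R C R′ z = z ∈ C × R ↭ C ++ R′ × (∀ {w} → w ∈ C → χ w ≡ χ z) × (∀ {w} → w ∈ R′ → χ w ≢ χ z)

    Sat-round : ∀ R → Unique R → length R ≤ n → size₀ ≤ length R →
      Sat (round Q R (take size₀ R)) timeRound λ (C , R′) → ∃[ z ] IsClass R C R′ z
    Sat-round R uR R≤n big with take size₀ R in eZ
    ... | [] = case trans (sym (cong length eZ)) (length-take≤ size₀ R big) of λ ()
    ... | z₀ ∷ Z = Sat-mono (round Q R (z₀ ∷ Z)) time (Sat-bind (largestM _ z₀ Z)
          (Sat-largestM _ (size₀ * timeSame) (Score uZ) z₀ Z (Sat-score uZ (≤-reflexive lenZ)))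
          λ (z , m) r → Sat-mono (partitionM (same (sample Q (z₀ ∷ Z)) z) R) ≤-refl
            (Sat-partitionM _ timeSame _ R (λ w → Sat-same (z₀ ∷ Z) z w (≤-reflexive lenZ)))
            λ (C , C′) s → z , done′ z m r C C′ s) λ _ r → r
      where
      uZ : Unique (z₀ ∷ Z)
      uZ = Unique-++⁻ˡ (z₀ ∷ Z) {drop size₀ R} (subst Unique (sym (trans (cong (_++ drop size₀ R) (sym eZ)) (take++drop≡id size₀ R))) uR)
      lenZ : length (z₀ ∷ Z) ≡ size₀
      lenZ = trans (sym (cong length eZ)) (length-take≤ size₀ R big)
      Z⊆R : ∀ {z} → z ∈ z₀ ∷ Z → z ∈ R
      Z⊆R {z} z∈ = take-⊆ size₀ (subst (z ∈_) (sym eZ) z∈)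
      time : length (z₀ ∷ Z) * (size₀ * timeSame) + length R * timeSame ≤ timeRound
      time = +-mono-≤ (≤-reflexive (cong (_* (size₀ * timeSame)) lenZ)) (*-monoˡ-≤ timeSame R≤n)
      Test : Fin n → Fin n → Bool → Set
      Test z w b = (χ z ≡ χ w → b ≡ true) × (b ≡ true → Interchangeable (tuples (pred q) (sample Q (z₀ ∷ Z))) z w)
      -- A popular colour gives its balls a score above c(q + 1), hence the best score is also above
      -- it, out of reach of a poor colour. The best ball thus certifies its own richness.
      rich : ∀ z m → z ∈ z₀ ∷ Z × Score uZ z m × (∀ {w} → w ∈ z₀ ∷ Z → ∃[ m′ ] Score uZ w m′ × m′ ≤ m) → RichIn uZ (χ z)
      rich z m (z∈ , (_ , poor) , top) with suc q <? cnt (has χ (χ z)) (sample Q (z₀ ∷ Z))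
      ... | yes r = r
      ... | no ¬r with popular (c * suc q) (map χ (z₀ ∷ Z)) (subst (c * (c * suc q) <_) (sym (trans (length-map χ (z₀ ∷ Z)) lenZ)) ≤-refl)
      ...   | k , lots with cnt-witness (has χ k) (z₀ ∷ Z) (≤-trans (s≤s z≤n) (subst (c * suc q <_) (mult-map χ k (z₀ ∷ Z)) lots))
      ...     | w , w∈ , e with χ w ≟ k
      ...       | yes refl with top w∈
      ...         | m′ , (enough , _) , m′≤ = ⊥-elim (<⇒≱ (≤-trans (subst (c * suc q <_) (mult-map χ k (z₀ ∷ Z)) lots) (≤-trans enough m′≤)) (poor ¬r))
      done′ : ∀ z m → z ∈ z₀ ∷ Z × Score uZ z m × (∀ {w} → w ∈ z₀ ∷ Z → ∃[ m′ ] Score uZ w m′ × m′ ≤ m) → ∀ C C′ →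
        R ↭ C ++ C′ × (∀ {y} → y ∈ C → Test z y true) × (∀ {y} → y ∈ C′ → Test z y false) → IsClass R C C′ z
      done′ z m r C C′ (p , yes! , no!) = z∈C , p
        , (λ w∈ → sym (tells uZ (rich z m r) (inj₁ (proj₂ (yes! w∈) refl))))
        , λ w∈ e → case proj₁ (no! w∈) (sym e) of λ ()
        where
        z∈C : z ∈ C
        z∈C with ∈-++⁻ C (∈-resp-↭ p (Z⊆R (proj₁ r)))
        ... | inj₁ z∈ = z∈
        ... | inj₂ z∈ = case proj₁ (no! z∈) refl of λ ()

    data Classified : List (Fin n) → List (List (Fin n)) → List (Fin n) → Set where
      stop : ∀ {R} → length R < size₀ → Classified R [] R
      peel : ∀ {R C R′ Cs R″ z} → IsClass R C R′ z → Classified R′ Cs R″ → Classified R (C ∷ Cs) R″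

    -- `ks` lists the colours that may still occur. Each round removes a full colour class and
    -- strikes one of them out, so `c` rounds suffice.
    Sat-rounds : ∀ j R ks → length ks ≤ j → (∀ {w} → w ∈ R → χ w ∈ ks) → Unique R → length R ≤ n →
      Sat (rounds Q j R) (j * timeRound) λ (Cs , R″) → Classified R Cs R″
    Sat-rounds zero [] ks _ _ _ _ = stop (s≤s z≤n)
    Sat-rounds zero (w ∷ R) [] _ cover _ _ with () ← cover (here refl)
    Sat-rounds (suc j) R ks ks≤ cover uR R≤n with length R <ᵇ size₀ in e
    ... | true = stop (<ᵇ⇒< _ _ (subst T (sym e) tt))
    ... | false = Sat-bind (round Q R (take size₀ R)) (Sat-round R uR R≤n (≮⇒≥ λ lt → subst T e (<⇒<ᵇ lt)))
        λ { (C , R′) (z , cls) → Sat-mono (rounds Q j R′ >>= _) (≤-reflexive (+-identityʳ _))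
          (Sat-bind (rounds Q j R′) {b′ = 0} (continue C R′ z cls) λ (Cs , R″) r → peel cls r) λ _ r → r }
      where
      continue : ∀ C R′ z → IsClass R C R′ z → Sat (rounds Q j R′) (j * timeRound) λ (Cs , R″) → Classified R′ Cs R″
      continue C R′ z (z∈ , p , in′ , out) = Sat-rounds j R′ (filterᵇ (λ k → not (does (k ≟ χ z))) ks) shorter cover′
        (Unique-++⁻ʳ C (Unique-↭ p uR)) (≤-trans (≤-trans (m≤n+m _ (length C)) (≤-reflexive (sym (trans (↭-length p) (length-++ C))))) R≤n)
        where
        shorter : length (filterᵇ (λ k → not (does (k ≟ χ z))) ks) ≤ j
        shorter = s≤s⁻¹ (≤-trans (≤-trans (≤-reflexive (cong suc (length-filterᵇ _ ks)))
          (≤-trans (+-monoˡ-≤ _ (mult-∈ {k = χ z} (cover (∈-resp-↭ (↭-sym p) (∈-++⁺ˡ z∈))))) (≤-reflexive (cnt-not _ ks)))) ks≤)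
        cover′ : ∀ {w} → w ∈ R′ → χ w ∈ filterᵇ (λ k → not (does (k ≟ χ z))) ks
        cover′ {w} w∈ = ∈-filterᵇ⁺ _ (cover (∈-resp-↭ (↭-sym p) (∈-++⁺ʳ C w∈))) (cong not (dec-false (χ w ≟ χ z) (out w∈)))

    Sat-classify : Sat (rounds Q c (allFin n)) (c * timeRound) λ (Cs , R″) → Classified (allFin n) Cs R″
    Sat-classify = Sat-rounds c (allFin n) (allFin c) (≤-reflexive (length-allFin c)) (λ {w} _ → ∈-allFin (χ w))
      (UniqueP.allFin⁺ n) (≤-reflexive (length-allFin n))

-- The output, given the colour classes

longest : ∀ {n} (C : List (Fin n)) (Cs : List (List (Fin n))) → List (Fin n)
longest C Cs = proj₁ (maximum length C Cs)

decide : ∀ {n} → Bool → List (List (Fin n)) → Reply n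
decide ap [] = nothing
decide {n} ap (C ∷ Cs) with longest C Cs
... | [] = nothing
... | z ∷ B = if n ≤ᵇ 2 * length (z ∷ B) then just z else
  if ap ∧ (cnt (λ C → length (z ∷ B) ≤ᵇ length C) (C ∷ Cs) ≡ᵇ 1) then just z else nothing

Target : ∀ {n c} → Bool → BallType n c
Target false = NonMinority
Target true = AlmostPlurality

≤ᵇ-true : ∀ {m n} → m ≤ n → (m ≤ᵇ n) ≡ true
≤ᵇ-true {m} {n} h with m ≤ᵇ n | ≤⇒≤ᵇ h
... | true | _ = refl

module Decide {c : ℕ} (rule : Rule c) {n q : ℕ} (χ : Coloring n c) (q≥2 : 2 ≤ q)
  {Q : List (Fin n)} (legalQ : Runs.Legal rule {n} {q} χ Q) (noQ : Rule.NO rule (map χ Q)) where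
  open Rule rule
  open Runs rule {n} {q} χ
  open Classification n q c
  open Classify rule {n} {q} χ q≥2

  private
    Cl : List (Fin n) → List (List (Fin n)) → List (Fin n) → Set
    Cl = Classified legalQ noQ

    Cls : List (Fin n) → List (Fin n) → List (Fin n) → Fin n → Set
    Cls = IsClass legalQ noQ

  class-size : ∀ {R C R′ z} → Cls R C R′ z → cnt (has χ (χ z)) R ≡ length C
  class-size {R} {C} {R′} {z} (_ , p , in′ , out) = trans (cnt-↭ _ p) (trans (cnt-++ _ C R′)
    (trans (cong₂ _+_ (cnt-full _ C (λ {w} w∈ → dec-true (χ w ≟ χ z) (in′ w∈)))
      (cnt-none _ R′ (λ {w} w∈ → dec-false (χ w ≟ χ z) (out w∈)))) (+-identityʳ _)))

  other-size : ∀ {R C R′ z k} → Cls R C R′ z → k ≢ χ z → cnt (has χ k) R ≡ cnt (has χ k) R′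
  other-size {R} {C} {R′} {z} {k} (_ , p , in′ , out) k≢ = trans (cnt-↭ _ p) (trans (cnt-++ _ C R′)
    (cong (_+ cnt (has χ k) R′) (cnt-none _ C (λ {w} w∈ → dec-false (χ w ≟ k) (λ e → k≢ (trans (sym e) (in′ w∈)))))))

  -- A colour met in some round is classified completely, and all others lie in the small remainder.
  -- As some colour has more than `size₀` balls, the unclassified ones can neither be largest nor
  -- tie with the largest.
  found-or-small : ∀ {R Cs R″} → Cl R Cs R″ → ∀ k →
    (∃[ C ] C ∈ Cs × cnt (has χ k) R ≡ length C) ⊎ cnt (has χ k) R < size₀
  found-or-small (stop {R} small) k = inj₂ (≤-<-trans (cnt≤length (has χ k) R) small)
  found-or-small (peel {C = C} {z = z} cls r) k with k ≟ χ z
  ... | yes refl = inj₁ (C , here refl , class-size cls)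
  ... | no k≢ with found-or-small r k
  ...   | inj₁ (C′ , C′∈ , e) = inj₁ (C′ , there C′∈ , trans (other-size cls k≢) e)
  ...   | inj₂ small = inj₂ (subst (_< size₀) (sym (other-size cls k≢)) small)

  class-of : ∀ {R Cs R″} → Cl R Cs R″ → ∀ {C} → C ∈ Cs →
    0 < length C × (∀ {z} → z ∈ C → z ∈ R × cnt (has χ (χ z)) R ≡ length C)
  class-of (peel {R} {C} {z = z} cls@(z∈ , p , in′ , _) r) (here refl) = nonempty z∈ , λ {w} w∈ →
    ∈-resp-↭ (↭-sym p) (∈-++⁺ˡ w∈) , subst (λ k → cnt (has χ k) R ≡ length C) (sym (in′ w∈)) (class-size cls)
    where
    nonempty : ∀ {C z} → z ∈ C → 0 < length C
    nonempty {x ∷ xs} _ = s≤s z≤n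
  class-of (peel {C = C} cls@(_ , p , _ , out) r) (there C∈) with class-of r C∈
  ... | pos , h = pos , λ w∈ → let w∈R′ , e = h w∈ in
    ∈-resp-↭ (↭-sym p) (∈-++⁺ʳ C w∈R′) , trans (other-size cls (out w∈R′)) e

  module _ (m : ℕ) where
    long : List (Fin n) → Bool
    long C = m ≤ᵇ length C

    one-long : ∀ {R Cs R″} → Cl R Cs R″ → size₀ ≤ m → ∀ {k} → m ≤ cnt (has χ k) R → 1 ≤ cnt long Cs
    one-long cl m≥ {k} h with found-or-small cl k
    ... | inj₁ (C , C∈ , e) = cnt-pos long C∈ (≤ᵇ-true (subst (m ≤_) e h))
    ... | inj₂ small = ⊥-elim (<⇒≱ small (≤-trans m≥ h))

    two-long : ∀ {R Cs R″} → Cl R Cs R″ → size₀ ≤ m → ∀ {k l} → k ≢ l →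
      m ≤ cnt (has χ k) R → m ≤ cnt (has χ l) R → 2 ≤ cnt long Cs
    two-long (stop {R} small) m≥ {k} _ h _ = ⊥-elim (<⇒≱ (≤-<-trans (cnt≤length (has χ k) R) small) (≤-trans m≥ h))
    two-long (peel {C = C} {Cs = Cs} {z = z} cls r) m≥ {k} {l} k≢l hk hl with k ≟ χ z | l ≟ χ z
    ... | yes refl | yes refl = ⊥-elim (k≢l refl)
    ... | yes refl | no l≢ = +-mono-≤ (≤-reflexive (cong bit (sym (≤ᵇ-true (subst (m ≤_) (class-size cls) hk)))))
                               (one-long r m≥ (subst (m ≤_) (other-size cls l≢) hl))
    ... | no k≢ | yes refl = +-mono-≤ (≤-reflexive (cong bit (sym (≤ᵇ-true (subst (m ≤_) (class-size cls) hl)))))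
                               (one-long r m≥ (subst (m ≤_) (other-size cls k≢) hk))
    ... | no k≢ | no l≢ = ≤-trans (two-long r m≥ k≢l (subst (m ≤_) (other-size cls k≢) hk) (subst (m ≤_) (other-size cls l≢) hl))
                            (m≤n+m _ (bit (long C)))

    long-one : ∀ {R Cs R″} → Cl R Cs R″ → 1 ≤ cnt long Cs → ∃[ w ] w ∈ R × m ≤ cnt (has χ (χ w)) R
    long-one {Cs = Cs} cl h with cnt-witness long Cs h
    ... | [] , C∈ , _ = ⊥-elim (n≮0 (proj₁ (class-of cl C∈)))
    ... | w ∷ C , C∈ , e with proj₂ (class-of cl C∈) (here refl)
    ...   | w∈ , size = w , w∈ , subst (m ≤_) (sym size) (≤ᵇ⇒≤ m _ (subst T (sym e) tt))

    long-two : ∀ {R Cs R″} → Cl R Cs R″ → 2 ≤ cnt long Cs →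
      ∃[ k ] ∃[ l ] k ≢ l × m ≤ cnt (has χ k) R × m ≤ cnt (has χ l) R
    long-two (peel {C = C} {z = z} cls@(_ , p , _ , out) r) h with long C in e
    ... | true with long-one r (s≤s⁻¹ h)
    ...   | w , w∈ , big = χ z , χ w , (out w∈ ∘ sym) ,
              subst (m ≤_) (sym (class-size cls)) (≤ᵇ⇒≤ m _ (subst T (sym e) tt)) ,
              subst (m ≤_) (sym (other-size cls (out w∈))) big
    long-two (peel {R} {C} {R′} {z = z} cls@(_ , p , _ , out) r) h | false with long-two r h
    ...   | k , l , k≢l , hk , hl = k , l , k≢l , grow k hk , grow l hl
      where
      grow : ∀ k → m ≤ cnt (has χ k) R′ → m ≤ cnt (has χ k) R
      grow k h′ = ≤-trans h′ (≤-trans (m≤n+m _ (cnt (has χ k) C)) (≤-reflexive (sym (trans (cnt-↭ (has χ k) p) (cnt-++ (has χ k) C _)))))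

  size : Fin c → ℕ
  size k = cnt (has χ k) (allFin n)

  decide-valid : ∀ ap {Cs R″} → c * size₀ < n → Cl (allFin n) Cs R″ → ValidReply (Target ap) χ Sub.⊤ (decide ap Cs)
  decide-valid ap {[]} big (stop small) = ⊥-elim (<⇒≱ (subst (_< size₀) (length-allFin n) small) (≤-trans (m≤n*m′ (popular size₀ (map χ (allFin n)) enough)) (<⇒≤ big)))
    where
    enough : c * size₀ < length (map χ (allFin n))
    enough = subst (c * size₀ <_) (sym (trans (length-map χ (allFin n)) (length-allFin n))) big
    m≤n*m′ : ∃[ k ] size₀ < mult k (map χ (allFin n)) → size₀ ≤ c * size₀
    m≤n*m′ (k , _) = m≤n*m size₀ c {{nonZeroIndex k}}
  decide-valid ap {C₀ ∷ Cs} {R″} big cl with maximum length C₀ Cs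
  ... | B , B∈ , top with B in eB | class-of cl B∈
  ...   | [] | () , _
  ...   | z ∷ B′ | _ , h = verdict ap
    where
    m = length (z ∷ B′)
    m-size : size (χ z) ≡ m
    m-size = proj₂ (h (here refl))
    size₀≤m : size₀ ≤ m
    size₀≤m with popular size₀ (map χ (allFin n)) (subst (c * size₀ <_) (sym (trans (length-map χ (allFin n)) (length-allFin n))) big)
    ... | k , lots with found-or-small cl k | subst (size₀ <_) (mult-map χ k (allFin n)) lots
    ...   | inj₁ (C , C∈ , e) | lots′ = ≤-trans (<⇒≤ lots′) (≤-trans (≤-reflexive e) (top C∈))
    ...   | inj₂ small | lots′ = ⊥-elim (<⇒≱ small (<⇒≤ lots′))
    largest : ∀ k → size k ≤ m
    largest k with found-or-small cl k
    ... | inj₁ (C , C∈ , e) = ≤-trans (≤-reflexive e) (top C∈)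
    ... | inj₂ small = ≤-trans (<⇒≤ small) size₀≤m
    isNonMinority : ∀ {x} → Sub.∣ Sub.⊤ {n} ∣ ≤ 2 * count χ Sub.⊤ (χ x) → n ≤ 2 * m
    isNonMinority {x} le = subst₂ _≤_ (SubP.∣⊤∣≡n n) refl (≤-trans le (*-monoʳ-≤ 2 (≤-trans (≤-reflexive (count-⊤ χ (χ x))) (largest (χ x)))))
    nonMinority : n ≤ 2 * m → NonMinority χ Sub.⊤ z
    nonMinority le = SubP.∈⊤ , subst₂ _≤_ (sym (SubP.∣⊤∣≡n n)) (cong (2 *_) (sym (trans (count-⊤ χ (χ z)) m-size))) le
    plurality : ∀ x → Plurality χ Sub.⊤ x → (∀ k → k ≢ χ x → size k < m) × size (χ x) ≡ m
    plurality x (_ , w) with χ z ≟ χ x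
    ... | yes e = (λ k k≢ → subst₂ _<_ (count-⊤ χ k) (trans (count-⊤ χ (χ x)) here!) (w k k≢)) , here!
      where
      here! : size (χ x) ≡ m
      here! = subst (λ k → size k ≡ m) e m-size
    ... | no ne = ⊥-elim (<⇒≱ (subst₂ _<_ (trans (count-⊤ χ (χ z)) m-size) (count-⊤ χ (χ x)) (w (χ z) ne)) (largest (χ x)))
    target : ∀ ap → NonMinority χ Sub.⊤ z → Target ap χ Sub.⊤ z
    target false nm = nm
    target true nm = inj₂ nm
    verdict : ∀ ap → ValidReply (Target ap) χ Sub.⊤ (if n ≤ᵇ 2 * m then just z else
      if ap ∧ (cnt (long m) (C₀ ∷ Cs) ≡ᵇ 1) then just z else nothing)
    verdict ap with n ≤ᵇ 2 * m in e
    ... | true = target ap (nonMinority (≤ᵇ⇒≤ n _ (subst T (sym e) tt)))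
    verdict false | false = λ x (_ , le) → subst T e (≤⇒≤ᵇ (isNonMinority {x} le))
    verdict true | false with cnt (long m) (C₀ ∷ Cs) ≡ᵇ 1 in e′
    ... | true = inj₁ (SubP.∈⊤ , λ k k≢ → subst₂ _<_ (sym (count-⊤ χ k)) (sym (trans (count-⊤ χ (χ z)) m-size))
            (≰⇒> λ le → <⇒≱ (two-long m cl size₀≤m k≢ le (≤-reflexive (sym m-size)))
              (≤-reflexive (≡ᵇ⇒≡ (cnt (long m) (C₀ ∷ Cs)) 1 (subst T (sym e′) tt)))))
    ... | false = λ { x (inj₂ (_ , le)) → subst T e (≤⇒≤ᵇ (isNonMinority {x} le))
                    ; x (inj₁ w) → several x (plurality x w) }
      where
      several : ∀ x → (∀ k → k ≢ χ x → size k < m) × size (χ x) ≡ m → ⊥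
      several x (w , sx) with 2 ≤? cnt (long m) (C₀ ∷ Cs)
      ... | no ≱2 = subst T e′ (≡⇒≡ᵇ _ 1 (≤-antisym (s≤s⁻¹ (≰⇒> ≱2)) (one-long m cl size₀≤m (≤-reflexive (sym sx)))))
      ... | yes ≥2 with long-two m cl ≥2
      ...   | k , l , k≢l , hk , hl with k ≟ χ x
      ...     | no k≢ = <⇒≱ (w k k≢) hk
      ...     | yes refl = <⇒≱ (w l (k≢l ∘ sym)) hl

-- Sliding a window over the balls, discarding the replies

-- A ball that does not occur is replaced by the last one, so that the list always shrinks by
-- exactly one.
extract : ∀ {n} → Fin n → Fin n → List (Fin n) → Fin n × List (Fin n)
extract m x [] = x , []
extract m x (y ∷ ys) = if does (m ≟ x) then (x , y ∷ ys) else
  (let (m′ , zs) = extract m y ys in m′ , x ∷ zs)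

extract-↭ : ∀ {n} (m x : Fin n) xs → let (m′ , zs) = extract m x xs in x ∷ xs ↭ m′ ∷ zs
extract-↭ m x [] = ↭-refl
extract-↭ m x (y ∷ ys) with does (m ≟ x)
... | true = ↭-refl
... | false = ↭-trans (↭-prep x (extract-↭ m y ys)) (↭-swap x _ ↭-refl)

extract-∈ : ∀ {n} {m x : Fin n} {xs} → m ∈ x ∷ xs → proj₁ (extract m x xs) ≡ m
extract-∈ {xs = []} (here refl) = refl
extract-∈ {m = m} {x} {y ∷ ys} m∈ with m ≟ x
... | yes refl = refl
... | no m≢x with m∈
...   | here e = ⊥-elim (m≢x e)
...   | there m∈′ = extract-∈ m∈′

slide : ∀ {n q} → List (Fin n) → List (Fin n) → List (Fin n) → List (Fin n) →
  Tree n q (List (Fin n) ⊎ (List (Fin n) × List (Fin n)))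
slide Y W [] R = ret (inj₂ (W , R))
slide {q = q} Y W (x ∷ xs) R = findNO (tuples q (sample (x ∷ W) Y)) >>= λ where
  (just Q) → ret (inj₁ Q)
  nothing → query (x ∷ W) >>= λ where
    (just (just m)) → let (m′ , W′) = extract m x W in slide Y W′ xs (m′ ∷ R)
    (just nothing) → ret (inj₁ (x ∷ W))
    nothing → ret (inj₂ (W , x ∷ xs ++ R))

module Sliding {c : ℕ} (rule : Rule c) {n q : ℕ} (χ : Coloring n c) (q≥2 : 2 ≤ q) where
  open Rule rule
  open Runs rule {n} {q} χ

  OneOf : Fin c → Fin c → List (Fin n) → Set
  OneOf D E L = ∀ {z} → z ∈ L → χ z ≡ D ⊎ χ z ≡ E

  two-colours : ∀ {D E L} → D ≢ E → OneOf D E L → cnt (has χ D) L + cnt (has χ E) L ≡ length L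
  two-colours {D} {E} {L} D≢E h = trans (cong (cnt (has χ D) L +_) (cnt-cong L λ {z} z∈ → opposite z (h z∈))) (cnt-not (has χ D) L)
    where
    opposite : ∀ z → χ z ≡ D ⊎ χ z ≡ E → has χ E z ≡ not (has χ D z)
    opposite z (inj₁ refl) = trans (dec-false (χ z ≟ E) D≢E) (cong not (sym (dec-true (χ z ≟ χ z) refl)))
    opposite z (inj₂ refl) = trans (dec-true (χ z ≟ χ z) refl) (cong not (sym (dec-false (χ z ≟ D) (D≢E ∘ sym))))

  OneOf-sym : ∀ {D E L} → OneOf D E L → OneOf E D L
  OneOf-sym h z∈ with h z∈
  ... | inj₁ e = inj₂ e
  ... | inj₂ e = inj₁ e

  OneOf-↭ : ∀ {D E L L′} → L ↭ L′ → OneOf D E L → OneOf D E L′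
  OneOf-↭ p h z∈ = h (∈-resp-↭ (↭-sym p) z∈)

  Half : Fin c → List (Fin n) → Set
  Half k W = q ≤ 1 + 2 * cnt (has χ k) W

  -- Among `q` balls of two colours a strict lead survives the loss of one ball as at least half of
  -- the remaining q - 1.
  winner-half : ∀ {D E L W m} → D ≢ E → OneOf D E L → length L ≡ q → L ↭ m ∷ W → χ m ≡ D → Strict (map χ L) D → Half D W
  winner-half {D} {E} {L} {W} {m} D≢E h len p e str = lia
    (cnt (has χ D) L ∷ cnt (has χ E) L ∷ length L ∷ q ∷ cnt (has χ D) W ∷ [])
    ((x₀ ⊕ x₁ ≈ x₂) ∷ (x₂ ≈ x₃) ∷ (x₁ ≺ x₀) ∷ (x₀ ≈ con 1 ⊕ x₄) ∷ []) (x₃ ≼ con 1 ⊕ 2 ⊛ x₄)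
    (two-colours D≢E h) len (subst₂ _<_ (mult-map χ E L) (mult-map χ D L) (str E (D≢E ∘ sym)))
    (trans (cnt-↭ _ p) (cong (λ b → bit b + cnt (has χ D) W) (dec-true (χ m ≟ D) e)))

  keeps : ∀ {x W m W′ k} → x ∷ W ↭ m ∷ W′ → χ m ≢ k → cnt (has χ k) W ≤ cnt (has χ k) W′
  keeps {x} {W} {m} {W′} {k} p ne = ≤-trans (m≤n+m _ (bit (has χ k x)))
    (≤-reflexive (trans (cnt-↭ _ p) (cong (λ b → bit b + cnt (has χ k) W′) (dec-false (χ m ≟ k) ne))))

  Half-≤ : ∀ {k W W′} → cnt (has χ k) W ≤ cnt (has χ k) W′ → Half k W → Half k W′
  Half-≤ le h = ≤-trans h (+-monoʳ-≤ 1 (*-monoʳ-≤ 2 le))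

  module _ {Y : List (Fin n)} (uY : Unique Y) {D : Fin c} (many : q ≤ cnt (has χ D) Y) where

    -- A colour just discarded keeps half of the window, and its share there drops only when one of
    -- its balls is discarded, whereupon it keeps half once more. Hence each of two colours
    -- discarded so far has half of the window. While only `D` has been discarded, this is claimed
    -- just for two-coloured windows: with a third colour around, a plurality may be less than half.
    data Invariant (W R : List (Fin n)) : Set where
      dominated : (∀ {r} → r ∈ R → χ r ≡ D) →
        (∀ E → E ≢ D → OneOf D E W → R ≡ [] ⊎ Half D W) → Invariant W R
      bicoloured : ∀ E d → E ≢ D → q ≡ suc (d + d) → OneOf D E Y → OneOf D E W → OneOf D E R → Half E W →
        (∀ {r} → r ∈ R → χ r ≡ E) ⊎ Half D W → Invariant W R

    invariant-step : ∀ {x W R m W′} → Unique (x ∷ W) → suc (length W) ≡ q → Pass (sample (x ∷ W) Y) →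
      Wins (map χ (x ∷ W)) (χ m) → x ∷ W ↭ m ∷ W′ → Invariant W R → Invariant W′ (m ∷ R)
    invariant-step {x} {W} {R} {m} {W′} uxW len pass w p inv = go inv
      where
      S = sample (x ∷ W) Y
      s : Fin c → ℕ
      s k = cnt (has χ k) S
      V = map χ (x ∷ W)
      lenV : length V ≡ q
      lenV = trans (length-map χ (x ∷ W)) len
      fits : ∀ k → mult k V ≤ s k
      fits k = ≤-trans (≤-reflexive (mult-map χ k (x ∷ W))) (Unique-⊆-cnt (has χ k) S uxW (⊆-sample {Z = Y}))
      many′ : q ≤ s D
      many′ = ≤-trans many (≤-trans (m≤m+n _ _) (≤-reflexive (sym (cnt-++ _ Y _))))
      str : Strict V (χ m)
      str = strict {V} w
      d≥1 : ∀ {d} → q ≡ suc (d + d) → 1 ≤ d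
      d≥1 {zero} refl with () ← s≤s⁻¹ q≥2
      d≥1 {suc d} _ = s≤s z≤n
      two : ∀ {E d} → E ≢ D → q ≡ suc (d + d) → d ≤ s E → OneOf D E S
      two {E} {d} E≢D e d≤ {z} z∈ with χ z ≟ D | χ z ≟ E
      ... | yes a | _ = inj₁ a
      ... | no _ | yes b = inj₂ b
      ... | no n₁ | no n₂ = case trans (sym (cnt-zero⁻ (has χ (χ z)) (no-third-colour rule pass many′ E≢D n₁ n₂ e (d≥1 e) d≤) z∈))
                              (dec-true (χ z ≟ χ z) refl) of λ ()
      part : ∀ {E} → OneOf D E S → OneOf D E Y × OneOf D E (x ∷ W)
      part h = (λ z∈ → h (∈-++⁺ˡ z∈)) , (λ z∈ → h (⊆-sample {Z = Y} z∈))
      W⊆ : ∀ {E} → OneOf D E (x ∷ W) → OneOf D E W′ × (χ m ≡ D ⊎ χ m ≡ E) × OneOf D E W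
      W⊆ h = (λ z∈ → OneOf-↭ p h (there z∈)) , OneOf-↭ p h (here refl) , (λ z∈ → h (there z∈))
      cons : ∀ {E} → χ m ≡ D ⊎ χ m ≡ E → OneOf D E R → OneOf D E (m ∷ R)
      cons e h (here refl) = e
      cons e h (there z∈) = h z∈
      allE : ∀ {k} → χ m ≡ k → (∀ {r} → r ∈ R → χ r ≡ k) → ∀ {r} → r ∈ m ∷ R → χ r ≡ k
      allE e h (here refl) = e
      allE e h (there r∈) = h r∈
      go : Invariant W R → Invariant W′ (m ∷ R)
      go (dominated RD half) with χ m ≟ D
      ... | yes e = dominated (allE e RD) λ E E≢D h → inj₂ (winner-half (E≢D ∘ sym)
              (OneOf-↭ (↭-sym p) λ { (here refl) → inj₁ e ; (there z∈) → h z∈ }) len p e (subst (Strict V) e str))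
      -- The first reply of a colour other than `D`. Its d + 1 balls in the query, together with the
      -- supply of `D`, exclude any third colour from `Y` and the window; the balls discarded before
      -- all have colour `D`.
      ... | no ne with foreign-reply rule pass many′ {V = V} ne lenV fits str
      ...   | d , e , d< with two ne e (≤-trans (≤-trans (n≤1+n d) d<) (fits (χ m)))
      ...     | oS with part oS
      ...       | oY , oxW with W⊆ oxW
      ...         | oW′ , om , oW = bicoloured (χ m) d ne e oY oW′ (cons (inj₂ refl) (λ r∈ → inj₁ (RD r∈)))
                    (winner-half ne (OneOf-sym oxW) len p refl str) third
        where
        third : (∀ {r} → r ∈ m ∷ R → χ r ≡ χ m) ⊎ Half D W′
        third with half (χ m) ne oW
        ... | inj₁ refl = inj₁ λ { (here refl) → refl }
        ... | inj₂ h = inj₂ (Half-≤ {D} {W} {W′} (keeps {k = D} p ne) h)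
      go (bicoloured E d E≢D e oY oW oR hE hD) with two E≢D e d≤
        where
        d≤ : d ≤ s E
        d≤ = ≤-trans (lia (d ∷ q ∷ cnt (has χ E) W ∷ []) ((x₁ ≈ con 1 ⊕ (x₀ ⊕ x₀)) ∷ (x₁ ≼ con 1 ⊕ 2 ⊛ x₂) ∷ []) (x₀ ≼ x₂) e hE)
               (≤-trans (m≤n+m _ (bit (has χ E x))) (Unique-⊆-cnt (has χ E) S uxW (⊆-sample {Z = Y})))
      ... | oS with W⊆ (proj₂ (part oS))
      ...   | oW′ , inj₁ mD , _ = bicoloured E d E≢D e oY oW′ (cons (inj₁ mD) oR)
              (Half-≤ {E} {W} {W′} (keeps {k = E} p λ mE → E≢D (trans (sym mE) mD)) hE)
              (inj₂ (winner-half (E≢D ∘ sym) (proj₂ (part oS)) len p mD (subst (Strict V) mD str)))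
      ...   | oW′ , inj₂ mE , _ = bicoloured E d E≢D e oY oW′ (cons (inj₂ mE) oR)
              (winner-half E≢D (OneOf-sym (proj₂ (part oS))) len p mE (subst (Strict V) mE str)) (third hD)
        where
        third : (∀ {r} → r ∈ R → χ r ≡ E) ⊎ Half D W → (∀ {r} → r ∈ m ∷ R → χ r ≡ E) ⊎ Half D W′
        third (inj₁ h) = inj₁ (allE mE h)
        third (inj₂ h) = inj₂ (Half-≤ {D} {W} {W′} (keeps {k = D} p λ mD → E≢D (trans (sym mE) mD)) h)

    stepTime : ℕ
    stepTime = (length Y + q) ^ q + 1

    Slid : List (Fin n) → List (Fin n) ⊎ (List (Fin n) × List (Fin n)) → Set
    Slid L (inj₁ Q) = Legal Q × NO (map χ Q)
    Slid L (inj₂ (W , R)) = L ↭ W ++ R × suc (length W) ≡ q × Invariant W R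

    Sat-slide : ∀ W xs R → Unique (W ++ xs) → suc (length W) ≡ q → Invariant W R →
      Sat (slide Y W xs R) (length xs * stepTime) (Slid (W ++ (xs ++ R)))
    Sat-slide W [] R u len inv = ↭-refl , len , inv
    Sat-slide W (x ∷ xs) R u len inv = Sat-mono (slide Y W (x ∷ xs) R) time
      (Sat-bind (findNO (tuples q S)) (Sat-findNO (tuples q S)) λ where
        (just Q) h → h
        nothing h → Sat-bind (query (x ∷ W)) (Sat-query (x ∷ W)) λ where
          nothing ¬l → ⊥-elim (¬l (uxW , len))
          (just nothing) h′ → h′
          (just (just m)) (_ , m∈ , w) → continue m h m∈ w) λ _ r → r
      where
      S = sample (x ∷ W) Y
      u′ : Unique (x ∷ W ++ xs)
      u′ = Unique-↭ (shift x W xs) u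
      uxW : Unique (x ∷ W)
      uxW = Unique-++⁻ˡ (x ∷ W) u′
      time : length (tuples q S) + (1 + length xs * stepTime) ≤ suc (length xs) * stepTime
      time = ≤-trans (≤-reflexive (sym (+-assoc (length (tuples q S)) 1 _))) (+-monoˡ-≤ _ (+-monoˡ-≤ 1
        (≤-trans (≤-reflexive (length-tuples q S)) (^-monoˡ-≤ q (≤-trans (length-sample (x ∷ W) Y) (+-monoʳ-≤ (length Y) (≤-reflexive len)))))))
      continue : ∀ m → FoundNO (tuples q S) nothing → m ∈ x ∷ W → Wins (map χ (x ∷ W)) (χ m) →
        let (m′ , W′) = extract m x W in
        Sat (slide Y W′ xs (m′ ∷ R)) (length xs * stepTime) (Slid (W ++ (x ∷ xs ++ R)))
      continue m h m∈ w with extract m x W | extract-↭ m x W | extract-∈ m∈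
      ... | m , W′ | p | refl = Sat-mono (slide Y W′ xs (m ∷ R)) ≤-refl
        (Sat-slide W′ xs (m ∷ R) (Unique-++⁻ʳ [ m ] (Unique-↭ (PermP.++⁺ʳ xs p) u′)) (trans (sym (↭-length p)) len)
          (invariant-step uxW len (pass (sample-unique uY uxW) h) w p inv)) λ where
            (inj₁ Q) r → r
            (inj₂ (W″ , R″)) (p′ , r) → ↭-trans (↭-trans (shift x W (xs ++ R)) (↭-trans (PermP.++⁺ʳ (xs ++ R) p)
              (↭-trans (↭-reflexive (cong (m ∷_) (sym (++-assoc W′ xs R)))) (↭-trans (↭-sym (shift m (W′ ++ xs) R)) (↭-reflexive (++-assoc W′ xs (m ∷ R))))))) p′ , r

    Settled : List (Fin n) → List (Fin n) → Set
    Settled W R = (∃[ k ] ∀ {r} → r ∈ R → χ r ≡ k) ⊎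
      (∃[ E ] ∃[ d ] D ≢ E × q ≡ suc (d + d) × OneOf D E (W ++ R) × cnt (has χ D) W ≡ d × cnt (has χ E) W ≡ d)

    -- If both colours have been discarded, each has at least d of the 2d balls of the window, hence
    -- exactly d.
    settled : ∀ {W R} → suc (length W) ≡ q → Invariant W R → Settled W R
    settled len (dominated RD _) = inj₁ (D , RD)
    settled len (bicoloured E d E≢D e oY oW oR hE (inj₁ RE)) = inj₁ (E , RE)
    settled {W} {R} len (bicoloured E d E≢D e oY oW oR hE (inj₂ hD)) = inj₂ (E , d , E≢D ∘ sym , e , both
      , lia ρ (h₁ ∷ h₂ ∷ h₃ ∷ h₄ ∷ h₅ ∷ []) (x₀ ≈ x₄) (two-colours (E≢D ∘ sym) oW) len e hE hD
      , lia ρ (h₁ ∷ h₂ ∷ h₃ ∷ h₄ ∷ h₅ ∷ []) (x₁ ≈ x₄) (two-colours (E≢D ∘ sym) oW) len e hE hD)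
      where
      ρ = cnt (has χ D) W ∷ cnt (has χ E) W ∷ length W ∷ q ∷ d ∷ []
      h₁ = x₀ ⊕ x₁ ≈ x₂
      h₂ = con 1 ⊕ x₂ ≈ x₃
      h₃ = x₃ ≈ con 1 ⊕ (x₄ ⊕ x₄)
      h₄ = x₃ ≼ con 1 ⊕ 2 ⊛ x₁
      h₅ = x₃ ≼ con 1 ⊕ 2 ⊛ x₀
      both : OneOf D E (W ++ R)
      both z∈ with ∈-++⁻ W z∈
      ... | inj₁ a = oW a
      ... | inj₂ b = oR b

-- Majorities of q + 2 balls from majorities of q balls

-- A set A ⊆ T that may be the majority colour of T, |T| = 2d + 3; e u v is the
-- reply to the query T ∖ {u, v}. This reply lies outside A just when |A| = d + 2
-- (tight) and u, v ∈ A.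
record Candidate {n : ℕ} (d : ℕ) (T : List (Fin n)) (e : Fin n → Fin n → Fin n) : Set where
  field
    member : Fin n → Bool
    tight  : Bool
    replies : ∀ {u v} → u ∈ T → v ∈ T → u ≢ v → member (e u v) ≡ not (tight ∧ (member u ∧ member v))
    size   : tight ≡ true → cnt (not ∘ member) T ≡ suc d

first : ∀ {A : Set} (L : List A) → 1 ≤ length L → ∃[ w ] w ∈ L
first (x ∷ L) _ = x , here refl

second : ∀ {n} (L : List (Fin n)) → Unique L → 2 ≤ length L → ∀ u → ∃[ w ] w ∈ L × w ≢ u
second (x ∷ []) _ (s≤s ())
second (x ∷ y ∷ L) ((xy ∷ _) ∷ _) _ u with x ≟ u
... | no ne = x , here refl , ne
... | yes refl = y , there (here refl) , xy ∘ sym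

-- A Helly-type argument: the reply e u v lies in every candidate that is not tight or
-- misses u or v. Two of the complements of three tight candidates meet, having d + 1
-- elements each; this settles three candidates. For more of them, common elements of
-- all but one yield two replies such that each candidate that is tight misses one.
module Helly {n : ℕ} {d : ℕ} {T : List (Fin n)} {e : Fin n → Fin n → Fin n} (d≥1 : 1 ≤ d)
  (uT : Unique T) (lenT : length T ≡ 3 + (d + d)) (e∈ : ∀ {u v} → u ∈ T → v ∈ T → u ≢ v → e u v ∈ T) where

  Hyp : Set
  Hyp = Candidate d T e

  open module Of (h : Hyp) = Candidate h

  another : ∀ u → ∃[ w ] w ∈ T × w ≢ u
  another = second T uT (subst (2 ≤_) (sym lenT) (s≤s (s≤s z≤n)))

  element : ∃[ w ] w ∈ T
  element = first T (subst (1 ≤_) (sym lenT) (s≤s z≤n))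

  Blocked : Fin n → Fin n → Hyp → Set
  Blocked u v h = tight h ≡ false ⊎ member h u ≡ false ⊎ member h v ≡ false

  reply-in : ∀ {u v} → u ∈ T → v ∈ T → u ≢ v → ∀ {h} → Blocked u v h → member h (e u v) ≡ true
  reply-in {u} {v} u∈ v∈ ne {h} b = trans (replies h u∈ v∈ ne) (cong not (absorb b))
    where
    absorb : ∀ {s a b} → s ≡ false ⊎ a ≡ false ⊎ b ≡ false → s ∧ (a ∧ b) ≡ false
    absorb (inj₁ refl) = refl
    absorb {true} (inj₂ (inj₁ refl)) = refl
    absorb {false} (inj₂ (inj₁ refl)) = refl
    absorb {true} {true} (inj₂ (inj₂ refl)) = refl
    absorb {true} {false} (inj₂ (inj₂ refl)) = refl
    absorb {false} (inj₂ (inj₂ refl)) = refl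

  common : ∀ {u v} → u ∈ T → v ∈ T → ∃[ y ] y ∈ T × (∀ h → Blocked u v h → member h y ≡ true)
  common {u} {v} u∈ v∈ with u ≟ v
  ... | no ne = e u v , e∈ u∈ v∈ ne , λ h → reply-in u∈ v∈ ne {h}
  ... | yes refl with another u
  ...   | w , w∈ , ne = e u w , e∈ u∈ w∈ (ne ∘ sym) , λ h b → reply-in u∈ w∈ (ne ∘ sym) {h} (merge {h} b)
    where
    merge : ∀ {h} → Blocked u u h → Blocked u w h
    merge (inj₁ x) = inj₁ x
    merge (inj₂ (inj₁ x)) = inj₂ (inj₁ x)
    merge (inj₂ (inj₂ x)) = inj₂ (inj₁ x)

  outside : ∀ h → ∃[ u ] u ∈ T × (tight h ≡ false ⊎ member h u ≡ false)
  outside h with tight h in eq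
  ... | false = let w , w∈ = element in w , w∈ , inj₁ refl
  ... | true with cnt-witness (not ∘ member h) T (subst (0 <_) (sym (size h eq)) (s≤s z≤n))
  ...   | u , u∈ , nu = u , u∈ , inj₂ (trans (sym (not-involutive _)) (cong not nu))

  -- Two balls block two candidates, one each; the third candidate comes for free if it is loose or
  -- misses the same ball as another.
  pair : ∀ a b c → (tight c ≡ false ⊎ ∃[ u ] u ∈ T × member b u ≡ false × member c u ≡ false) →
    ∃[ y ] y ∈ T × member a y ≡ true × member b y ≡ true × member c y ≡ true
  pair a b c (inj₁ loose) with outside a | outside b
  ... | u , u∈ , ou | v , v∈ , ov with common u∈ v∈
  ...   | y , y∈ , f = y , y∈ , f a ([ inj₁ , inj₂ ∘ inj₁ ]′ ou) , f b ([ inj₁ , inj₂ ∘ inj₂ ]′ ov) , f c (inj₁ loose)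
  pair a b c (inj₂ (v , v∈ , vb , vc)) with outside a
  ... | u , u∈ , ou with common u∈ v∈
  ...   | y , y∈ , f = y , y∈ , f a ([ inj₁ , inj₂ ∘ inj₁ ]′ ou) , f b (inj₂ (inj₂ vb)) , f c (inj₂ (inj₂ vc))

  Twice : (a b c : Fin n → Bool) → List (Fin n) → Set
  Twice a b c L = ∃[ u ] u ∈ L × ((a u ≡ true × b u ≡ true) ⊎ (a u ≡ true × c u ≡ true) ⊎ (b u ≡ true × c u ≡ true))

  later : ∀ {a b c x L} → Twice a b c L → Twice a b c (x ∷ L)
  later (u , u∈ , r) = u , there u∈ , r

  twice : (a b c : Fin n → Bool) → ∀ L → length L < cnt a L + (cnt b L + cnt c L) → Twice a b c L
  twice a b c (x ∷ L) h with a x in ea | b x in eb | c x in ec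
  ... | true | true | _ = x , here refl , inj₁ (ea , eb)
  ... | true | false | true = x , here refl , inj₂ (inj₁ (ea , ec))
  ... | false | true | true = x , here refl , inj₂ (inj₂ (eb , ec))
  ... | true | false | false = later {a} {b} {c} (twice a b c L (s≤s⁻¹ h))
  ... | false | true | false = later {a} {b} {c} (twice a b c L (s≤s⁻¹ (≤-trans h (≤-reflexive (+-suc (cnt a L) _)))))
  ... | false | false | true = later {a} {b} {c} (twice a b c L (s≤s⁻¹ (≤-trans h (≤-reflexive
          (trans (cong (cnt a L +_) (+-suc (cnt b L) _)) (+-suc (cnt a L) _))))))
  ... | false | false | false = later {a} {b} {c} (twice a b c L (≤-trans (n≤1+n _) h))

  triple : ∀ a b c → ∃[ y ] y ∈ T × member a y ≡ true × member b y ≡ true × member c y ≡ true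
  triple a b c with tight a in ea | tight b in eb | tight c in ec
  ... | _ | _ | false = pair a b c (inj₁ ec)
  ... | _ | false | true = let y , y∈ , f , g , h = pair a c b (inj₁ eb) in y , y∈ , f , h , g
  ... | false | true | true = let y , y∈ , f , g , h = pair b c a (inj₁ ea) in y , y∈ , h , f , g
  ... | true | true | true with twice (not ∘ member a) (not ∘ member b) (not ∘ member c) T
        (lia (length T ∷ cnt (not ∘ member a) T ∷ cnt (not ∘ member b) T ∷ cnt (not ∘ member c) T ∷ d ∷ [])
          ((x₀ ≈ con 3 ⊕ (x₄ ⊕ x₄)) ∷ (x₁ ≈ con 1 ⊕ x₄) ∷ (x₂ ≈ con 1 ⊕ x₄) ∷ (x₃ ≈ con 1 ⊕ x₄) ∷ (con 1 ≼ x₄) ∷ [])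
          (x₀ ≺ x₁ ⊕ (x₂ ⊕ x₃)) lenT (size a ea) (size b eb) (size c ec) d≥1)
  ...   | u , u∈ , inj₁ (p , q) = let y , y∈ , f , g , h = pair c a b (inj₂ (u , u∈ , un p , un q)) in y , y∈ , g , h , f
    where
    un : ∀ {b} → not b ≡ true → b ≡ false
    un {false} _ = refl
  ...   | u , u∈ , inj₂ (inj₁ (p , q)) = let y , y∈ , f , g , h = pair b a c (inj₂ (u , u∈ , un p , un q)) in y , y∈ , g , f , h
    where
    un : ∀ {b} → not b ≡ true → b ≡ false
    un {false} _ = refl
  ...   | u , u∈ , inj₂ (inj₂ (p , q)) = pair a b c (inj₂ (u , u∈ , un p , un q))
    where
    un : ∀ {b} → not b ≡ true → b ≡ false
    un {false} _ = refl

  Common : List Hyp → Fin n → Set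
  Common hs y = All (λ h → member h y ≡ true) hs

  helly : ∀ a b c hs → ∃[ y ] y ∈ T × Common (a ∷ b ∷ c ∷ hs) y
  helly a b c [] = let y , y∈ , f , g , h = triple a b c in y , y∈ , f ∷ g ∷ h ∷ []
  helly a b c (d ∷ hs) with helly b c d hs | helly a c d hs | helly a b d hs | helly a b c hs
  ... | x₁′ , ∈₁ , b₁ ∷ c₁ ∷ d₁ ∷ r₁ | x₂′ , ∈₂ , a₂ ∷ c₂ ∷ d₂ ∷ r₂ | x₃′ , ∈₃ , a₃ ∷ b₃ ∷ d₃ ∷ r₃ | x₄′ , ∈₄ , a₄ ∷ b₄ ∷ c₄ ∷ r₄
    with member a x₁′ in a₁ | member b x₂′ in b₂ | member c x₃′ in c₃ | member d x₄′ in d₄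
  ... | true | _ | _ | _ = x₁′ , ∈₁ , a₁ ∷ b₁ ∷ c₁ ∷ d₁ ∷ r₁
  ... | false | true | _ | _ = x₂′ , ∈₂ , a₂ ∷ b₂ ∷ c₂ ∷ d₂ ∷ r₂
  ... | false | false | true | _ = x₃′ , ∈₃ , a₃ ∷ b₃ ∷ c₃ ∷ d₃ ∷ r₃
  ... | false | false | false | true = x₄′ , ∈₄ , a₄ ∷ b₄ ∷ c₄ ∷ d₄ ∷ r₄
  -- Each of the four balls misses just the candidate left out when it was found. A tight `c`, `d`
  -- or further candidate contains the first two balls and therefore misses their reply; a tight `a`
  -- or `b` misses the reply of the last two. So these two replies block everything.
  ... | false | false | false | false = conclude (common (e∈ ∈₁ ∈₂ ne₁₂) (e∈ ∈₃ ∈₄ ne₃₄))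
    where
    clash : ∀ h {x y} → member h x ≡ false → member h y ≡ true → x ≢ y
    clash h p q refl = case trans (sym p) q of λ ()
    ne₁₂ : x₁′ ≢ x₂′
    ne₁₂ = clash a a₁ a₂
    ne₃₄ : x₃′ ≢ x₄′
    ne₃₄ = clash c c₃ c₄
    both : ∀ h {x y} → x ∈ T → y ∈ T → x ≢ y → member h x ≡ true → member h y ≡ true → member h (e x y) ≡ not (tight h)
    both h x∈ y∈ ne hx hy = trans (replies h x∈ y∈ ne)
      (cong not (trans (cong₂ (λ p q → tight h ∧ (p ∧ q)) hx hy) (∧-comm (tight h) true)))
    loose-or : ∀ {h z} → member h z ≡ not (tight h) → tight h ≡ false ⊎ member h z ≡ false
    loose-or {h} eq with tight h
    ... | true = inj₂ eq
    ... | false = inj₁ refl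
    via₁₂ : ∀ h → member h x₁′ ≡ true → member h x₂′ ≡ true → Blocked (e x₁′ x₂′) (e x₃′ x₄′) h
    via₁₂ h p q = [ inj₁ , inj₂ ∘ inj₁ ]′ (loose-or {h} (both h ∈₁ ∈₂ ne₁₂ p q))
    via₃₄ : ∀ h → member h x₃′ ≡ true → member h x₄′ ≡ true → Blocked (e x₁′ x₂′) (e x₃′ x₄′) h
    via₃₄ h p q = [ inj₁ , inj₂ ∘ inj₂ ]′ (loose-or {h} (both h ∈₃ ∈₄ ne₃₄ p q))
    conclude : ∃[ y ] y ∈ T × (∀ h → Blocked (e x₁′ x₂′) (e x₃′ x₄′) h → member h y ≡ true) →
      ∃[ y ] y ∈ T × Common (a ∷ b ∷ c ∷ d ∷ hs) y
    conclude (y , y∈ , f) = y , y∈ , f a (via₃₄ a a₃ a₄) ∷ f b (via₃₄ b b₃ b₄) ∷ f c (via₁₂ c c₁ c₂) ∷ f d (via₁₂ d d₁ d₂)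
      ∷ All.zipWith (λ { {h} (p , q) → f h (via₁₂ h p q) }) (r₁ , r₂)

  helly′ : ∀ hs → ∃[ y ] y ∈ T × Common hs y
  helly′ [] = let w , w∈ = element in w , w∈ , []
  helly′ (a ∷ hs) with helly a a a hs
  ... | y , y∈ , _ ∷ _ ∷ c = y , y∈ , c

-- Two colours

majority : ∀ {n q} → Fin n → List (Fin n) → Tree n q (Fin n)
majority z₀ L = query L >>= λ where
  (just (just m)) → ret m
  _ → ret z₀

remove : ∀ {n} → Fin n → List (Fin n) → List (Fin n)
remove u [] = []
remove u (x ∷ xs) = proj₂ (extract u x xs)

remove-↭ : ∀ {n} {u : Fin n} {L} → u ∈ L → L ↭ u ∷ remove u L
remove-↭ {u = u} {x ∷ xs} u∈ with extract u x xs | extract-↭ u x xs | extract-∈ u∈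
... | _ , _ | p | refl = p

replies : ∀ {n q} → Fin n → List (Fin n) → List (Fin n × Fin n) → Tree n q (Fin n → Fin n → Fin n)
replies z₀ T [] = ret (λ _ _ → z₀)
replies z₀ T ((u , v) ∷ ps) = majority z₀ (remove v (remove u T)) >>= λ m → replies z₀ T ps >>= λ e →
  ret (λ a b → if does (a ≟ u) ∧ does (b ≟ v) then m else e a b)

subsets : ∀ {A : Set} → List A → List (List A)
subsets [] = [ [] ]
subsets (x ∷ xs) = map (x ∷_) (subsets xs) ++ subsets xs

filterᵇ-∈-subsets : ∀ {A : Set} (p : A → Bool) L → filterᵇ p L ∈ subsets L
filterᵇ-∈-subsets p [] = here refl
filterᵇ-∈-subsets p (x ∷ xs) with p x
... | true = ∈-++⁺ˡ (∈-map⁺ (x ∷_) (filterᵇ-∈-subsets p xs))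
... | false = ∈-++⁺ʳ _ (filterᵇ-∈-subsets p xs)

length-cartesianProduct : ∀ {A B : Set} (xs : List A) (ys : List B) → length (cartesianProduct xs ys) ≡ length xs * length ys
length-cartesianProduct [] ys = refl
length-cartesianProduct (x ∷ xs) ys = trans (length-++ (map (x ,_) ys)) (cong₂ _+_ (length-map (x ,_) ys) (length-cartesianProduct xs ys))

mem : ∀ {n} → List (Fin n) → Fin n → Bool
mem A z = does (DecMem._∈?_ _≟_ z A)

mem⁻ : ∀ {n} (L : List (Fin n)) {z} → mem L z ≡ true → z ∈ L
mem⁻ L {z} e with DecMem._∈?_ _≟_ z L
... | yes z∈ = z∈

mem-false : ∀ {n} (L : List (Fin n)) {z} → mem L z ≡ false → z ∉ L
mem-false L {z} e z∈ = case trans (sym e) (dec-true (DecMem._∈?_ _≟_ z L) z∈) of λ ()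

module _ {n : ℕ} (d : ℕ) (T : List (Fin n)) (e : Fin n → Fin n → Fin n) where

  tightSet : List (Fin n) → Bool
  tightSet A = length A ≡ᵇ 2 + d

  Consistent : List (Fin n) → Set
  Consistent A = All (λ (u , v) → u ≢ v → mem A (e u v) ≡ not (tightSet A ∧ (mem A u ∧ mem A v))) (cartesianProduct T T)
    × (tightSet A ≡ true → cnt (not ∘ mem A) T ≡ suc d)

  consistent? : ∀ A → Dec (Consistent A)
  consistent? A = All.all? (λ (u , v) → ¬? (u ≟ v) →-dec (_ ≟ᵇ _)) (cartesianProduct T T)
    ×-dec ((tightSet A ≟ᵇ true) →-dec (cnt (not ∘ mem A) T ℕₚ.≟ suc d))

  Certain : Fin n → Set
  Certain y = All (λ A → Consistent A → mem A y ≡ true) (subsets T)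

  certain? : ∀ y → Dec (Certain y)
  certain? y = All.all? (λ A → consistent? A →-dec (mem A y ≟ᵇ true)) (subsets T)

  -- The true majority class is one of the subsets consistent with the replies but cannot be singled
  -- out. A ball lying in all of them is right in any case, and Helly guarantees one, so the default
  -- is not reached for sets of the intended size.
  elect : Fin n → Fin n
  elect z₀ with Any.any? certain? T
  ... | yes a = proj₁ (find a)
  ... | no _ = z₀

  candidates : List (List (Fin n)) → List (Candidate d T e)
  candidates [] = []
  candidates (A ∷ As) with consistent? A
  ... | no _ = candidates As
  ... | yes (h , s) = record
    { member = mem A ; tight = tightSet A
    ; replies = λ u∈ v∈ → All.lookup h (∈-cartesianProduct⁺ u∈ v∈) ; size = s } ∷ candidates As

  candidates-common : ∀ {y} As → All (λ h → Candidate.member h y ≡ true) (candidates As) →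
    All (λ A → Consistent A → mem A y ≡ true) As
  candidates-common [] _ = []
  candidates-common (A ∷ As) c with consistent? A | c
  ... | no ¬h | c′ = (λ h → ⊥-elim (¬h h)) ∷ candidates-common As c′
  ... | yes _ | p ∷ c′ = (λ _ → p) ∷ candidates-common As c′

  elect-certain : 1 ≤ d → Unique T → length T ≡ 3 + (d + d) → (∀ {u v} → u ∈ T → v ∈ T → u ≢ v → e u v ∈ T) →
    ∀ z₀ → elect z₀ ∈ T × Certain (elect z₀)
  elect-certain d≥1 uT lenT e∈ z₀ with Any.any? certain? T
  ... | yes a = proj₂ (find a)
  ... | no ¬a with Helly.helly′ d≥1 uT lenT e∈ (candidates (subsets T))
  ...   | y , y∈ , c = ⊥-elim (¬a (lose y∈ (candidates-common (subsets T) c)))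

simulate : ∀ {n q} → ℕ → Fin n → List (Fin n) → Tree n q (Fin n)
simulate d z₀ T = replies z₀ T (cartesianProduct T T) >>= λ e → ret (elect d T e z₀)

slideᵇ : ∀ {n q} → (List (Fin n) → Tree n q (Fin n)) → List (Fin n) → List (Fin n) → List (Fin n) →
  Tree n q (List (Fin n) × List (Fin n))
slideᵇ f W [] R = ret (W , R)
slideᵇ f W (x ∷ xs) R = f (x ∷ W) >>= λ m → let (m′ , W′) = extract m x W in slideᵇ f W′ xs (m′ ∷ R)

flat : ∀ {A : Set} → List (A × A) → List A
flat [] = []
flat ((a , b) ∷ ps) = a ∷ b ∷ flat ps

-- Each step slides a window of q + 1 balls, with simulated majorities of q + 2. If both colours are
-- discarded, the window is balanced; asking it without `w` then yields a ball `u` of the other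
-- colour. The whole window is set aside in `J`, as it does not favour either colour.
grab : ∀ {n q} → ℕ → Fin n → ℕ → List (Fin n) → Tree n q (List (Fin n × Fin n) × List (Fin n) × List (Fin n))
grab d z₀ zero R = ret ([] , [] , R)
grab {q = q} d z₀ (suc k) R = slideᵇ (simulate d z₀) (take (suc q) R) (drop (suc q) R) [] >>= λ where
  ([] , R′) → ret ([] , [] , R)
  (w ∷ S , R′) → majority z₀ S >>= λ u → grab d z₀ k R′ >>= λ (ps , J , R″) →
    ret ((w , u) ∷ ps , (w ∷ S) ++ J , R″)

is : Bool → Bool → Bool
is true b = b
is false b = not b

-- `H` stands for the case of two colours with a balanced first window. The program cannot check it,
-- so it appears in postconditions only and never in cost bounds. `β` marks one of the two colours,
-- and `forced` says that legal queries are then majority queries with answer YES.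
module Binary {c : ℕ} (rule : Rule c) {n q : ℕ} (χ : Coloring n c) (z₀ : Fin n) (H : Set) (β : Fin n → Bool)
  {d : ℕ} (d≥1 : 1 ≤ d) (q≡ : q ≡ suc (d + d))
  (forced : H → ∀ {L a} → Runs.Legal rule {n} {q} χ L → Runs.Answer rule {n} {q} χ L a →
    ∃[ m ] a ≡ just (just m) × m ∈ L × length L < 2 * cnt (λ z → is (β m) (β z)) L) where
  open Rule rule
  open Runs rule {n} {q} χ

  K : Bool → List (Fin n) → ℕ
  K b L = cnt (λ z → is b (β z)) L

  K-sum : ∀ b L → K b L + K (not b) L ≡ length L
  K-sum true L = cnt-not β L
  K-sum false L = trans (+-comm (K false L) (K true L)) (cnt-not β L)

  is-same : ∀ b → is b b ≡ true
  is-same true = refl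
  is-same false = refl

  is-true⁻ : ∀ {a b} → is a b ≡ true → b ≡ a
  is-true⁻ {true} refl = refl
  is-true⁻ {false} {false} _ = refl

  is-false⁻ : ∀ {a b} → is a b ≡ false → b ≡ not a
  is-false⁻ {true} refl = refl
  is-false⁻ {false} {true} _ = refl

  IsMajority : List (Fin n) → Fin n → Set
  IsMajority L m = m ∈ L × length L < 2 * K (β m) L

  Sat-majority : ∀ L → Sat (majority z₀ L) 1 λ m → Legal L → H → IsMajority L m
  Sat-majority L = Sat-bind (query L) {b′ = 0} (Sat-query L) λ where
    nothing a l → ⊥-elim (a l)
    (just nothing) a l h → case forced h {L} {just nothing} l a of λ { (_ , () , _) }
    (just (just m)) a l h → case forced h {L} {just (just m)} l a of λ { (_ , refl , r) → r }

  Sat-replies : ∀ T ps → Sat (replies z₀ T ps) (length ps) λ e → H → ∀ {u v} → (u , v) ∈ ps →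
    let T′ = remove v (remove u T) in Legal T′ → IsMajority T′ (e u v)
  Sat-replies T [] = λ _ ()
  Sat-replies T ((u , v) ∷ ps) = Sat-bind (majority z₀ (remove v (remove u T))) (Sat-majority (remove v (remove u T))) λ m hm →
    Sat-mono (replies z₀ T ps >>= _) (≤-reflexive (+-identityʳ _))
      (Sat-bind (replies z₀ T ps) {b′ = 0} (Sat-replies T ps) λ e he → extend m hm e he) λ _ r → r
    where
    extend : ∀ m → (Legal (remove v (remove u T)) → H → IsMajority (remove v (remove u T)) m) → ∀ e →
      (H → ∀ {a b} → (a , b) ∈ ps → Legal (remove b (remove a T)) → IsMajority (remove b (remove a T)) (e a b)) →
      H → ∀ {a b} → (a , b) ∈ (u , v) ∷ ps → Legal (remove b (remove a T)) →
      IsMajority (remove b (remove a T)) (if does (a ≟ u) ∧ does (b ≟ v) then m else e a b)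
    extend m hm e he h {a} {b} ab∈ l with a ≟ u | b ≟ v
    ... | yes refl | yes refl = hm l h
    ... | yes refl | no b≢ = he h (tail ab∈ λ { refl → b≢ refl }) l
      where
      tail : ∀ {x} → x ∈ (u , v) ∷ ps → x ≢ (u , v) → x ∈ ps
      tail (here e) ne = ⊥-elim (ne e)
      tail (there x∈) _ = x∈
    ... | no a≢ | _ = he h (tail ab∈ λ { refl → a≢ refl }) l
      where
      tail : ∀ {x} → x ∈ (u , v) ∷ ps → x ≢ (u , v) → x ∈ ps
      tail (here e) ne = ⊥-elim (ne e)
      tail (there x∈) _ = x∈

  decided : ∀ {L m b} → length L ≡ suc (d + d) → IsMajority L m → is b (β m) ≡ (suc d ≤ᵇ K b L)
  decided {L} {m} {b} len (_ , h) with is b (β m) in e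
  ... | true with is-true⁻ {b} e
  ...   | refl = sym (≤ᵇ-true (lia (length L ∷ d ∷ K b L ∷ []) ((x₀ ≈ con 1 ⊕ (x₁ ⊕ x₁)) ∷ (x₀ ≺ 2 ⊛ x₂) ∷ []) (x₁ ≺ x₂) len h))
  decided {L} {m} {b} len (_ , h) | false with suc d ≤ᵇ K b L in e′
  ...   | false = refl
  ...   | true = ⊥-elim (lia⊥ (length L ∷ d ∷ K b L ∷ K (not b) L ∷ [])
            ((x₀ ≈ con 1 ⊕ (x₁ ⊕ x₁)) ∷ (x₁ ≺ x₂) ∷ (x₂ ⊕ x₃ ≈ x₀) ∷ (x₀ ≺ 2 ⊛ x₃) ∷ [])
            len (≤ᵇ⇒≤ (suc d) _ (subst T (sym e′) tt)) (K-sum b L) (subst (λ b′ → length L < 2 * K b′ L) (is-false⁻ {b} e) h))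

  module _ {T : List (Fin n)} (uT : Unique T) (lenT : length T ≡ suc (suc q)) where
    private
      lenT′ : length T ≡ 3 + (d + d)
      lenT′ = trans lenT (cong (2 +_) q≡)

      split : ∀ {u v} → u ∈ T → v ∈ T → u ≢ v → T ↭ u ∷ v ∷ remove v (remove u T)
      split {u} {v} u∈ v∈ ne = ↭-trans p (↭-prep u (remove-↭ (v∈′ (∈-resp-↭ p v∈))))
        where
        p = remove-↭ u∈
        v∈′ : v ∈ u ∷ remove u T → v ∈ remove u T
        v∈′ (here e) = ⊥-elim (ne (sym e))
        v∈′ (there x) = x

      legal : ∀ {u v} → u ∈ T → v ∈ T → u ≢ v → Legal (remove v (remove u T))
      legal {u} {v} u∈ v∈ ne = Unique-++⁻ʳ (u ∷ v ∷ []) (Unique-↭ (split u∈ v∈ ne) uT) ,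
        suc-injective (suc-injective (trans (sym (↭-length (split u∈ v∈ ne))) lenT))

    -- It suffices that the true majority class `A` is a consistent candidate. It has at least d + 2
    -- of the 2d + 3 balls, so removing two leaves it fewer than d + 1 only if it has exactly d + 2
    -- and both were its own.
    elect-majority : ∀ e → (∀ {u v} → u ∈ T → v ∈ T → u ≢ v → IsMajority (remove v (remove u T)) (e u v)) →
      IsMajority T (elect d T e z₀)
    elect-majority e he = proj₁ el , subst (λ b′ → length T < 2 * K b′ T) (sym winner) b-wins
      where
      e∈ : ∀ {u v} → u ∈ T → v ∈ T → u ≢ v → e u v ∈ T
      e∈ u∈ v∈ ne = ∈-resp-↭ (↭-sym (split u∈ v∈ ne)) (there (there (proj₁ (he u∈ v∈ ne))))
      el = elect-certain d T e d≥1 uT lenT′ e∈ z₀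
      some : ∃[ b ] 2 + d ≤ K b T
      some with 2 + d ≤? K true T
      ... | yes h = true , h
      ... | no h = false , lia (d ∷ K true T ∷ K false T ∷ length T ∷ [])
              ((x₁ ≺ con 2 ⊕ x₀) ∷ (x₁ ⊕ x₂ ≈ x₃) ∷ (x₃ ≈ con 3 ⊕ (x₀ ⊕ x₀)) ∷ []) (con 2 ⊕ x₀ ≼ x₂) (≰⇒> h) (K-sum true T) lenT′
      b = proj₁ some
      b-wins : length T < 2 * K b T
      b-wins = lia (d ∷ K b T ∷ length T ∷ []) ((con 2 ⊕ x₀ ≼ x₁) ∷ (x₂ ≈ con 3 ⊕ (x₀ ⊕ x₀)) ∷ []) (x₂ ≺ 2 ⊛ x₁) (proj₂ some) lenT′
      A = filterᵇ (λ z → is b (β z)) T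
      sizeA : length A ≡ K b T
      sizeA = length-filterᵇ _ T
      memA : ∀ {z} → z ∈ T → mem A z ≡ is b (β z)
      memA {z} z∈ with is b (β z) in eq
      ... | true = dec-true (DecMem._∈?_ _≟_ z A) (∈-filterᵇ⁺ _ z∈ eq)
      ... | false = dec-false (DecMem._∈?_ _≟_ z A) λ z∈A → case trans (sym eq) (proj₂ (∈-filterᵇ⁻ _ {T} z∈A)) of λ ()
      removal : ∀ {u v} → (u∈ : u ∈ T) (v∈ : v ∈ T) (ne : u ≢ v) →
        (suc d ≤ᵇ K b (remove v (remove u T))) ≡ not (tightSet d T e A ∧ (is b (β u) ∧ is b (β v)))
      removal {u} {v} u∈ v∈ ne = arith (is b (β u)) (is b (β v)) (trans sizeA (cnt-↭ _ (split u∈ v∈ ne))) (subst (2 + d ≤_) (sym sizeA) (proj₂ some))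
        where
        k = K b (remove v (remove u T))
        arith : ∀ x y {N} → N ≡ bit x + (bit y + k) → 2 + d ≤ N → (suc d ≤ᵇ k) ≡ not ((N ≡ᵇ 2 + d) ∧ (x ∧ y))
        arith true true {N} e₁ h with N ≡ᵇ 2 + d in e₂
        ... | true = ≤ᵇ-false λ le → 1+n≰n (≤-trans le (≤-reflexive (suc-injective (suc-injective (trans (sym e₁) (≡ᵇ⇒≡ N (2 + d) (subst Bool.T (sym e₂) tt)))))))
          where
          ≤ᵇ-false : ∀ {a b} → ¬ a ≤ b → (a ≤ᵇ b) ≡ false
          ≤ᵇ-false {a} {b} ¬h with a ≤ᵇ b in e₃
          ... | false = refl
          ... | true = ⊥-elim (¬h (≤ᵇ⇒≤ a b (subst Bool.T (sym e₃) tt)))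
        ... | false = ≤ᵇ-true (≤∧≢⇒< (s≤s⁻¹ (s≤s⁻¹ (≤-trans h (≤-reflexive e₁)))) λ e₃ → subst Bool.T e₂ (≡⇒≡ᵇ N (2 + d) (trans e₁ (cong (2 +_) (sym e₃)))))
        arith true false {N} e₁ h = trans (≤ᵇ-true (s≤s⁻¹ (≤-trans h (≤-reflexive e₁)))) (cong not (sym (∧-comm (N ≡ᵇ 2 + d) false)))
        arith false true {N} e₁ h = trans (≤ᵇ-true (s≤s⁻¹ (≤-trans h (≤-reflexive e₁)))) (cong not (sym (∧-comm (N ≡ᵇ 2 + d) false)))
        arith false false {N} e₁ h = trans (≤ᵇ-true (≤-trans (n≤1+n _) (≤-trans h (≤-reflexive e₁)))) (cong not (sym (∧-comm (N ≡ᵇ 2 + d) false)))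
      consistent : Consistent d T e A
      consistent = All.tabulate (λ { {(u , v)} uv∈ ne → let u∈ , v∈ = ∈-cartesianProduct⁻ T T uv∈ in
          trans (memA (e∈ u∈ v∈ ne)) (trans (decided {b = b} (trans (proj₂ (legal u∈ v∈ ne)) q≡) (he u∈ v∈ ne))
            (trans (removal u∈ v∈ ne) (cong₂ (λ x y → not (tightSet d T e A ∧ (x ∧ y))) (sym (memA u∈)) (sym (memA v∈))))) })
        , λ t → lia (d ∷ K b T ∷ K (not b) T ∷ length T ∷ cnt (not ∘ mem A) T ∷ cnt (mem A) T ∷ [])
            ((x₁ ≈ con 2 ⊕ x₀) ∷ (x₃ ≈ con 3 ⊕ (x₀ ⊕ x₀)) ∷ (x₅ ⊕ x₄ ≈ x₃) ∷ (x₅ ≈ x₁) ∷ []) (x₄ ≈ con 1 ⊕ x₀)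
            (trans (sym sizeA) (≡ᵇ⇒≡ (length A) (2 + d) (subst Bool.T (sym t) tt))) lenT′ (cnt-not (mem A) T) (cnt-cong T memA)
      winner : β (elect d T e z₀) ≡ b
      winner = is-true⁻ {b} (trans (sym (memA (proj₁ el))) (All.lookup (proj₂ el) (filterᵇ-∈-subsets _ T) consistent))

    Sat-simulate : Sat (simulate d z₀ T) ((2 + q) * (2 + q)) λ m → H → IsMajority T m
    Sat-simulate = Sat-mono (simulate d z₀ T) time (Sat-bind (replies z₀ T (cartesianProduct T T)) {b′ = 0} (Sat-replies T (cartesianProduct T T)) λ e he h →
      elect-majority e λ u∈ v∈ ne → he h (∈-cartesianProduct⁺ u∈ v∈) (legal u∈ v∈ ne)) λ _ r → r
      where
      time : length (cartesianProduct T T) + 0 ≤ (2 + q) * (2 + q)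
      time = ≤-reflexive (trans (+-identityʳ _) (trans (length-cartesianProduct T T) (cong₂ _*_ lenT lenT)))

-- Balanced sets of q + 1 balls and pairs of balls of different colours

module Pairs {c : ℕ} (rule : Rule c) {n q : ℕ} (χ : Coloring n c) (z₀ : Fin n) (H : Set) (β : Fin n → Bool)
  {d : ℕ} (d≥1 : 1 ≤ d) (q≡ : q ≡ suc (d + d))
  (forced : H → ∀ {L a} → Runs.Legal rule {n} {q} χ L → Runs.Answer rule {n} {q} χ L a →
    ∃[ m ] a ≡ just (just m) × m ∈ L × length L < 2 * cnt (λ z → is (β m) (β z)) L) where
  open Rule rule
  open Runs rule {n} {q} χ
  open Binary rule χ z₀ H β d≥1 q≡ (λ h {L} {a} → forced h {L} {a})

  Mixed : List (Fin n) → Set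
  Mixed R = (∃[ r ] r ∈ R × β r ≡ true) × (∃[ r ] r ∈ R × β r ≡ false)

  module _ (f : List (Fin n) → Tree n q (Fin n)) (t s : ℕ)
    (hf : ∀ L → Unique L → length L ≡ suc (s + s) → Sat (f L) t λ m → H → IsMajority L m) where

    -- The principle of the first window, for majorities of 2s + 1 balls: each colour discarded so
    -- far has at least half of the window. If both occur among the discarded balls, equality
    -- follows.
    Reservoir : List (Fin n) → List (Fin n) → Set
    Reservoir W R = H → ∀ {r} → r ∈ R → s ≤ K (β r) W

    Sat-slideᵇ : ∀ W xs R → Unique (W ++ xs) → length W ≡ s + s → Reservoir W R →
      Sat (slideᵇ f W xs R) (length xs * t) λ (W′ , R′) →
        W ++ (xs ++ R) ↭ W′ ++ R′ × length W′ ≡ s + s × Reservoir W′ R′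
    Sat-slideᵇ W [] R u len inv = ↭-refl , len , inv
    Sat-slideᵇ W (x ∷ xs) R u len inv = Sat-bind (f (x ∷ W)) (hf (x ∷ W) (Unique-++⁻ˡ (x ∷ W) u′) (cong suc len)) continue
      where
      u′ : Unique (x ∷ W ++ xs)
      u′ = Unique-↭ (shift x W xs) u
      continue : ∀ m → (H → IsMajority (x ∷ W) m) → let (m′ , W′) = extract m x W in
        Sat (slideᵇ f W′ xs (m′ ∷ R)) (length xs * t) λ (W″ , R″) →
          W ++ (x ∷ xs ++ R) ↭ W″ ++ R″ × length W″ ≡ s + s × Reservoir W″ R″
      continue m hm with extract m x W | extract-↭ m x W | (λ m∈ → extract-∈ {m = m} {x} {W} m∈)
      ... | m′ , W′ | p | e = Sat-mono (slideᵇ f W′ xs (m′ ∷ R)) ≤-refl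
        (Sat-slideᵇ W′ xs (m′ ∷ R) (Unique-++⁻ʳ [ m′ ] (Unique-↭ (PermP.++⁺ʳ xs p) u′))
          (trans (suc-injective (sym (↭-length p))) len) inv′) λ (W″ , R″) (p′ , r) →
            ↭-trans (↭-trans (shift x W (xs ++ R)) (↭-trans (PermP.++⁺ʳ (xs ++ R) p)
              (↭-trans (↭-reflexive (cong (m′ ∷_) (sym (++-assoc W′ xs R)))) (↭-trans (↭-sym (shift m′ (W′ ++ xs) R)) (↭-reflexive (++-assoc W′ xs (m′ ∷ R))))))) p′ , r
        where
        inv′ : Reservoir W′ (m′ ∷ R)
        inv′ h with hm h
        ... | m∈ , maj with e m∈
        ...   | refl = λ { (here refl) → top ; (there r∈) → other r∈ }
          where
          count-split : ∀ b → K b (x ∷ W) ≡ bit (is b (β m)) + K b W′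
          count-split b = cnt-↭ _ p
          top : s ≤ K (β m) W′
          top = lia (s ∷ K (β m) W′ ∷ K (β m) (x ∷ W) ∷ length W ∷ [])
            ((con 1 ⊕ x₃ ≺ 2 ⊛ x₂) ∷ (x₃ ≈ x₀ ⊕ x₀) ∷ (x₂ ≈ con 1 ⊕ x₁) ∷ []) (x₀ ≼ x₁) maj len
            (trans (count-split (β m)) (cong (λ b → bit b + K (β m) W′) (is-same (β m))))
          other : ∀ {r} → r ∈ R → s ≤ K (β r) W′
          other {r} r∈ with is (β r) (β m) in eq
          ... | true = subst (λ b → s ≤ K b W′) (is-true⁻ {β r} eq) top
          ... | false = ≤-trans (inv h r∈) (≤-trans (m≤n+m _ (bit (is (β r) (β x)))) (≤-reflexive (trans (count-split (β r)) (cong (λ b → bit b + K (β r) W′) eq))))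

    balanced : ∀ {W R} → length W ≡ s + s → Reservoir W R → H → Mixed R → ∀ b → K b W ≡ s
    balanced {W} {R} len inv h ((r , r∈ , rt) , (r′ , r′∈ , rf)) = λ where
        true → lia ρ (h₁ ∷ h₂ ∷ h₃ ∷ h₄ ∷ []) (x₀ ≈ x₃) (K-sum true W) len kt kf
        false → lia ρ (h₁ ∷ h₂ ∷ h₃ ∷ h₄ ∷ []) (x₁ ≈ x₃) (K-sum true W) len kt kf
      where
      kt : s ≤ K true W
      kt = subst (λ b → s ≤ K b W) rt (inv h r∈)
      kf : s ≤ K false W
      kf = subst (λ b → s ≤ K b W) rf (inv h r′∈)
      ρ = K true W ∷ K false W ∷ length W ∷ s ∷ []
      h₁ = x₀ ⊕ x₁ ≈ x₂
      h₂ = x₂ ≈ x₃ ⊕ x₃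
      h₃ = x₃ ≼ x₀
      h₄ = x₃ ≼ x₁

  -- This is only guaranteed when the final remainder is mixed, which makes every earlier remainder
  -- mixed too. A monochromatic remainder already contains almost all balls and needs no pairs.
  record Grabbed (ps : List (Fin n × Fin n)) (J : List (Fin n)) : Set where
    field
      within   : ∀ {z} → z ∈ flat ps → z ∈ J
      distinct : Unique (flat ps)
      differ   : ∀ {w u} → (w , u) ∈ ps → β u ≡ not (β w)
      even     : K true J ≡ K false J

  grabTime : ℕ → ℕ
  grabTime k = k * (n * ((2 + q) * (2 + q)) + 1)

  Sat-grab : ∀ k R → Unique R → k * suc q ≤ length R → length R ≤ n →
    Sat (grab d z₀ k R) (grabTime k) λ (ps , J , R′) →
      R ↭ J ++ R′ × length J ≡ k * suc q × length ps ≡ k × (H → Mixed R′ → Grabbed ps J)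
  Sat-grab zero R uR enough R≤n = ↭-refl , refl , refl , λ _ _ → record
    { within = λ () ; distinct = [] ; differ = λ () ; even = refl }
  Sat-grab (suc k) R uR enough R≤n = Sat-mono (grab d z₀ (suc k) R) time
    (Sat-bind (slideᵇ (simulate d z₀) W xs []) (Sat-slideᵇ f t s hf W xs [] (subst Unique (sym W++xs) uR) lenW (λ _ ()))
      continue) λ _ r → r
    where
    s = suc d
    t = (2 + q) * (2 + q)
    f = simulate d z₀
    W = take (suc q) R
    xs = drop (suc q) R
    W++xs : W ++ xs ≡ R
    W++xs = take++drop≡id (suc q) R
    ss : suc q ≡ s + s
    ss = trans (cong suc q≡) (sym (cong suc (+-suc d d)))
    lenW : length W ≡ s + s
    lenW = trans (length-take≤ (suc q) R (≤-trans (m≤m+n (suc q) _) enough)) ss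
    hf : ∀ L → Unique L → length L ≡ suc (s + s) → Sat (f L) t λ m → H → IsMajority L m
    hf L u l = Sat-simulate u (trans l (cong suc (sym ss)))
    time : length xs * t + (1 + grabTime k) ≤ grabTime (suc k)
    time = ≤-trans (≤-reflexive (sym (+-assoc (length xs * t) 1 _))) (+-monoˡ-≤ _ (+-monoˡ-≤ 1
      (*-monoˡ-≤ t (≤-trans (≤-reflexive (length-drop (suc q) R)) (≤-trans (m∸n≤m _ (suc q)) R≤n)))))
    Result : List (Fin n × Fin n) × List (Fin n) × List (Fin n) → Set
    Result (ps , J , R′) = R ↭ J ++ R′ × length J ≡ suc k * suc q × length ps ≡ suc k × (H → Mixed R′ → Grabbed ps J)
    continue : ∀ ((W′ , R′) : List (Fin n) × List (Fin n)) → W ++ (xs ++ []) ↭ W′ ++ R′ × length W′ ≡ s + s × Reservoir f t s hf W′ R′ → _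
    continue ([] , R′) (_ , () , _)
    continue (w ∷ S , R′) (p , len , inv) = Sat-bind (majority z₀ S) (Sat-majority S) λ u hu →
      Sat-mono (grab d z₀ k R′ >>= _) (≤-reflexive (+-identityʳ _))
        (Sat-bind (grab d z₀ k R′) {b′ = 0} (Sat-grab k R′ (Unique-++⁻ʳ (w ∷ S) uWR) enough′ R′≤n) λ (ps , J , R″) r → collect u hu ps J R″ r) λ _ r → r
      where
      p′ : R ↭ (w ∷ S) ++ R′
      p′ = ↭-trans (↭-reflexive (sym (trans (cong (W ++_) (++-identityʳ xs)) W++xs))) p
      uWR : Unique ((w ∷ S) ++ R′)
      uWR = Unique-↭ p′ uR
      lenR : length R ≡ suc q + length R′
      lenR = trans (↭-length p′) (trans (length-++ (w ∷ S)) (cong (_+ length R′) (trans len (sym ss))))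
      enough′ : k * suc q ≤ length R′
      enough′ = +-cancelˡ-≤ (suc q) _ _ (≤-trans enough (≤-reflexive lenR))
      R′≤n : length R′ ≤ n
      R′≤n = ≤-trans (m≤n+m _ (suc q)) (≤-trans (≤-reflexive (sym lenR)) R≤n)
      legalS : Legal S
      legalS = Unique-++⁻ʳ [ w ] (Unique-++⁻ˡ (w ∷ S) uWR) , suc-injective (trans len (sym ss))
      collect : ∀ u → (Legal S → H → IsMajority S u) → ∀ ps J R″ →
        R′ ↭ J ++ R″ × length J ≡ k * suc q × length ps ≡ k × (H → Mixed R″ → Grabbed ps J) → Result ((w , u) ∷ ps , (w ∷ S) ++ J , R″)
      collect u hu ps J R″ (p″ , lenJ , len-ps , g) =
        ↭-trans p′ (↭-trans (PermP.++⁺ˡ (w ∷ S) p″) (↭-reflexive (sym (++-assoc (w ∷ S) J R″))))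
        , trans (length-++ (w ∷ S)) (cong₂ _+_ (trans len (sym ss)) lenJ)
        , cong suc len-ps
        , λ h mx → extend h mx (g h mx) (hu legalS h)
        where
        extend : H → Mixed R″ → Grabbed ps J → IsMajority S u → Grabbed ((w , u) ∷ ps) ((w ∷ S) ++ J)
        extend h mx G (u∈ , maj) = record
          { within = λ { (here refl) → here refl ; (there (here refl)) → ∈-++⁺ˡ (there u∈)
                       ; (there (there z∈)) → ∈-++⁺ʳ (w ∷ S) (within z∈) }
          ; distinct = (All.tabulate (λ { (here refl) refl → Unique-∉ (Unique-++⁻ˡ (w ∷ S) uWR) u∈
                                        ; (there z∈) refl → apart (here refl) (within z∈) }))
                       ∷ (All.tabulate (λ { z∈ refl → apart (there u∈) (within z∈) })) ∷ distinct
          ; differ = λ { (here refl) → is-false⁻ {β w} opposite ; (there wu∈) → differ wu∈ }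
          ; even = trans (cnt-++ _ (w ∷ S) J) (trans (cong₂ _+_ (trans (bal true) (sym (bal false))) even) (sym (cnt-++ _ (w ∷ S) J))) }
          where
          open Grabbed G
          apart : ∀ {z} → z ∈ w ∷ S → z ∈ J → ⊥
          apart z∈ z∈J = Unique-++-disjoint (w ∷ S) uWR z∈ (∈-resp-↭ (↭-sym p″) (∈-++⁺ˡ z∈J))
          up : ∀ {z} → z ∈ R″ → z ∈ R′
          up z∈ = ∈-resp-↭ (↭-sym p″) (∈-++⁺ʳ J z∈)
          mx′ : Mixed R′
          mx′ = let ((a , a∈ , ea) , (b , b∈ , eb)) = mx in (a , up a∈ , ea) , (b , up b∈ , eb)
          bal : ∀ b → K b (w ∷ S) ≡ s
          bal = balanced f t s hf {w ∷ S} {R′} len inv h mx′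
          atS : K (β w) S ≡ d
          atS = suc-injective (trans (cong (λ b → bit b + K (β w) S) (sym (is-same (β w)))) (bal (β w)))
          -- Removing `w` from a balanced set of 2d + 2 balls leaves only d balls of its colour
          -- among 2d + 1.
          opposite : is (β w) (β u) ≡ false
          opposite = trans (decided {S} {b = β w} (trans (proj₂ legalS) q≡) (u∈ , maj)) (fails (suc d) (K (β w) S) λ le → 1+n≰n (≤-trans le (≤-reflexive atS)))
            where
            fails : ∀ a b → ¬ a ≤ b → (a ≤ᵇ b) ≡ false
            fails a b ¬h with a ≤ᵇ b in eq
            ... | false = refl
            ... | true = ⊥-elim (¬h (≤ᵇ⇒≤ a b (subst T (sym eq) tt)))

-- Linear-time selection (median of medians)

-- Comparison trees; true stands for x ⊑ y and false for y ⊑ x.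
data Compare (B A : Set) : Set where
  ret : A → Compare B A
  cmp : B → B → (Bool → Compare B A) → Compare B A

infixl 1 _⟫_
_⟫_ : ∀ {B A A′ : Set} → Compare B A → (A → Compare B A′) → Compare B A′
ret a ⟫ f = f a
cmp x y k ⟫ f = cmp x y (λ b → k b ⟫ f)

record Five (A : Set) : Set where
  constructor five
  field lo₁ lo₂ mid hi₁ hi₂ : A
open Five

module _ {B : Set} where

  insert : ∀ {A : Set} → (A → B) → A → List A → Compare B (List A)
  insert key x [] = ret [ x ]
  insert key x (y ∷ ys) = cmp (key x) (key y) λ where
    true → ret (x ∷ y ∷ ys)
    false → insert key x ys ⟫ λ zs → ret (y ∷ zs)

  sort : ∀ {A : Set} → (A → B) → List A → Compare B (List A)
  sort key [] = ret []
  sort key (x ∷ xs) = sort key xs ⟫ insert key x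

  fives : ∀ {A : Set} → (A → B) → List A → Compare B (List (Five A) × List A)
  regroup : ∀ {A : Set} → (A → B) → List A → List A → Compare B (List (Five A) × List A)

  fives key (a ∷ b ∷ c ∷ d ∷ e ∷ xs) = sort key (a ∷ b ∷ c ∷ d ∷ e ∷ []) ⟫ regroup key xs
  fives key r = ret ([] , r)

  regroup key xs (a ∷ b ∷ c ∷ d ∷ e ∷ []) = fives key xs ⟫ λ (gs , r) → ret (five a b c d e ∷ gs , r)
  regroup key xs _ = ret ([] , [])

  divide : ∀ {A : Set} → (A → B) → A → List A → Compare B (List A × List A)
  divide key p [] = ret ([] , [])
  divide key p (x ∷ xs) = cmp (key x) (key p) λ b → divide key p xs ⟫ λ (L , G) →
    ret (if b then (x ∷ L , G) else (L , x ∷ G))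

below above lower upper whole : ∀ {A : Set} → Five A → List A
below g = mid g ∷ lo₁ g ∷ lo₂ g ∷ []
above g = mid g ∷ hi₁ g ∷ hi₂ g ∷ []
lower g = lo₁ g ∷ lo₂ g ∷ []
upper g = hi₁ g ∷ hi₂ g ∷ []
whole g = lo₁ g ∷ lo₂ g ∷ mid g ∷ hi₁ g ∷ hi₂ g ∷ []

half : ℕ → ℕ
half m = proj₁ (halve m)

-- The first argument is fuel bounding the length. The element type varies because the recursion
-- selects among groups of five, compared by their medians: whole groups are moved, and their
-- division around the pivot is returned rather than recomputed.
select : ∀ {B A : Set} → ℕ → (A → B) → A → List A → ℕ → Compare B (List A × A × List A)
choosePivot : ∀ {B A : Set} → ℕ → (A → B) → A → List A → ℕ → List (Five A) × List A → Compare B (List A × A × List A)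
-- By transitivity, three balls of each group are already placed relative to the pivot. Only the
-- leftovers, the upper balls of the lower groups and the lower balls of the upper groups must still
-- be compared with it.
splitAround : ∀ {B A : Set} → ℕ → (A → B) → ℕ → List A → List (Five A) × Five A × List (Five A) → Compare B (List A × A × List A)
continue : ∀ {B A : Set} → ℕ → (A → B) → ℕ → List A → A → List A → Compare B (List A × A × List A)

select zero key x xs k = ret ([] , x , xs)
select (suc f) key x xs k = fives key (x ∷ xs) ⟫ choosePivot f key x xs k

choosePivot f key x xs k ([] , _) = divide key x xs ⟫ λ (L , G) → continue f key k L x G
choosePivot f key x xs k (g ∷ gs , r) = select f (key ∘ mid) g gs (half (length (g ∷ gs))) ⟫ splitAround f key k r

splitAround f key k r (Lg , p , Gg) = divide key (mid p) (r ++ concatMap upper Lg ++ concatMap lower Gg) ⟫ λ (L , G) →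
  continue f key k (lower p ++ concatMap below Lg ++ L) (mid p) (upper p ++ concatMap above Gg ++ G)

inSmaller inGreater : ∀ {B A : Set} → ℕ → (A → B) → ℕ → List A → A → List A → Compare B (List A × A × List A)

continue f key k L p G with <-cmp k (length L)
... | tri< _ _ _ = inSmaller f key k L p G
... | tri≈ _ _ _ = ret (L , p , G)
... | tri> _ _ _ = inGreater f key k L p G

inSmaller f key k [] p G = ret ([] , p , G)
inSmaller f key k (y ∷ L) p G = select f key y L k ⟫ λ (L′ , p′ , G′) → ret (L′ , p′ , G′ ++ p ∷ G)

inGreater f key k L p [] = ret (L , p , [])
inGreater f key k L p (y ∷ G) = select f key y G (k ∸ suc (length L)) ⟫ λ (L′ , p′ , G′) → ret (L ++ p ∷ L′ , p′ , G′)

module Selection {B : Set} (_⊑_ : B → B → Set) (⊑-trans : ∀ {x y z} → x ⊑ y → y ⊑ z → x ⊑ z) where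

  -- For equivalent elements both branches must be good. No order on keys is ever decided here:
  -- transitivity together with the answers given is all that is used.
  SatC : ∀ {A : Set} → Compare B A → ℕ → (A → Set) → Set
  SatC (ret a) b φ = φ a
  SatC (cmp x y k) zero φ = ⊥
  SatC (cmp x y k) (suc b) φ = (x ⊑ y → SatC (k true) b φ) × (y ⊑ x → SatC (k false) b φ)

  SatC-mono : ∀ {A : Set} (t : Compare B A) {b b′} {φ ψ : A → Set} →
    b ≤ b′ → SatC t b φ → (∀ a → φ a → ψ a) → SatC t b′ ψ
  SatC-mono (ret a) _ s f = f a s
  SatC-mono (cmp x y k) {suc b} (s≤s b≤) (s₁ , s₂) f =
    (λ h → SatC-mono (k true) b≤ (s₁ h) f) , (λ h → SatC-mono (k false) b≤ (s₂ h) f)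

  SatC-bind : ∀ {A A′ : Set} (t : Compare B A) {k : A → Compare B A′} {b b′} {φ : A → Set} {ψ : A′ → Set} →
    SatC t b φ → (∀ a → φ a → SatC (k a) b′ ψ) → SatC (t ⟫ k) (b + b′) ψ
  SatC-bind (ret a) {k} {b} {b′} s f = SatC-mono (k a) (m≤n+m b′ b) (f a s) (λ _ h → h)
  SatC-bind (cmp x y j) {b = suc b} (s₁ , s₂) f =
    (λ h → SatC-bind (j true) (s₁ h) f) , (λ h → SatC-bind (j false) (s₂ h) f)

  SatC-map : ∀ {A A′ : Set} (t : Compare B A) {g : A → A′} {b} {φ : A → Set} {ψ : A′ → Set} →
    SatC t b φ → (∀ a → φ a → ψ (g a)) → SatC (t ⟫ λ a → ret (g a)) b ψ
  SatC-map t {b = b} s f = SatC-mono (t ⟫ _) (≤-reflexive (+-identityʳ b)) (SatC-bind t {b′ = 0} s f) (λ _ h → h)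

  module _ {A : Set} (key : A → B) where

    Below : List A → A → Set
    Below L p = ∀ {z} → z ∈ L → key z ⊑ key p

    Above : List A → A → Set
    Above G p = ∀ {z} → z ∈ G → key p ⊑ key z

    data Sorted : List A → Set where
      [] : Sorted []
      _∷_ : ∀ {x xs} → Above xs x → Sorted xs → Sorted (x ∷ xs)

    SatC-insert : ∀ x ys → Sorted ys → SatC (insert key x ys) (length ys) λ zs → x ∷ ys ↭ zs × Sorted zs
    SatC-insert x [] s = ↭-refl , (λ ()) ∷ []
    SatC-insert x (y ∷ ys) (a ∷ s) =
      (λ h → ↭-refl , (λ { (here refl) → h ; (there z∈) → ⊑-trans h (a z∈) }) ∷ (a ∷ s)) ,
      (λ h → SatC-map (insert key x ys) (SatC-insert x ys s) λ zs (p , s′) →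
        ↭-trans (↭-swap x y ↭-refl) (↭-prep y p) ,
        (λ z∈ → case ∈-resp-↭ (↭-sym p) z∈ of λ { (here refl) → h ; (there z∈′) → a z∈′ }) ∷ s′)

    triangle : ℕ → ℕ
    triangle zero = 0
    triangle (suc m) = triangle m + m

    SatC-sort : ∀ xs → SatC (sort key xs) (triangle (length xs)) λ zs → xs ↭ zs × Sorted zs
    SatC-sort [] = ↭-refl , []
    SatC-sort (x ∷ xs) = SatC-bind (sort key xs) (SatC-sort xs) λ ys (p , s) →
      SatC-mono (insert key x ys) (≤-reflexive (sym (↭-length p))) (SatC-insert x ys s) λ zs (p′ , s′) →
        ↭-trans (↭-prep x p) p′ , s′

    Good : Five A → Set
    Good g = Below (lower g) (mid g) × Above (upper g) (mid g)

    record Grouped (S : List A) (gs : List (Five A)) (r : List A) : Set where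
      field
        good : ∀ {g} → g ∈ gs → Good g
        perm : S ↭ concatMap whole gs ++ r
        few  : length r ≤ 4
        none : gs ≡ [] → S ≡ r

    SatC-fives : ∀ S → SatC (fives key S) (2 * length S) λ (gs , r) → Grouped S gs r
    SatC-fives [] = record { good = λ () ; perm = ↭-refl ; few = z≤n ; none = λ _ → refl }
    SatC-fives (a ∷ []) = record { good = λ () ; perm = ↭-refl ; few = s≤s z≤n ; none = λ _ → refl }
    SatC-fives (a ∷ b ∷ []) = record { good = λ () ; perm = ↭-refl ; few = s≤s (s≤s z≤n) ; none = λ _ → refl }
    SatC-fives (a ∷ b ∷ c ∷ []) = record { good = λ () ; perm = ↭-refl ; few = s≤s (s≤s (s≤s z≤n)) ; none = λ _ → refl }
    SatC-fives (a ∷ b ∷ c ∷ d ∷ []) = record { good = λ () ; perm = ↭-refl ; few = ≤-refl ; none = λ _ → refl }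
    SatC-fives (a ∷ b ∷ c ∷ d ∷ e ∷ xs) = SatC-mono (sort key block ⟫ regroup key xs)
      {b = 10 + 2 * length xs} {ψ = λ (gs , r) → Grouped (a ∷ b ∷ c ∷ d ∷ e ∷ xs) gs r}
      (lia (length xs ∷ []) [] (con 10 ⊕ 2 ⊛ x₀ ≼ 2 ⊛ (con 5 ⊕ x₀)))
      (SatC-bind (sort key block) {k = regroup key xs} {b = 10} {φ = λ zs → block ↭ zs × Sorted zs} (SatC-sort block) λ zs (p , s) → next zs p s (↭-length p)) λ _ r → r
      where
      block = a ∷ b ∷ c ∷ d ∷ e ∷ []
      next : ∀ zs → block ↭ zs → Sorted zs → 5 ≡ length zs →
        SatC (regroup key xs zs) (2 * length xs) λ (gs , r) → Grouped (a ∷ b ∷ c ∷ d ∷ e ∷ xs) gs r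
      next [] _ _ ()
      next (_ ∷ []) _ _ ()
      next (_ ∷ _ ∷ []) _ _ ()
      next (_ ∷ _ ∷ _ ∷ []) _ _ ()
      next (_ ∷ _ ∷ _ ∷ _ ∷ []) _ _ ()
      next (_ ∷ _ ∷ _ ∷ _ ∷ _ ∷ _ ∷ _) _ _ ()
      next (a′ ∷ b′ ∷ c′ ∷ d′ ∷ e′ ∷ []) p (s₁ ∷ s₂ ∷ s₃ ∷ s₄ ∷ s₅ ∷ []) _ =
        SatC-map (fives key xs) (SatC-fives xs) λ (gs , r) G → record
          { good = λ { (here refl) → (λ { (here refl) → s₁ (there (here refl)) ; (there (here refl)) → s₂ (here refl) })
                                   , (λ { (here refl) → s₃ (here refl) ; (there (here refl)) → s₃ (there (here refl)) })
                     ; (there g∈) → Grouped.good G g∈ }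
          ; perm = PermP.++⁺ p (Grouped.perm G)
          ; few = Grouped.few G
          ; none = λ () }

    record Divided (p : A) (U L G : List A) : Set where
      constructor divided
      field
        perm  : U ↭ L ++ G
        small : Below L p
        large : Above G p

    SatC-divide : ∀ p U → SatC (divide key p U) (length U) λ (L , G) → Divided p U L G
    SatC-divide p [] = divided ↭-refl (λ ()) (λ ())
    SatC-divide p (x ∷ U) =
      (λ h → SatC-map (divide key p U) (SatC-divide p U) λ (L , G) (divided q l g) →
        divided (↭-prep x q) (λ { (here refl) → h ; (there z∈) → l z∈ }) g) ,
      (λ h → SatC-map (divide key p U) (SatC-divide p U) λ (L , G) (divided q l g) →
        divided (↭-trans (↭-prep x q) (↭-sym (shift x L G))) l (λ { (here refl) → h ; (there z∈) → g z∈ }))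

    record Selected (S : List A) (k : ℕ) (L : List A) (p : A) (G : List A) : Set where
      constructor selected
      field
        perm  : S ↭ p ∷ L ++ G
        small : Below L p
        large : Above G p
        rank  : length L ≡ k

  concatMap-↭ : ∀ {A A′ : Set} (f : A → List A′) {xs ys} → xs ↭ ys → concatMap f xs ↭ concatMap f ys
  concatMap-↭ f Perm.refl = ↭-refl
  concatMap-↭ f (Perm.prep x p) = PermP.++⁺ˡ (f x) (concatMap-↭ f p)
  concatMap-↭ f (Perm.swap x y p) = ↭-trans (shifts (f x) (f y)) (PermP.++⁺ˡ (f y) (PermP.++⁺ˡ (f x) (concatMap-↭ f p)))
  concatMap-↭ f (Perm.trans p q) = ↭-trans (concatMap-↭ f p) (concatMap-↭ f q)

  concatMap-++ : ∀ {A A′ : Set} (f : A → List A′) xs ys → concatMap f (xs ++ ys) ≡ concatMap f xs ++ concatMap f ys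
  concatMap-++ f [] ys = refl
  concatMap-++ f (x ∷ xs) ys = trans (cong (f x ++_) (concatMap-++ f xs ys)) (sym (++-assoc (f x) _ _))

  interleave : ∀ {A : Set} (a b c d : List A) → (a ++ b) ++ (c ++ d) ↭ (a ++ c) ++ (b ++ d)
  interleave a b c d = ↭-trans (↭-reflexive (++-assoc a b (c ++ d)))
    (↭-trans (PermP.++⁺ˡ a (shifts b c)) (↭-reflexive (sym (++-assoc a c (b ++ d)))))

  concatMap-split : ∀ {A A′ : Set} (f g h : A → List A′) → (∀ x → f x ↭ g x ++ h x) → ∀ xs →
    concatMap f xs ↭ concatMap g xs ++ concatMap h xs
  concatMap-split f g h e [] = ↭-refl
  concatMap-split f g h e (x ∷ xs) = ↭-trans (PermP.++⁺ (e x) (concatMap-split f g h e xs))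
    (interleave (g x) (h x) (concatMap g xs) (concatMap h xs))

  ∈-concatMap⁻ : ∀ {A A′ : Set} (f : A → List A′) xs {z} → z ∈ concatMap f xs → ∃[ x ] x ∈ xs × z ∈ f x
  ∈-concatMap⁻ f (x ∷ xs) z∈ with ∈-++⁻ (f x) z∈
  ... | inj₁ z∈f = x , here refl , z∈f
  ... | inj₂ z∈r with ∈-concatMap⁻ f xs z∈r
  ...   | y , y∈ , z∈f = y , there y∈ , z∈f

module MedianOfMedians {B : Set} (_⊑_ : B → B → Set) (⊑-trans : ∀ {x y z} → x ⊑ y → y ⊑ z → x ⊑ z) where
  open Selection _⊑_ ⊑-trans

  -- For n elements, grouping costs 2n, the median of medians Cn/5, the comparisons with the pivot
  -- about 2n/5, and the larger side has about 7n/10 elements. The main terms balance at C = 24; the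
  -- value 40 also absorbs rounding.
  C : ℕ
  C = 40

  module Groups {A : Set} (key : A → B) {S : List A} {gs : List (Five A)} {r : List A} (grouped : Grouped key S gs r)
    {k : ℕ} {Lg : List (Five A)} {p : Five A} {Gg : List (Five A)} (sel : Selected (key ∘ mid) gs k Lg p Gg) where
    open Grouped grouped
    open Selected sel renaming (perm to permg; small to smallg; large to largeg; rank to rankg)

    p∈ : p ∈ gs
    p∈ = ∈-resp-↭ (↭-sym permg) (here refl)

    Lg∈ : ∀ {g} → g ∈ Lg → g ∈ gs
    Lg∈ g∈ = ∈-resp-↭ (↭-sym permg) (there (∈-++⁺ˡ g∈))

    Gg∈ : ∀ {g} → g ∈ Gg → g ∈ gs
    Gg∈ g∈ = ∈-resp-↭ (↭-sym permg) (there (∈-++⁺ʳ Lg g∈))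

    below-pivot : ∀ {L} → Below key L (mid p) → Below key (lower p ++ concatMap below Lg ++ L) (mid p)
    below-pivot h z∈ with ∈-++⁻ (lower p) z∈
    ... | inj₁ z∈p = proj₁ (good p∈) z∈p
    ... | inj₂ z∈r with ∈-++⁻ (concatMap below Lg) z∈r
    ...   | inj₂ z∈L = h z∈L
    ...   | inj₁ z∈b with ∈-concatMap⁻ below Lg z∈b
    ...     | g , g∈ , here refl = smallg g∈
    ...     | g , g∈ , there z∈g = ⊑-trans (proj₁ (good (Lg∈ g∈)) z∈g) (smallg g∈)

    above-pivot : ∀ {G} → Above key G (mid p) → Above key (upper p ++ concatMap above Gg ++ G) (mid p)
    above-pivot h z∈ with ∈-++⁻ (upper p) z∈
    ... | inj₁ z∈p = proj₂ (good p∈) z∈p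
    ... | inj₂ z∈r with ∈-++⁻ (concatMap above Gg) z∈r
    ...   | inj₂ z∈G = h z∈G
    ...   | inj₁ z∈b with ∈-concatMap⁻ above Gg z∈b
    ...     | g , g∈ , here refl = largeg g∈
    ...     | g , g∈ , there z∈g = ⊑-trans (largeg g∈) (proj₂ (good (Gg∈ g∈)) z∈g)

    undecided : List A
    undecided = r ++ concatMap upper Lg ++ concatMap lower Gg

    partition : ∀ {L G} → undecided ↭ L ++ G →
      S ↭ mid p ∷ (lower p ++ concatMap below Lg ++ L) ++ (upper p ++ concatMap above Gg ++ G)
    partition {L} {G} pU = ↭-trans perm (↭-trans (PermP.++⁺ʳ r (↭-trans (concatMap-↭ whole permg)
      (PermP.++⁺ˡ (whole p) (↭-trans (↭-reflexive (concatMap-++ whole Lg Gg))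
        (PermP.++⁺ (concatMap-split whole below upper (λ g → ↭-trans (shifts (lo₁ g ∷ lo₂ g ∷ []) [ mid g ]) ↭-refl) Lg)
                   (concatMap-split whole above lower (λ g → ↭-trans (PermP.++-comm (lo₁ g ∷ lo₂ g ∷ []) (mid g ∷ hi₁ g ∷ hi₂ g ∷ [])) ↭-refl) Gg))))))
      (↭-trans (regroup₁ [ lo₁ p ] [ lo₂ p ] [ mid p ] [ hi₁ p ] [ hi₂ p ] (concatMap below Lg) (concatMap upper Lg) (concatMap above Gg) (concatMap lower Gg) r)
        (↭-trans (PermP.++⁺ˡ (lo₁ p ∷ lo₂ p ∷ mid p ∷ hi₁ p ∷ hi₂ p ∷ concatMap below Lg ++ concatMap above Gg) pU)
          (regroup₂ [ lo₁ p ] [ lo₂ p ] [ mid p ] [ hi₁ p ] [ hi₂ p ] (concatMap below Lg) (concatMap above Gg) L G))))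
      where
      open import Algebra.Solver.CommutativeMonoid (PermP.++-commutativeMonoid {A = A})
        using (solve; _⊜_) renaming (_⊕_ to _•_)
      regroup₁ : ∀ a b c d e bl up ab lo r → ((a ++ b ++ c ++ d ++ e) ++ ((bl ++ up) ++ (ab ++ lo))) ++ r ↭
        (a ++ b ++ c ++ d ++ e ++ bl ++ ab) ++ (r ++ up ++ lo)
      regroup₁ = solve 10 (λ a b c d e bl up ab lo r → ((a • (b • (c • (d • e)))) • ((bl • up) • (ab • lo))) • r ⊜
        (a • (b • (c • (d • (e • (bl • ab)))))) • (r • (up • lo))) ↭-refl
      regroup₂ : ∀ a b c d e bl ab L G → (a ++ b ++ c ++ d ++ e ++ bl ++ ab) ++ (L ++ G) ↭
        c ++ (((a ++ b) ++ (bl ++ L)) ++ ((d ++ e) ++ (ab ++ G)))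
      regroup₂ = solve 9 (λ a b c d e bl ab L G → (a • (b • (c • (d • (e • (bl • ab)))))) • (L • G) ⊜
        c • (((a • b) • (bl • L)) • ((d • e) • (ab • G)))) ↭-refl

    groups : length gs ≡ 1 + (k + length Gg)
    groups = trans (↭-length permg) (cong suc (trans (length-++ Lg) (cong (_+ length Gg) rankg)))

    undecided-few : length undecided ≤ 4 + 2 * (k + length Gg)
    undecided-few = ≤-trans (≤-reflexive (trans (length-++ r) (cong (length r +_) (trans (length-++ (concatMap upper Lg))
        (cong₂ _+_ (trans (length-concatMap upper 2 Lg (λ _ → refl)) (trans (cong (_* 2) rankg) (*-comm k 2))) (trans (length-concatMap lower 2 Gg (λ _ → refl)) (*-comm (length Gg) 2)))))))
      (lia (length r ∷ k ∷ length Gg ∷ []) ((x₀ ≼ con 4) ∷ []) (x₀ ⊕ (2 ⊛ x₁ ⊕ 2 ⊛ x₂) ≼ con 4 ⊕ 2 ⊛ (x₁ ⊕ x₂)) few)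

    length-low : ∀ L → length (lower p ++ concatMap below Lg ++ L) ≡ 2 + (k * 3 + length L)
    length-low L = cong (2 +_) (trans (length-++ (concatMap below Lg)) (cong (_+ length L)
      (trans (length-concatMap below 3 Lg (λ _ → refl)) (cong (_* 3) rankg))))

    length-high : ∀ G → length (upper p ++ concatMap above Gg ++ G) ≡ 2 + (length Gg * 3 + length G)
    length-high G = cong (2 +_) (trans (length-++ (concatMap above Gg)) (cong (_+ length G)
      (length-concatMap above 3 Gg (λ _ → refl))))

  half-split : ∀ g m → 1 ≤ g → g ≡ 1 + (half g + m) → m ≤ half g × half g ≤ suc m
  half-split g m g≥1 e with halve g
  ... | h , inj₁ e′ = lia (g ∷ h ∷ m ∷ []) ((x₀ ≈ x₁ ⊕ x₁) ∷ (x₀ ≈ con 1 ⊕ (x₁ ⊕ x₂)) ∷ []) (x₂ ≼ x₁) e′ e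
                    , lia (g ∷ h ∷ m ∷ []) ((x₀ ≈ x₁ ⊕ x₁) ∷ (x₀ ≈ con 1 ⊕ (x₁ ⊕ x₂)) ∷ []) (x₁ ≼ con 1 ⊕ x₂) e′ e
  ... | h , inj₂ e′ = lia (g ∷ h ∷ m ∷ []) ((x₀ ≈ con 1 ⊕ (x₁ ⊕ x₁)) ∷ (x₀ ≈ con 1 ⊕ (x₁ ⊕ x₂)) ∷ []) (x₂ ≼ x₁) e′ e
                    , lia (g ∷ h ∷ m ∷ []) ((x₀ ≈ con 1 ⊕ (x₁ ⊕ x₁)) ∷ (x₀ ≈ con 1 ⊕ (x₁ ⊕ x₂)) ∷ []) (x₁ ≼ con 1 ⊕ x₂) e′ e

  half< : ∀ g → 1 ≤ g → half g < g
  half< g g≥1 with halve g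
  ... | h , inj₁ e = lia (g ∷ h ∷ []) ((con 1 ≼ x₀) ∷ (x₀ ≈ x₁ ⊕ x₁) ∷ []) (x₁ ≺ x₀) g≥1 e
  ... | h , inj₂ e = lia (g ∷ h ∷ []) ((x₀ ≈ con 1 ⊕ (x₁ ⊕ x₁)) ∷ []) (x₁ ≺ x₀) e

  Outcome : ∀ {A : Set} → (A → B) → List A → ℕ → List A × A × List A → Set
  Outcome key S k (L , p , G) = Selected key S k L p G

  SatC-select : ∀ {A : Set} f (key : A → B) x xs k → length (x ∷ xs) ≤ f → k < length (x ∷ xs) →
    SatC (select f key x xs k) (C * length (x ∷ xs)) (Outcome key (x ∷ xs) k)
  SatC-continue : ∀ {A : Set} f (key : A → B) S k L p G b → Divided key p (L ++ G) L G → S ↭ p ∷ L ++ G →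
    length L ≤ f → length G ≤ f → k < length S → C * length L ≤ b → C * length G ≤ b →
    SatC (continue f key k L p G) b (Outcome key S k)

  SatC-select zero key x xs k () k<
  SatC-select (suc f) key x xs k (s≤s n≤f) k< = SatC-mono (select (suc f) key x xs k) {b = 2 * n + (C * n ∸ 2 * n)} {ψ = Outcome key S k}
    (≤-reflexive (m+[n∸m]≡n (*-monoˡ-≤ n (s≤s (s≤s (z≤n {38}))))))
    (SatC-bind (fives key S) {k = choosePivot f key x xs k} (SatC-fives key S) next) λ _ r → r
    where
    S = x ∷ xs
    n = length S
    enough : ∀ {b} → 2 * n + b ≤ C * n → b ≤ C * n ∸ 2 * n
    enough {b} h = +-cancelˡ-≤ (2 * n) _ _ (≤-trans h (≤-reflexive (sym (m+[n∸m]≡n (*-monoˡ-≤ n (s≤s (s≤s (z≤n {38}))))))))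
    next : ∀ ((gs , r) : List (Five _) × List _) → Grouped key S gs r → SatC (choosePivot f key x xs k (gs , r)) (C * n ∸ 2 * n) (Outcome key S k)
    next ([] , r) G = SatC-mono (divide key x xs ⟫ _) {ψ = Outcome key S k}
      (enough (lia (length xs ∷ []) ((con 1 ⊕ x₀ ≼ con 4) ∷ []) (2 ⊛ (con 1 ⊕ x₀) ⊕ (x₀ ⊕ C ⊛ x₀) ≼ C ⊛ (con 1 ⊕ x₀))
        (≤-trans (≤-reflexive (cong length (Grouped.none G refl))) (Grouped.few G))))
      (SatC-bind (divide key x xs) (SatC-divide key x xs) λ (L , G′) (divided p l g) →
        SatC-continue f key S k L x G′ (C * length xs) (divided ↭-refl l g) (↭-prep x p)
          (≤-trans (lengthL {L = L} p) n≤f) (≤-trans (lengthG {L = L} p) n≤f) k< (*-monoʳ-≤ C (lengthL {L = L} p)) (*-monoʳ-≤ C (lengthG {L = L} p))) λ _ r → r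
      where
      lengthL : ∀ {L G′} → xs ↭ L ++ G′ → length L ≤ length xs
      lengthL {L} p = ≤-trans (m≤m+n _ _) (≤-reflexive (trans (sym (length-++ L)) (sym (↭-length p))))
      lengthG : ∀ {L G′} → xs ↭ L ++ G′ → length G′ ≤ length xs
      lengthG {L} p = ≤-trans (m≤n+m _ (length L)) (≤-reflexive (trans (sym (length-++ L)) (sym (↭-length p))))
    next (g ∷ gs , r) grouped = SatC-mono (select f (key ∘ mid) g gs (half |gs|) ⟫ splitAround f key k r) {b = C * |gs| + (C * n ∸ 2 * n ∸ C * |gs|)} {ψ = Outcome key S k}
      (≤-reflexive (m+[n∸m]≡n (enough (lia (n ∷ |gs| ∷ []) ((5 ⊛ x₁ ≼ x₀) ∷ []) (2 ⊛ x₀ ⊕ C ⊛ x₁ ≼ C ⊛ x₀) five≤))))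
      (SatC-bind (select f (key ∘ mid) g gs (half |gs|)) {k = splitAround f key k r} (SatC-select f (key ∘ mid) g gs (half |gs|)
        (lia (n ∷ |gs| ∷ f ∷ []) ((5 ⊛ x₁ ≼ x₀) ∷ (x₀ ≼ con 1 ⊕ x₂) ∷ (con 1 ≼ x₁) ∷ []) (x₁ ≼ x₂) five≤ (s≤s n≤f) (s≤s z≤n)) (half< |gs| (s≤s z≤n))) pivot) λ _ r → r
      where
      |gs| = length (g ∷ gs)
      total : n ≡ |gs| * 5 + length r
      total = trans (↭-length (Grouped.perm grouped)) (trans (length-++ (concatMap whole (g ∷ gs))) (cong (_+ length r) (length-concatMap whole 5 (g ∷ gs) (λ _ → refl))))
      five≤ : 5 * |gs| ≤ n
      five≤ = ≤-trans (≤-reflexive (*-comm 5 |gs|)) (≤-trans (m≤m+n _ _) (≤-reflexive (sym total)))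
      pivot : ∀ ((Lg , p , Gg) : List (Five _) × Five _ × List (Five _)) → Outcome (key ∘ mid) (g ∷ gs) (half |gs|) (Lg , p , Gg) →
        SatC (splitAround f key k r (Lg , p , Gg)) (C * n ∸ 2 * n ∸ C * |gs|) (Outcome key S k)
      pivot (Lg , p , Gg) sel = SatC-mono (divide key (mid p) undecided ⟫ _) {ψ = Outcome key S k} time
        (SatC-bind (divide key (mid p) undecided) (SatC-divide key (mid p) undecided) λ (L , G) (divided q l g) →
          let pq = partition q
              Lt = lower p ++ concatMap below Lg ++ L
              Gt = upper p ++ concatMap above Gg ++ G
              sum : n ≡ suc (length Lt + length Gt)
              sum = trans (↭-length pq) (cong suc (length-++ Lt))
              L≤ : length Lt ≤ m
              L≤ = lia (length Lt ∷ length Gt ∷ n ∷ m ∷ gg ∷ length G ∷ []) ((x₂ ≈ con 1 ⊕ (x₀ ⊕ x₁)) ∷ (x₁ ≈ con 2 ⊕ (3 ⊛ x₄ ⊕ x₅)) ∷ (x₃ ⊕ (con 3 ⊕ 3 ⊛ x₄) ≈ x₂) ∷ []) (x₀ ≼ x₃)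
                sum (trans (length-high G) (cong (λ a → 2 + (a + length G)) (*-comm gg 3))) m+
              G≤ : length Gt ≤ m
              G≤ = lia (length Lt ∷ length Gt ∷ n ∷ m ∷ gg ∷ length L ∷ h ∷ []) ((x₂ ≈ con 1 ⊕ (x₀ ⊕ x₁)) ∷ (x₀ ≈ con 2 ⊕ (3 ⊛ x₆ ⊕ x₅)) ∷ (x₃ ⊕ (con 3 ⊕ 3 ⊛ x₄) ≈ x₂) ∷ (x₄ ≼ x₆) ∷ []) (x₁ ≼ x₃)
                sum (trans (length-low L) (cong (λ a → 2 + (a + length L)) (*-comm h 3))) m+ (proj₁ hs)
              m≤f : m ≤ f
              m≤f = lia (m ∷ gg ∷ n ∷ f ∷ []) ((x₀ ⊕ (con 3 ⊕ 3 ⊛ x₁) ≈ x₂) ∷ (x₂ ≼ con 1 ⊕ x₃) ∷ []) (x₀ ≼ x₃) m+ (s≤s n≤f)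
          in SatC-continue f key S k Lt (mid p) Gt (C * m) (divided ↭-refl (below-pivot l) (above-pivot g)) pq
               (≤-trans L≤ m≤f) (≤-trans G≤ m≤f) k< (*-monoʳ-≤ C L≤) (*-monoʳ-≤ C G≤)) λ _ r → r
        where
        open Groups key grouped sel
        h = half |gs|
        gg = length Gg
        hs : gg ≤ h × h ≤ suc gg
        hs = half-split |gs| gg (s≤s z≤n) groups
        m = n ∸ (3 + 3 * gg)
        m+ : m + (3 + 3 * gg) ≡ n
        m+ = m∸n+n≡m (lia (n ∷ |gs| ∷ h ∷ gg ∷ []) ((5 ⊛ x₁ ≼ x₀) ∷ (x₁ ≈ con 1 ⊕ (x₂ ⊕ x₃)) ∷ []) (con 3 ⊕ 3 ⊛ x₃ ≼ x₀) five≤ groups)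
        time : length undecided + C * m ≤ C * n ∸ 2 * n ∸ C * |gs|
        time = +-cancelˡ-≤ (C * |gs|) _ _ (≤-trans (enough (lia (n ∷ |gs| ∷ length undecided ∷ m ∷ h ∷ gg ∷ length r ∷ [])
          ((x₀ ≈ 5 ⊛ x₁ ⊕ x₆) ∷ (x₆ ≼ con 4) ∷ (x₁ ≈ con 1 ⊕ (x₄ ⊕ x₅)) ∷ (x₂ ≼ con 4 ⊕ 2 ⊛ (x₄ ⊕ x₅)) ∷ (x₃ ⊕ (con 3 ⊕ 3 ⊛ x₅) ≈ x₀) ∷ (x₄ ≼ con 1 ⊕ x₅) ∷ [])
          (2 ⊛ x₀ ⊕ (C ⊛ x₁ ⊕ (x₂ ⊕ C ⊛ x₃)) ≼ C ⊛ x₀)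
          (trans total (cong (_+ length r) (*-comm |gs| 5))) (Grouped.few grouped) groups undecided-few m+ (proj₂ hs)))
          (≤-reflexive (sym (m+[n∸m]≡n (enough (lia (n ∷ |gs| ∷ []) ((5 ⊛ x₁ ≼ x₀) ∷ []) (2 ⊛ x₀ ⊕ C ⊛ x₁ ≼ C ⊛ x₀) five≤))))))

  SatC-continue f key S k L p G b (divided _ lo up) pS L≤ G≤ k< bL bG with <-cmp k (length L)
  ... | tri< k<L _ _ = recurseL L lo pS L≤ bL k<L
    where
    open import Algebra.Solver.CommutativeMonoid (PermP.++-commutativeMonoid {A = _}) using (solve; _⊜_) renaming (_⊕_ to _•_)
    recurseL : ∀ L → Below key L p → S ↭ p ∷ L ++ G → length L ≤ f → C * length L ≤ b → k < length L →
      SatC (inSmaller f key k L p G) b (Outcome key S k)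
    recurseL (y ∷ L) lo pS L≤ bL k<L =
      SatC-map (select f key y L k) (SatC-mono (select f key y L k) bL (SatC-select f key y L k L≤ k<L) λ _ r → r) found
      where
      found : ∀ ((L′ , p′ , G′) : List _ × _ × List _) → Outcome key (y ∷ L) k (L′ , p′ , G′) → Outcome key S k (L′ , p′ , G′ ++ p ∷ G)
      found (L′ , p′ , G′) (selected q l g r) = selected
        (↭-trans pS (↭-trans (↭-prep p (PermP.++⁺ʳ G q))
          (solve 5 (λ a b c d e → a • ((b • (c • d)) • e) ⊜ b • (c • (d • (a • e)))) ↭-refl [ p ] [ p′ ] L′ G′ G)))
        l (λ z∈ → high z∈ (∈-++⁻ G′ z∈)) r
        where
        p′⊑p : key p′ ⊑ key p
        p′⊑p = lo (∈-resp-↭ (↭-sym q) (here refl))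
        high : ∀ {z} → z ∈ G′ ++ p ∷ G → z ∈ G′ ⊎ z ∈ p ∷ G → key p′ ⊑ key z
        high _ (inj₁ z∈) = g z∈
        high _ (inj₂ (here refl)) = p′⊑p
        high _ (inj₂ (there z∈)) = ⊑-trans p′⊑p (up z∈)
  ... | tri≈ _ e _ = selected pS lo up (sym e)
  ... | tri> _ _ L<k = recurseG G up pS G≤ bG
    where
    open import Algebra.Solver.CommutativeMonoid (PermP.++-commutativeMonoid {A = _}) using (solve; _⊜_) renaming (_⊕_ to _•_)
    recurseG : ∀ G → Above key G p → S ↭ p ∷ L ++ G → length G ≤ f → C * length G ≤ b →
      SatC (inGreater f key k L p G) b (Outcome key S k)
    recurseG [] up pS G≤ bG = ⊥-elim (<⇒≱ k< (≤-trans (≤-reflexive (trans (↭-length pS) (cong (suc ∘ length) (++-identityʳ L)))) L<k))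
    recurseG (y ∷ G) up pS G≤ bG =
      SatC-map (select f key y G k′) (SatC-mono (select f key y G k′) bG (SatC-select f key y G k′ G≤ k′<) λ _ r → r) found
      where
      k′ = k ∸ suc (length L)
      k′+ : k′ + suc (length L) ≡ k
      k′+ = m∸n+n≡m L<k
      k′< : k′ < length (y ∷ G)
      k′< = lia (k′ ∷ length L ∷ k ∷ length S ∷ length (y ∷ G) ∷ []) ((x₀ ⊕ (con 1 ⊕ x₁) ≈ x₂) ∷ (x₂ ≺ x₃) ∷ (x₃ ≈ con 1 ⊕ (x₁ ⊕ x₄)) ∷ []) (x₀ ≺ x₄)
        k′+ k< (trans (↭-length pS) (cong suc (length-++ L)))
      found : ∀ ((L′ , p′ , G′) : List _ × _ × List _) → Outcome key (y ∷ G) k′ (L′ , p′ , G′) → Outcome key S k (L ++ p ∷ L′ , p′ , G′)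
      found (L′ , p′ , G′) (selected q l g r) = selected
        (↭-trans pS (↭-trans (↭-prep p (PermP.++⁺ˡ L q))
          (solve 5 (λ a b c d e → a • (b • (c • (d • e))) ⊜ c • ((b • (a • d)) • e)) ↭-refl [ p ] L [ p′ ] L′ G′)))
        (λ z∈ → low z∈ (∈-++⁻ L z∈)) g
        (trans (length-++ L) (trans (cong (λ a → length L + suc a) r) (trans (+-suc _ _) (trans (+-comm (suc (length L)) k′) k′+))))
        where
        p⊑p′ : key p ⊑ key p′
        p⊑p′ = up (∈-resp-↭ (↭-sym q) (here refl))
        low : ∀ {z} → z ∈ L ++ p ∷ L′ → z ∈ L ⊎ z ∈ p ∷ L′ → key z ⊑ key p′
        low _ (inj₁ z∈) = ⊑-trans (lo z∈) p⊑p′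
        low _ (inj₂ (here refl)) = p⊑p′
        low _ (inj₂ (there z∈)) = l z∈

-- Comparing balls of unknown colours

data Verdict : Set where
  le ge ne : Verdict

-- orQ and andQ reply with a ball coloured like the disjunction or the conjunction of
-- the colours of two balls, possibly with one of the reference balls o (colour
-- false) and i (colour true); they may give up with an exception.
module Comparing {n q : ℕ} {E : Set} (o i : Fin n) (orQ andQ : Fin n → Fin n → Tree n q (E ⊎ Fin n)) where

  readOr readAnd : Fin n → Fin n → Fin n → Maybe Verdict
  readOr x y r = if does (r ≟ x) then just ge else if does (r ≟ y) then just le else if does (r ≟ o) then just le else nothing
  readAnd x y r = if does (r ≟ x) then just le else if does (r ≟ y) then just ge else if does (r ≟ i) then just le else nothing

  afterAnd : Fin n → Fin n → E ⊎ Fin n → Tree n q (E ⊎ Verdict)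
  afterAnd x y (inj₁ e) = ret (inj₁ e)
  afterAnd x y (inj₂ r) with readAnd x y r
  ... | just v = ret (inj₂ v)
  ... | nothing = ret (inj₂ ne)

  afterOr : Fin n → Fin n → E ⊎ Fin n → Tree n q (E ⊎ Verdict)
  afterOr x y (inj₁ e) = ret (inj₁ e)
  afterOr x y (inj₂ r) with readOr x y r
  ... | just v = ret (inj₂ v)
  ... | nothing = andQ x y >>= afterAnd x y

  -- If the disjunction is answered by `x` or `y`, that ball is the larger one; if by `o`, both are
  -- false. If by `i`, one of them is true, and the conjunction decides dually: there the answer `o`
  -- says that one is false, so the balls differ.
  compare₂ : Fin n → Fin n → Tree n q (E ⊎ Verdict)
  compare₂ x y = orQ x y >>= afterOr x y

  record Sorted₄ : Set where
    constructor sorted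
    field zeros ones likeX likeY : List (Fin n)

  data Scanned : Set where
    -- The flag is the colour of x.
    oriented : Bool → List (Fin n) → Sorted₄ → Scanned
    exhausted : Sorted₄ → Scanned

  -- Given that x and y have different colours, compare further balls with both of
  -- them. Each of these gets a known colour, in terms of that of x, until one between
  -- x and y reveals the colour of x.
  scan : Fin n → Fin n → List (Fin n) → Sorted₄ → Tree n q (E ⊎ Scanned)
  scanX : Fin n → Fin n → Fin n → List (Fin n) → Sorted₄ → E ⊎ Verdict → Tree n q (E ⊎ Scanned)
  scanY : Fin n → Fin n → Fin n → List (Fin n) → Sorted₄ → Verdict → E ⊎ Verdict → Tree n q (E ⊎ Scanned)

  scan x y [] s = ret (inj₂ (exhausted s))
  scan x y (z ∷ todo) s = compare₂ z x >>= scanX x y z todo s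

  scanX x y z todo s (inj₁ e) = ret (inj₁ e)
  scanX x y z todo (sorted a b c d) (inj₂ ne) = scan x y todo (sorted a b c (z ∷ d))
  scanX x y z todo s (inj₂ v) = compare₂ z y >>= scanY x y z todo s v

  scanY x y z todo s v (inj₁ e) = ret (inj₁ e)
  scanY x y z todo (sorted a b c d) v (inj₂ ne) = scan x y todo (sorted a b (z ∷ c) d)
  -- One of `x` and `y` is false and the other true. So `z` below both is false and `z` above both
  -- is true, while `z` in between shows which is which.
  scanY x y z todo (sorted a b c d) le (inj₂ le) = scan x y todo (sorted (z ∷ a) b c d)
  scanY x y z todo s le (inj₂ ge) = ret (inj₂ (oriented true (z ∷ todo) s))
  scanY x y z todo s ge (inj₂ le) = ret (inj₂ (oriented false (z ∷ todo) s))
  scanY x y z todo (sorted a b c d) _ (inj₂ ge) = scan x y todo (sorted a (z ∷ b) c d)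
  scanY x y z todo (sorted a b c d) ne (inj₂ le) = scan x y todo (sorted a b c d)

  headOr : Fin n → List (Fin n) → Fin n
  headOr x [] = x
  headOr x (z ∷ _) = z

  -- Two colourings remain, differing by a swap of the balls like `x` with those like `y`. If zeros
  -- or ones do not lose in either, such a ball is returned; otherwise the winning colour changes
  -- with the swap, as that of `x` or of `y` does. If the required list of zeros or ones is empty,
  -- the inequalities force a balance in which `x` will do.
  conclude : Fin n → Fin n → Sorted₄ → Fin n
  conclude x y (sorted a b c d)
    with length c + length b ≤? length d + length a | length d + length b ≤? length c + length a
       | length c + length a ≤? length d + length b | length d + length a ≤? length c + length b
  ... | yes _ | yes _ | _ | _ = headOr x a
  ... | _ | _ | yes _ | yes _ = headOr x b
  ... | _ | yes _ | _ | yes _ = x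
  ... | _ | _ | _ | _ = y

  record State : Set where
    constructor state
    field open′ zeros ones : List (Fin n)

  update : Bool → Fin n → Fin n → List (Fin n) → Sorted₄ → State → State
  update true x y todo (sorted a b c d) (state _ Z O) = state todo (a ++ (y ∷ d) ++ Z) (b ++ (x ∷ c) ++ O)
  update false x y todo (sorted a b c d) (state _ Z O) = state todo (a ++ (x ∷ c) ++ Z) (b ++ (y ∷ d) ++ O)

  module _ {pool : List (Fin n)} where
    Ball : Set
    Ball = ∃[ x ] x ∈ pool

    -- Comparisons decided by known colours are free. Unequal balls start a scan: either it orients
    -- the pair and the selection goes on with many colours known, or it exhausts the balls and the
    -- answer is found at once, which is the alternative `Fin n` of the result.
    interpret : ∀ {A : Set} → Compare Ball A → State → Tree n q (E ⊎ (Fin n ⊎ A))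
    afterCompare : ∀ {A : Set} → Fin n → Fin n → (Bool → Compare Ball A) → State → E ⊎ Verdict → Tree n q (E ⊎ (Fin n ⊎ A))
    afterScan : ∀ {A : Set} → Fin n → Fin n → (Bool → Compare Ball A) → State → E ⊎ Scanned → Tree n q (E ⊎ (Fin n ⊎ A))

    interpret (ret a) st = ret (inj₂ (inj₂ a))
    interpret (cmp (x , _) (y , _) k) st@(state U Z O) =
      if does (x ≟ y) ∨ (mem Z x ∨ mem O y) then interpret (k true) st
      else if mem O x ∨ mem Z y then interpret (k false) st
      else (compare₂ x y >>= afterCompare x y k st)

    afterCompare x y k st (inj₁ e) = ret (inj₁ e)
    afterCompare x y k st (inj₂ le) = interpret (k true) st
    afterCompare x y k st (inj₂ ge) = interpret (k false) st
    afterCompare x y k st@(state U _ _) (inj₂ ne) =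
      scan x y (remove y (remove x U)) (sorted [] [] [] []) >>= afterScan x y k st

    afterScan x y k st (inj₁ e) = ret (inj₁ e)
    afterScan x y k (state _ Z O) (inj₂ (exhausted (sorted a b c d))) =
      ret (inj₂ (inj₁ (conclude x y (sorted (a ++ Z) (b ++ O) (x ∷ c) (y ∷ d)))))
    afterScan x y k st (inj₂ (oriented b todo s)) = interpret (k (not b)) (update b x y todo s st)

NonMin : ∀ {n} → (Fin n → Bool) → List (Fin n) → Fin n → Set
NonMin β L p = p ∈ L × length L ≤ 2 * cnt (λ z → is (β p) (β z)) L

module Interpreting {c : ℕ} (rule : Rule c) {n q : ℕ} (χ : Coloring n c) (H : Set) (β : Fin n → Bool)
  {E : Set} (o i : Fin n) (orQ andQ : Fin n → Fin n → Tree n q (E ⊎ Fin n))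
  (pool : List (Fin n)) (upool : Unique pool) (Exc : E → Set) (t : ℕ) where
  open Rule rule
  open Runs rule {n} {q} χ
  open Comparing {n} {q} {E} o i orQ andQ

  OrSpec AndSpec : Fin n → Fin n → E ⊎ Fin n → Set
  OrSpec x y (inj₁ e) = Exc e
  OrSpec x y (inj₂ r) = H → r ∈ x ∷ y ∷ o ∷ i ∷ [] × β r ≡ β x ∨ β y
  AndSpec x y (inj₁ e) = Exc e
  AndSpec x y (inj₂ r) = H → r ∈ x ∷ y ∷ o ∷ i ∷ [] × β r ≡ β x ∧ β y

  _⊑_ : Fin n → Fin n → Set
  x ⊑ y = H → β x ≡ true → β y ≡ true

  Spec : Fin n → Fin n → E ⊎ Verdict → Set
  Spec x y (inj₁ e) = Exc e
  Spec x y (inj₂ le) = x ⊑ y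
  Spec x y (inj₂ ge) = y ⊑ x
  Spec x y (inj₂ ne) = H → β y ≡ not (β x)

  module _ (βo : H → β o ≡ false) (βi : H → β i ≡ true)
    (Sat-or : ∀ {x y} → x ∈ pool → y ∈ pool → x ≢ y → Sat (orQ x y) t (OrSpec x y))
    (Sat-and : ∀ {x y} → x ∈ pool → y ∈ pool → x ≢ y → Sat (andQ x y) t (AndSpec x y)) where

    or-true : ∀ {a b} → b ≡ true → a ∨ b ≡ true
    or-true {true} refl = refl
    or-true {false} refl = refl

    and-true : ∀ {a b} → a ∧ b ≡ true → a ≡ true × b ≡ true
    and-true {true} {true} _ = refl , refl

    Sat-compare₂ : ∀ {x y} → x ∈ pool → y ∈ pool → x ≢ y → Sat (compare₂ x y) (t + t) (Spec x y)
    Sat-compare₂ {x} {y} x∈ y∈ x≢y = Sat-bind (orQ x y) (Sat-or x∈ y∈ x≢y) λ where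
        (inj₁ e) h → h
        (inj₂ r) h → ors r h
      where
      ands : ∀ r r′ → (H → r ∈ x ∷ y ∷ o ∷ i ∷ [] × β r ≡ β x ∨ β y) → r ≢ x → r ≢ y → r ≢ o →
        (H → r′ ∈ x ∷ y ∷ o ∷ i ∷ [] × β r′ ≡ β x ∧ β y) → Sat (afterAnd x y (inj₂ r′)) 0 (Spec x y)
      ands r r′ hr n₁ n₂ n₃ h with r′ ≟ x
      ... | yes refl = λ H′ e → proj₂ (and-true (trans (sym (proj₂ (h H′))) e))
      ... | no m₁ with r′ ≟ y
      ...   | yes refl = λ H′ e → proj₁ (and-true (trans (sym (proj₂ (h H′))) e))
      ...   | no m₂ with r′ ≟ i
      ...     | yes refl = λ H′ e → proj₂ (and-true (trans (sym (proj₂ (h H′))) (βi H′)))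
      ...     | no m₃ = λ H′ → complementary (disj H′) (conj H′)
        where
        disj : H → β x ∨ β y ≡ true
        disj H′ with hr H′
        ... | here e , _ = ⊥-elim (n₁ e)
        ... | there (here e) , _ = ⊥-elim (n₂ e)
        ... | there (there (here e)) , _ = ⊥-elim (n₃ e)
        ... | there (there (there (here refl))) , e = trans (sym e) (βi H′)
        conj : H → β x ∧ β y ≡ false
        conj H′ with h H′
        ... | here e , _ = ⊥-elim (m₁ e)
        ... | there (here e) , _ = ⊥-elim (m₂ e)
        ... | there (there (here refl)) , e = trans (sym e) (βo H′)
        ... | there (there (there (here e))) , _ = ⊥-elim (m₃ e)
        complementary : ∀ {a b} → a ∨ b ≡ true → a ∧ b ≡ false → b ≡ not a
        complementary {true} {false} _ _ = refl
        complementary {false} {true} _ _ = refl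
      ors : ∀ r → (H → r ∈ x ∷ y ∷ o ∷ i ∷ [] × β r ≡ β x ∨ β y) → Sat (afterOr x y (inj₂ r)) t (Spec x y)
      ors r h with r ≟ x
      ... | yes refl = λ H′ e → trans (proj₂ (h H′)) (or-true {β x} e)
      ... | no n₁ with r ≟ y
      ...   | yes refl = λ H′ e → trans (proj₂ (h H′)) (cong (_∨ β y) e)
      ...   | no n₂ with r ≟ o
      ...     | yes refl = λ H′ e → case trans (sym (βo H′)) (trans (proj₂ (h H′)) (cong (_∨ β y) e)) of λ ()
      ...     | no n₃ = Sat-mono (andQ x y >>= afterAnd x y) (≤-reflexive (+-identityʳ t)) (Sat-bind (andQ x y) {b′ = 0} (Sat-and x∈ y∈ x≢y) (λ where
                  (inj₁ e) h′ → h′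
                  (inj₂ r′) h′ → ands r r′ h n₁ n₂ n₃ h′)) λ _ r → r

module Amortised {c : ℕ} (rule : Rule c) {n q : ℕ} (χ : Coloring n c) (H : Set) (β : Fin n → Bool)
  {E : Set} (o i : Fin n) (orQ andQ : Fin n → Fin n → Tree n q (E ⊎ Fin n))
  (pool : List (Fin n)) (upool : Unique pool) (Exc : E → Set) (t : ℕ) where
  open Rule rule
  open Runs rule {n} {q} χ
  open Comparing {n} {q} {E} o i orQ andQ
  open Interpreting rule {n} {q} χ H β o i orQ andQ pool upool Exc t
  open import Algebra.Solver.CommutativeMonoid (PermP.++-commutativeMonoid {A = Fin n}) using (solve; _⊜_) renaming (_⊕_ to _•_)

  Sat-assoc : ∀ {A A′ A″ : Set} (p : Tree n q A) {f : A → Tree n q A′} {g : A′ → Tree n q A″} {b φ} →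
    Sat (p >>= λ a → f a >>= g) b φ → Sat (p >>= f >>= g) b φ
  Sat-assoc (ret a) s = s
  Sat-assoc (ask Q e k) {b = suc b} s a v = Sat-assoc (k a) (s a v)

  -- A scanned ball takes up to two comparisons, of up to two oracle calls each.
  unit : ℕ
  unit = (t + t) + (t + t)

  members : Sorted₄ → List (Fin n)
  members (sorted a b c d) = a ++ b ++ c ++ d

  Colours : Bool → List (Fin n) → Set
  Colours v L = ∀ {z} → z ∈ L → β z ≡ v

  record Known (x y : Fin n) (s : Sorted₄) : Set where
    constructor known
    open Sorted₄ s
    field
      knownZeros : H → Colours false zeros
      knownOnes  : H → Colours true ones
      knownX     : H → Colours (β x) likeX
      knownY     : H → Colours (β y) likeY

  with-head : ∀ {v z L} → (H → β z ≡ v) → (H → Colours v L) → H → Colours v (z ∷ L)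
  with-head e k h (here refl) = e h
  with-head e k h (there z∈) = k h z∈

  bool-cases : ∀ a → a ≡ true ⊎ a ≡ false
  bool-cases true = inj₁ refl
  bool-cases false = inj₂ refl

  module _ (βo : H → β o ≡ false) (βi : H → β i ≡ true)
    (Sat-or : ∀ {x y} → x ∈ pool → y ∈ pool → x ≢ y → Sat (orQ x y) t (OrSpec x y))
    (Sat-and : ∀ {x y} → x ∈ pool → y ∈ pool → x ≢ y → Sat (andQ x y) t (AndSpec x y)) where

    module _ {x y : Fin n} (x∈ : x ∈ pool) (y∈ : y ∈ pool) (x≠y : H → β y ≡ not (β x)) {A : Set}
      (K : E ⊎ Scanned → Tree n q A) (b : ℕ) (ψ : A → Set)
      (onExc : ∀ e → Exc e → Sat (K (inj₁ e)) b ψ) where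

      -- In continuation-passing form, as the cost is charged to the balls leaving todo.
      Sat-scan : ∀ todo s → (∀ {z} → z ∈ todo → z ∈ pool × z ≢ x × z ≢ y) → Known x y s →
        (∀ s′ → Known x y s′ → todo ++ members s ↭ members s′ → Sat (K (inj₂ (exhausted s′))) b ψ) →
        (∀ v todo′ s′ → Known x y s′ → (H → β x ≡ v) → todo ++ members s ↭ todo′ ++ members s′ →
          Sat (K (inj₂ (oriented v todo′ s′))) (unit * length todo′ + b) ψ) →
        Sat (scan x y todo s >>= K) (unit * suc (length todo) + b) ψ
      Sat-scan [] s ok kn onEnd onTurn = Sat-mono (K (inj₂ (exhausted s))) (m≤n+m b (unit * 1)) (onEnd s kn ↭-refl) λ _ r → r
      Sat-scan (z ∷ todo) s@(sorted a₀ b₀ c₀ d₀) ok kn@(known kz ko kx ky) onEnd onTurn with ok (here refl)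
      ... | z∈ , z≢x , z≢y = Sat-mono (scan x y (z ∷ todo) s >>= K) (≤-reflexive time) (Sat-assoc (compare₂ z x)
          (Sat-bind (compare₂ z x) {k = λ v → scanX x y z todo s v >>= K} (Sat-compare₂ βo βi Sat-or Sat-and z∈ x∈ z≢x) stepX)) λ _ r → r
        where
        rest = unit * suc (length todo) + b
        time : (t + t) + ((t + t) + rest) ≡ unit * suc (length (z ∷ todo)) + b
        time = trans (sym (+-assoc (t + t) (t + t) rest)) (trans (sym (+-assoc unit (unit * suc (length todo)) b)) (cong (_+ b) (sym (*-suc unit (suc (length todo))))))
        recurse : ∀ s′ → Known x y s′ → z ∷ todo ++ members s ↭ todo ++ members s′ → Sat (scan x y todo s′ >>= K) rest ψ
        recurse s′ kn′ p = Sat-scan todo s′ (λ w∈ → ok (there w∈)) kn′ (λ s″ kn″ p′ → onEnd s″ kn″ (↭-trans p p′))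
          (λ v todo′ s″ kn″ e p′ → onTurn v todo′ s″ kn″ e (↭-trans p p′))
        insertₙ : ∀ {M} → members s ↭ M → z ∷ todo ++ members s ↭ todo ++ z ∷ M
        insertₙ {M} p = ↭-trans (↭-prep z (PermP.++⁺ˡ todo p)) (↭-sym (shift z todo M))
        toZeros : z ∷ todo ++ members s ↭ todo ++ members (sorted (z ∷ a₀) b₀ c₀ d₀)
        toZeros = insertₙ ↭-refl
        toOnes : z ∷ todo ++ members s ↭ todo ++ members (sorted a₀ (z ∷ b₀) c₀ d₀)
        toOnes = solve 6 (λ z t a b c d → z • (t • (a • (b • (c • d)))) ⊜ t • (a • ((z • b) • (c • d)))) ↭-refl [ z ] todo a₀ b₀ c₀ d₀
        toX : z ∷ todo ++ members s ↭ todo ++ members (sorted a₀ b₀ (z ∷ c₀) d₀)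
        toX = solve 6 (λ z t a b c d → z • (t • (a • (b • (c • d)))) ⊜ t • (a • (b • ((z • c) • d)))) ↭-refl [ z ] todo a₀ b₀ c₀ d₀
        toY : z ∷ todo ++ members s ↭ todo ++ members (sorted a₀ b₀ c₀ (z ∷ d₀))
        toY = solve 6 (λ z t a b c d → z • (t • (a • (b • (c • d)))) ⊜ t • (a • (b • (c • (z • d))))) ↭-refl [ z ] todo a₀ b₀ c₀ d₀
        spare : ∀ {A′ : Set} (p : Tree n q A′) {φ : A′ → Set} → Sat p rest φ → Sat p ((t + t) + rest) φ
        spare p h = Sat-mono p (m≤n+m rest (t + t)) h λ _ r → r
        turn : ∀ v → (H → β x ≡ v) → Sat (K (inj₂ (oriented v (z ∷ todo) s))) rest ψ
        turn v e = onTurn v (z ∷ todo) s kn e ↭-refl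
        stepY : ∀ v → v ≢ ne → Spec z x (inj₂ v) → ∀ w → Spec z y w → Sat (scanY x y z todo s v w >>= K) rest ψ
        stepY v v≢ hx (inj₁ e) hy = Sat-mono (K (inj₁ e)) (m≤n+m b _) (onExc e hy) λ _ r → r
        stepY v v≢ hx (inj₂ ne) hy = recurse _ (known kz ko (with-head (λ h → lemma (x≠y h) (hy h)) kx) ky) toX
          where
          lemma : ∀ {p q r} → q ≡ not p → q ≡ not r → r ≡ p
          lemma {p} {q} {r} e₁ e₂ = trans (sym (not-involutive r)) (trans (cong not (trans (sym e₂) e₁)) (not-involutive p))
        stepY le v≢ hx (inj₂ le) hy = recurse _ (known (with-head (λ h → isFalse h (bool-cases (β z))) kz) ko kx ky) toZeros
          where
          isFalse : H → β z ≡ true ⊎ β z ≡ false → β z ≡ false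
          isFalse h (inj₂ e) = e
          isFalse h (inj₁ e) = case trans (sym (hy h e)) (trans (x≠y h) (cong not (hx h e))) of λ ()
        stepY le v≢ hx (inj₂ ge) hy = turn true λ h → isTrue h (bool-cases (β x))
          where
          isTrue : H → β x ≡ true ⊎ β x ≡ false → β x ≡ true
          isTrue h (inj₁ e) = e
          isTrue h (inj₂ e) = hx h (hy h (trans (x≠y h) (cong not e)))
        stepY ge v≢ hx (inj₂ le) hy = turn false λ h → isFalse h (bool-cases (β x))
          where
          isFalse : H → β x ≡ true ⊎ β x ≡ false → β x ≡ false
          isFalse h (inj₂ e) = e
          isFalse h (inj₁ e) = case trans (sym (hy h (hx h e))) (trans (x≠y h) (cong not e)) of λ ()
        stepY ge v≢ hx (inj₂ ge) hy = recurse _ (known kz (with-head (λ h → isTrue h (bool-cases (β x))) ko) kx ky) toOnes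
          where
          isTrue : H → β x ≡ true ⊎ β x ≡ false → β z ≡ true
          isTrue h (inj₁ e) = hx h e
          isTrue h (inj₂ e) = hy h (trans (x≠y h) (cong not e))
        stepY ne v≢ hx (inj₂ le) hy = ⊥-elim (v≢ refl)
        stepY ne v≢ hx (inj₂ ge) hy = ⊥-elim (v≢ refl)
        second? : ∀ v → v ≢ ne → Spec z x (inj₂ v) → Sat (compare₂ z y >>= scanY x y z todo s v >>= K) ((t + t) + rest) ψ
        second? v v≢ hx = Sat-assoc (compare₂ z y) (Sat-bind (compare₂ z y) {k = λ w → scanY x y z todo s v w >>= K}
          (Sat-compare₂ βo βi Sat-or Sat-and z∈ y∈ z≢y) (stepY v v≢ hx))
        stepX : ∀ v → Spec z x v → Sat (scanX x y z todo s v >>= K) ((t + t) + rest) ψ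
        stepX (inj₁ e) h = spare (K (inj₁ e)) (Sat-mono (K (inj₁ e)) (m≤n+m b _) (onExc e h) λ _ r → r)
        stepX (inj₂ ne) h = spare (scan x y todo (sorted a₀ b₀ c₀ (z ∷ d₀)) >>= K)
          (recurse _ (known kz ko kx (with-head (λ h′ → trans (sym (not-involutive (β z))) (trans (cong not (sym (h h′))) (sym (x≠y h′)))) ky)) toY)
        stepX (inj₂ le) h = second? le (λ ()) h
        stepX (inj₂ ge) h = second? ge (λ ()) h

  uniform : ∀ w {v L} → Colours v L → cnt (λ z → is w (β z)) L ≡ bit (is w v) * length L
  uniform w {v} {L} h with is w v in e
  ... | true = trans (cnt-full _ L (λ z∈ → trans (cong (is w) (h z∈)) e)) (sym (+-identityʳ (length L)))
  ... | false = cnt-none _ L (λ z∈ → trans (cong (is w) (h z∈)) e)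

  conclude-nonMin : ∀ x y a b c d → pool ↭ a ++ b ++ c ++ d → x ∈ c → y ∈ d → H →
    Colours false a → Colours true b → Colours (β x) c → Colours (not (β x)) d → NonMin β pool (conclude x y (sorted a b c d))
  conclude-nonMin x y a b c d p x∈ y∈ h ha hb hc hd = choose
    where
    A = length a
    B = length b
    X = length c
    Y = length d
    K : Bool → ℕ
    K w = cnt (λ z → is w (β z)) pool
    total : length pool ≡ A + (B + (X + Y))
    total = trans (↭-length p) (trans (length-++ a) (cong (A +_) (trans (length-++ b) (cong (B +_) (length-++ c)))))
    counts : ∀ w v → β x ≡ v → K w ≡ bit (is w false) * A + (bit (is w true) * B + (bit (is w v) * X + bit (is w (not v)) * Y))
    counts w v refl = trans (cnt-↭ _ p) (trans (cnt-++ _ a _) (cong₂ _+_ (uniform w ha) (trans (cnt-++ _ b _) (cong₂ _+_ (uniform w hb)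
      (trans (cnt-++ _ c _) (cong₂ _+_ (uniform w hc) (uniform w hd)))))))
    ρ : ℕ → List ℕ
    ρ k = A ∷ B ∷ X ∷ Y ∷ length pool ∷ k ∷ []
    sumRel : Rel
    sumRel = x₄ ≈ x₀ ⊕ (x₁ ⊕ (x₂ ⊕ x₃))
    countRel : Bool → Bool → Rel
    countRel w v = x₅ ≈ bit (is w false) ⊛ x₀ ⊕ (bit (is w true) ⊛ x₁ ⊕ (bit (is w v) ⊛ x₂ ⊕ bit (is w (not v)) ⊛ x₃))
    in-a : ∀ {z} → z ∈ a → z ∈ pool
    in-a z∈ = ∈-resp-↭ (↭-sym p) (∈-++⁺ˡ z∈)
    in-b : ∀ {z} → z ∈ b → z ∈ pool
    in-b z∈ = ∈-resp-↭ (↭-sym p) (∈-++⁺ʳ a (∈-++⁺ˡ z∈))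
    in-c : ∀ {z} → z ∈ c → z ∈ pool
    in-c z∈ = ∈-resp-↭ (↭-sym p) (∈-++⁺ʳ a (∈-++⁺ʳ b (∈-++⁺ˡ z∈)))
    in-d : ∀ {z} → z ∈ d → z ∈ pool
    in-d z∈ = ∈-resp-↭ (↭-sym p) (∈-++⁺ʳ a (∈-++⁺ʳ b (∈-++⁺ʳ c z∈)))
    by : ∀ z w → z ∈ pool → β z ≡ w → length pool ≤ 2 * K w → NonMin β pool z
    by z w z∈ refl h′ = z∈ , h′
    βy : β y ≡ not (β x)
    βy = hd y∈
    zerosWin : X + B ≤ Y + A → Y + B ≤ X + A → length pool ≤ 2 * K false
    zerosWin e₁ e₂ with bool-cases (β x)
    ... | inj₁ v = lia (ρ (K false)) (sumRel ∷ countRel false true ∷ (x₂ ⊕ x₁ ≼ x₃ ⊕ x₀) ∷ []) (x₄ ≼ 2 ⊛ x₅) total (counts false true v) e₁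
    ... | inj₂ v = lia (ρ (K false)) (sumRel ∷ countRel false false ∷ (x₃ ⊕ x₁ ≼ x₂ ⊕ x₀) ∷ []) (x₄ ≼ 2 ⊛ x₅) total (counts false false v) e₂
    onesWin : X + A ≤ Y + B → Y + A ≤ X + B → length pool ≤ 2 * K true
    onesWin e₁ e₂ with bool-cases (β x)
    ... | inj₁ v = lia (ρ (K true)) (sumRel ∷ countRel true true ∷ (x₃ ⊕ x₀ ≼ x₂ ⊕ x₁) ∷ []) (x₄ ≼ 2 ⊛ x₅) total (counts true true v) e₂
    ... | inj₂ v = lia (ρ (K true)) (sumRel ∷ countRel true false ∷ (x₂ ⊕ x₀ ≼ x₃ ⊕ x₁) ∷ []) (x₄ ≼ 2 ⊛ x₅) total (counts true false v) e₁
    xWins : Y + A ≤ X + B → Y + B ≤ X + A → length pool ≤ 2 * K (β x)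
    xWins e₁ e₂ with bool-cases (β x)
    ... | inj₁ v = subst (λ w → length pool ≤ 2 * K w) (sym v) (lia (ρ (K true)) (sumRel ∷ countRel true true ∷ (x₃ ⊕ x₀ ≼ x₂ ⊕ x₁) ∷ []) (x₄ ≼ 2 ⊛ x₅) total (counts true true v) e₁)
    ... | inj₂ v = subst (λ w → length pool ≤ 2 * K w) (sym v) (lia (ρ (K false)) (sumRel ∷ countRel false false ∷ (x₃ ⊕ x₁ ≼ x₂ ⊕ x₀) ∷ []) (x₄ ≼ 2 ⊛ x₅) total (counts false false v) e₂)
    yWins : X + A ≤ Y + B → X + B ≤ Y + A → length pool ≤ 2 * K (not (β x))
    yWins e₁ e₂ with bool-cases (β x)
    ... | inj₁ v = subst (λ w → length pool ≤ 2 * K (not w)) (sym v) (lia (ρ (K false)) (sumRel ∷ countRel false true ∷ (x₂ ⊕ x₁ ≼ x₃ ⊕ x₀) ∷ []) (x₄ ≼ 2 ⊛ x₅) total (counts false true v) e₂)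
    ... | inj₂ v = subst (λ w → length pool ≤ 2 * K (not w)) (sym v) (lia (ρ (K true)) (sumRel ∷ countRel true false ∷ (x₂ ⊕ x₀ ≼ x₃ ⊕ x₁) ∷ []) (x₄ ≼ 2 ⊛ x₅) total (counts true false v) e₁)
    zerosCase : ∀ a′ → a′ ≡ a → X + B ≤ Y + A → Y + B ≤ X + A → NonMin β pool (headOr x a′)
    zerosCase (z ∷ _) refl e₁ e₂ = by z false (in-a (here refl)) (ha (here refl)) (zerosWin e₁ e₂)
    zerosCase [] refl e₁ e₂ = by x (β x) (in-c x∈) refl (xWins
      (lia (0 ∷ B ∷ X ∷ Y ∷ []) ((x₂ ⊕ x₁ ≼ x₃ ⊕ x₀) ∷ (x₃ ⊕ x₁ ≼ x₂ ⊕ x₀) ∷ (x₀ ≈ con 0) ∷ []) (x₃ ⊕ x₀ ≼ x₂ ⊕ x₁) e₁ e₂ refl) e₂)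
    onesCase : ∀ b′ → b′ ≡ b → X + A ≤ Y + B → Y + A ≤ X + B → NonMin β pool (headOr x b′)
    onesCase (z ∷ _) refl e₁ e₂ = by z true (in-b (here refl)) (hb (here refl)) (onesWin e₁ e₂)
    onesCase [] refl e₁ e₂ = by x (β x) (in-c x∈) refl (xWins e₂
      (lia (0 ∷ A ∷ X ∷ Y ∷ []) ((x₂ ⊕ x₁ ≼ x₃ ⊕ x₀) ∷ (x₃ ⊕ x₁ ≼ x₂ ⊕ x₀) ∷ (x₀ ≈ con 0) ∷ []) (x₃ ⊕ x₀ ≼ x₂ ⊕ x₁) e₁ e₂ refl))
    choose : NonMin β pool (conclude x y (sorted a b c d))
    choose with X + B ≤? Y + A | Y + B ≤? X + A | X + A ≤? Y + B | Y + A ≤? X + B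
    ... | yes e₁ | yes e₂ | _ | _ = zerosCase a refl e₁ e₂
    ... | yes _ | no _ | yes e₃ | yes e₄ = onesCase b refl e₃ e₄
    ... | no _ | yes _ | yes e₃ | yes e₄ = onesCase b refl e₃ e₄
    ... | no _ | no _ | yes e₃ | yes e₄ = onesCase b refl e₃ e₄
    ... | no _ | yes e₂ | no _ | yes e₄ = by x (β x) (in-c x∈) refl (xWins e₄ e₂)
    ... | yes e₁ | no _ | yes e₃ | no _ = by y (not (β x)) (in-d y∈) βy (yWins e₃ e₁)
    ... | yes _ | no n₂ | no n₃ | _ = ⊥-elim (n₃ (<⇒≤ (≰⇒> n₂)))
    ... | no _ | no n₂ | no n₃ | _ = ⊥-elim (n₃ (<⇒≤ (≰⇒> n₂)))
    ... | no n₁ | _ | _ | no n₄ = ⊥-elim (n₄ (<⇒≤ (≰⇒> n₁)))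

module Running {c : ℕ} (rule : Rule c) {n q : ℕ} (χ : Coloring n c) (H : Set) (β : Fin n → Bool)
  {E : Set} (o i : Fin n) (orQ andQ : Fin n → Fin n → Tree n q (E ⊎ Fin n))
  (pool : List (Fin n)) (upool : Unique pool) (Exc : E → Set) (t : ℕ) where
  open Rule rule
  open Runs rule {n} {q} χ
  open Comparing {n} {q} {E} o i orQ andQ
  open Interpreting rule {n} {q} χ H β o i orQ andQ pool upool Exc t
  open Amortised rule {n} {q} χ H β o i orQ andQ pool upool Exc t
  open import Algebra.Solver.CommutativeMonoid (PermP.++-commutativeMonoid {A = Fin n}) using (solve; _⊜_) renaming (_⊕_ to _•_)

  _⊑ₚ_ : Ball {pool} → Ball {pool} → Set
  u ⊑ₚ v = proj₁ u ⊑ proj₁ v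

  ⊑ₚ-trans : ∀ {u v w} → u ⊑ₚ v → v ⊑ₚ w → u ⊑ₚ w
  ⊑ₚ-trans f g h e = g h (f h e)

  open Selection _⊑ₚ_ (λ {u} {v} {w} → ⊑ₚ-trans {u} {v} {w})

  Ready : State → Set
  Ready (state U Z O) = pool ↭ U ++ Z ++ O × (H → Colours false Z) × (H → Colours true O)

  Ended : ∀ {A : Set} → (A → Set) → E ⊎ (Fin n ⊎ A) → Set
  Ended φ (inj₁ e) = Exc e
  Ended φ (inj₂ (inj₁ p)) = H → NonMin β pool p
  Ended φ (inj₂ (inj₂ a)) = φ a

  ∨-cases : ∀ {a b} → a ∨ b ≡ true → a ≡ true ⊎ b ≡ true
  ∨-cases {true} _ = inj₁ refl
  ∨-cases {false} e = inj₂ e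

  ∨-false : ∀ {a b} → a ∨ b ≡ false → a ≡ false × b ≡ false
  ∨-false {false} {false} _ = refl , refl

  known-zero : ∀ {L z} → (H → Colours false L) → mem L z ≡ true → H → β z ≡ false
  known-zero {L} {z} k e h = k h (mem⁻ L {z} e)

  known-one : ∀ {L z} → (H → Colours true L) → mem L z ≡ true → H → β z ≡ true
  known-one {L} {z} k e h = k h (mem⁻ L {z} e)

  zero-⊑ : ∀ {x y} → (H → β x ≡ false) → x ⊑ y
  zero-⊑ f h e = case trans (sym (f h)) e of λ ()

  ⊑-one : ∀ {x y} → (H → β y ≡ true) → x ⊑ y
  ⊑-one f h _ = f h

  _++ᶜ_ : ∀ {v L M} → (H → Colours v L) → (H → Colours v M) → H → Colours v (L ++ M)
  _++ᶜ_ {L = L} f g h z∈ with ∈-++⁻ L z∈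
  ... | inj₁ a = f h a
  ... | inj₂ b = g h b

  module _ (βo : H → β o ≡ false) (βi : H → β i ≡ true)
    (Sat-or : ∀ {x y} → x ∈ pool → y ∈ pool → x ≢ y → Sat (orQ x y) t (OrSpec x y))
    (Sat-and : ∀ {x y} → x ∈ pool → y ∈ pool → x ≢ y → Sat (andQ x y) t (AndSpec x y)) where

    -- The potential is one `unit` for each open ball and each comparison still to come. A scan is
    -- paid by the balls whose colours become known. The ball that orients the pair stays open, but
    -- `x` and `y` themselves leave and pay for it.
    Sat-interpret : ∀ {A : Set} (p : Compare Ball A) d {φ : A → Set} st → SatC p d φ → Ready st →
      Sat (interpret p st) (unit * (length (State.open′ st) + d)) (Ended φ)
    Sat-interpret (ret a) d st s r = s
    Sat-interpret (cmp (x , x∈) (y , y∈) k) (suc d) {φ} st@(state U Z O) (s₁ , s₂) ready@(pU , kz , ko)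
      with does (x ≟ y) ∨ (mem Z x ∨ mem O y) in e₁
    ... | true = Sat-mono (interpret (k true) st) (*-monoʳ-≤ unit (+-monoʳ-≤ (length U) (n≤1+n d)))
          (Sat-interpret (k true) d st (s₁ (because (∨-cases e₁))) ready) λ _ r → r
      where
      because : does (x ≟ y) ≡ true ⊎ mem Z x ∨ mem O y ≡ true → x ⊑ y
      because (inj₁ e) with x ≟ y
      ... | yes refl = λ _ e → e
      because (inj₂ e) with ∨-cases e
      ... | inj₁ m = zero-⊑ {y = y} (known-zero {Z} {x} kz m)
      ... | inj₂ m = ⊑-one {x} (known-one {O} {y} ko m)
    ... | false with mem O x ∨ mem Z y in e₂
    ...   | true = Sat-mono (interpret (k false) st) (*-monoʳ-≤ unit (+-monoʳ-≤ (length U) (n≤1+n d)))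
            (Sat-interpret (k false) d st (s₂ (because (∨-cases e₂))) ready) λ _ r → r
      where
      because : mem O x ≡ true ⊎ mem Z y ≡ true → y ⊑ x
      because (inj₁ m) = ⊑-one {y} (known-one {O} {x} ko m)
      because (inj₂ m) = zero-⊑ {y = x} (known-zero {Z} {y} kz m)
    ...   | false = Sat-mono (compare₂ x y >>= afterCompare x y k st) time
            (Sat-bind (compare₂ x y) {k = afterCompare x y k st} (Sat-compare₂ βo βi Sat-or Sat-and x∈ y∈ x≢y) next) λ _ r → r
      where
      x≢y : x ≢ y
      x≢y e = case trans (sym (dec-true (x ≟ y) e)) (proj₁ (∨-false e₁)) of λ ()
      u = length U
      time : (t + t) + (unit * (u + d) + (t + t)) ≤ unit * (u + suc d)
      time = ≤-reflexive (trans (+-comm (t + t) _) (trans (+-assoc (unit * (u + d)) (t + t) (t + t))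
        (trans (+-comm (unit * (u + d)) unit) (trans (sym (*-suc unit (u + d))) (cong (unit *_) (sym (+-suc u d)))))))
      in-U : ∀ {z} → z ∈ pool → z ∉ Z → z ∉ O → z ∈ U
      in-U z∈ ∉Z ∉O with ∈-++⁻ U (∈-resp-↭ pU z∈)
      ... | inj₁ z∈U = z∈U
      ... | inj₂ z∈r with ∈-++⁻ Z z∈r
      ...   | inj₁ z∈Z = ⊥-elim (∉Z z∈Z)
      ...   | inj₂ z∈O = ⊥-elim (∉O z∈O)
      x∈U : x ∈ U
      x∈U = in-U x∈ (mem-false Z (proj₁ (∨-false {mem Z x} {mem O y} (proj₂ (∨-false {does (x ≟ y)} {mem Z x ∨ mem O y} e₁))))) (mem-false O (proj₁ (∨-false {mem O x} {mem Z y} e₂)))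
      y∈U : y ∈ U
      y∈U = in-U y∈ (mem-false Z (proj₂ (∨-false {mem O x} {mem Z y} e₂))) (mem-false O (proj₂ (∨-false {mem Z x} {mem O y} (proj₂ (∨-false {does (x ≟ y)} {mem Z x ∨ mem O y} e₁)))))
      todo = remove y (remove x U)
      px = remove-↭ x∈U
      y∈′ : y ∈ x ∷ remove x U → y ∈ remove x U
      y∈′ (here e) = ⊥-elim (x≢y (sym e))
      y∈′ (there m) = m
      split : U ↭ x ∷ y ∷ todo
      split = ↭-trans px (↭-prep x (remove-↭ (y∈′ (∈-resp-↭ px y∈U))))
      uU : Unique (x ∷ y ∷ todo)
      uU = Unique-↭ split (Unique-++⁻ˡ U (Unique-↭ pU upool))
      ok : ∀ {z} → z ∈ todo → z ∈ pool × z ≢ x × z ≢ y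
      ok z∈ = ∈-resp-↭ (↭-sym pU) (∈-++⁺ˡ (∈-resp-↭ (↭-sym split) (there (there z∈))))
            , (λ { refl → Unique-∉ uU (there z∈) })
            , (λ { refl → Unique-∉ (Unique-++⁻ʳ [ x ] uU) z∈ })
      more : ∀ {A′ : Set} (p : Tree n q A′) {φ : A′ → Set} → Sat p (unit * (u + d)) φ → Sat p (unit * (u + d) + (t + t)) φ
      more p h = Sat-mono p (m≤m+n _ (t + t)) h λ _ r → r
      K = afterScan x y k st
      differ : (H → β y ≡ not (β x)) → Sat (scan x y todo (sorted [] [] [] []) >>= K) (unit * (u + d) + (t + t)) (Ended φ)
      differ opp = Sat-mono (scan x y todo (sorted [] [] [] []) >>= K) room
        (Sat-scan βo βi Sat-or Sat-and x∈ y∈ opp K (unit * d) (Ended φ) (λ _ h → h) todo (sorted [] [] [] []) ok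
          (known (λ _ ()) (λ _ ()) (λ _ ()) (λ _ ())) onEnd onTurn) λ _ r → r
        where
        room : unit * suc (length todo) + unit * d ≤ unit * (u + d) + (t + t)
        room = ≤-trans (≤-reflexive (sym (*-distribˡ-+ unit (suc (length todo)) d)))
          (≤-trans (*-monoʳ-≤ unit (+-monoˡ-≤ d (≤-trans (n≤1+n _) (≤-reflexive (sym (↭-length split)))))) (m≤m+n _ (t + t)))
        whole′ : ∀ {M} → todo ++ [] ↭ M → pool ↭ (x ∷ y ∷ M) ++ Z ++ O
        whole′ p = ↭-trans pU (PermP.++⁺ʳ (Z ++ O) (↭-trans split (↭-prep x (↭-prep y (↭-trans (↭-reflexive (sym (++-identityʳ todo))) p)))))
        onEnd : ∀ s′ → Known x y s′ → todo ++ [] ↭ members s′ → Sat (K (inj₂ (exhausted s′))) (unit * d) (Ended φ)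
        onEnd (sorted a b c′ d′) (known ka kb kc kd) p h = conclude-nonMin x y (a ++ Z) (b ++ O) (x ∷ c′) (y ∷ d′)
          (↭-trans (whole′ p) (solve 8 (λ x y a b c d z o → (x • (y • (a • (b • (c • d))))) • (z • o) ⊜ (a • z) • ((b • o) • ((x • c) • (y • d)))) ↭-refl [ x ] [ y ] a b c′ d′ Z O))
          (here refl) (here refl) h (_++ᶜ_ {L = a} ka kz h) (_++ᶜ_ {L = b} kb ko h) (with-head (λ _ → refl) kc h)
          (λ { (here refl) → opp h ; (there z∈) → trans (kd h z∈) (opp h) })
        onTurn : ∀ v todo′ s′ → Known x y s′ → (H → β x ≡ v) → todo ++ [] ↭ todo′ ++ members s′ →
          Sat (K (inj₂ (oriented v todo′ s′))) (unit * length todo′ + unit * d) (Ended φ)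
        onTurn true todo′ s′@(sorted a b c′ d′) (known ka kb kc kd) e p =
          Sat-mono (interpret (k false) (update true x y todo′ s′ st)) (≤-reflexive (*-distribˡ-+ unit (length todo′) d))
            (Sat-interpret (k false) d _ (s₂ (⊑-one {y} e))
              ( ↭-trans (whole′ p) (solve 9 (λ x y t a b c d z o → (x • (y • (t • (a • (b • (c • d)))))) • (z • o) ⊜ t • ((a • ((y • d) • z)) • (b • ((x • c) • o)))) ↭-refl [ x ] [ y ] todo′ a b c′ d′ Z O)
              , (_++ᶜ_ {L = a} ka (_++ᶜ_ {L = y ∷ d′} (with-head yfalse λ h z∈ → trans (kd h z∈) (yfalse h)) kz))
              , (_++ᶜ_ {L = b} kb (_++ᶜ_ {L = x ∷ c′} (with-head e λ h z∈ → trans (kc h z∈) (e h)) ko)))) λ _ r → r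
          where
          yfalse : H → β y ≡ false
          yfalse h = trans (opp h) (cong not (e h))
        onTurn false todo′ s′@(sorted a b c′ d′) (known ka kb kc kd) e p =
          Sat-mono (interpret (k true) (update false x y todo′ s′ st)) (≤-reflexive (*-distribˡ-+ unit (length todo′) d))
            (Sat-interpret (k true) d _ (s₁ (zero-⊑ {y = y} e))
              ( ↭-trans (whole′ p) (solve 9 (λ x y t a b c d z o → (x • (y • (t • (a • (b • (c • d)))))) • (z • o) ⊜ t • ((a • ((x • c) • z)) • (b • ((y • d) • o)))) ↭-refl [ x ] [ y ] todo′ a b c′ d′ Z O)
              , (_++ᶜ_ {L = a} ka (_++ᶜ_ {L = x ∷ c′} (with-head e λ h z∈ → trans (kc h z∈) (e h)) kz))
              , (_++ᶜ_ {L = b} kb (_++ᶜ_ {L = y ∷ d′} (with-head ytrue λ h z∈ → trans (kd h z∈) (ytrue h)) ko)))) λ _ r → r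
          where
          ytrue : H → β y ≡ true
          ytrue h = trans (opp h) (cong not (e h))
      next : ∀ v → Spec x y v → Sat (afterCompare x y k st v) (unit * (u + d) + (t + t)) (Ended φ)
      next (inj₁ e) h = h
      next (inj₂ le) h = more (interpret (k true) st) (Sat-interpret (k true) d st (s₁ h) ready)
      next (inj₂ ge) h = more (interpret (k false) st) (Sat-interpret (k false) d st (s₂ h) ready)
      next (inj₂ ne) h = differ h

-- Majorities of three balls with the help of pairs

chunks : ∀ {A : Set} → ℕ → ℕ → List A → List (List A)
chunks j zero ps = []
chunks j (suc k) ps = take j ps ∷ chunks j k (drop j ps)

length-chunks : ∀ {A : Set} j k (ps : List A) → length (chunks j k ps) ≡ k
length-chunks j zero ps = refl
length-chunks j (suc k) ps = cong suc (length-chunks j k (drop j ps))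

drop-⊆ : ∀ {A : Set} k {xs : List A} {x} → x ∈ drop k xs → x ∈ xs
drop-⊆ zero x∈ = x∈
drop-⊆ (suc k) {_ ∷ xs} x∈ = there (drop-⊆ k x∈)

chunks-⊆ : ∀ {A : Set} j k {ps : List A} {G p} → G ∈ chunks j k ps → p ∈ G → p ∈ ps
chunks-⊆ j (suc k) (here refl) p∈ = take-⊆ j p∈
chunks-⊆ j (suc k) (there G∈) p∈ = drop-⊆ j (chunks-⊆ j k G∈ p∈)

chunks-length : ∀ {A : Set} j k {ps : List A} → k * j ≤ length ps → ∀ {G} → G ∈ chunks j k ps → length G ≡ j
chunks-length j (suc k) {ps} h (here refl) = length-take≤ j ps (≤-trans (m≤m+n j _) h)
chunks-length j (suc k) {ps} h (there G∈) = chunks-length j k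
  (≤-trans (≤-trans (≤-reflexive (sym (m+n∸m≡n j (k * j)))) (∸-monoˡ-≤ j h)) (≤-reflexive (sym (length-drop j ps)))) G∈

flat-++ : ∀ {A : Set} (ps qs : List (A × A)) → flat (ps ++ qs) ≡ flat ps ++ flat qs
flat-++ [] qs = refl
flat-++ ((a , b) ∷ ps) qs = cong (λ l → a ∷ b ∷ l) (flat-++ ps qs)

flat-chunks : ∀ {A : Set} j k (ps : List (A × A)) → ∃[ rs ] flat ps ≡ concatMap flat (chunks j k ps) ++ rs
flat-chunks j zero ps = flat ps , refl
flat-chunks j (suc k) ps with flat-chunks j k (drop j ps)
... | rs , e = rs , trans (cong flat (sym (take++drop≡id j ps))) (trans (flat-++ (take j ps) (drop j ps))
  (trans (cong (flat (take j ps) ++_) e) (sym (++-assoc (flat (take j ps)) _ rs))))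

length-flat : ∀ {A : Set} (ps : List (A × A)) → length (flat ps) ≡ length ps + length ps
length-flat [] = refl
length-flat (_ ∷ ps) = cong suc (trans (cong suc (length-flat ps)) (sym (+-suc (length ps) (length ps))))

partner : ∀ {n} → Fin n → List (Fin n × Fin n) → Fin n
partner r [] = r
partner r ((a , b) ∷ G) = if does (r ≟ a) then b else if does (r ≟ b) then a else partner r G

-- The majority colour of x, y, z, asked with the help of groups of pairs of balls of
-- different colours. If each time the reply is not among x, y, z, these replies
-- have the same colour.
ask₃ : ∀ {n q} → Fin n → Fin n → Fin n → Fin n → List (List (Fin n × Fin n)) → Tree n q (List (Fin n × Fin n) ⊎ Fin n)
keep₃ : ∀ {n q} → Fin n → Fin n → Fin n → Fin n → List (Fin n × Fin n) → List (List (Fin n × Fin n)) → Fin n → Tree n q (List (Fin n × Fin n) ⊎ Fin n)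

extend₃ : ∀ {n q} → Fin n → List (Fin n × Fin n) → List (Fin n × Fin n) ⊎ Fin n → Tree n q (List (Fin n × Fin n) ⊎ Fin n)

extend₃ r G (inj₁ ps) = ret (inj₁ ((r , partner r G) ∷ ps))
extend₃ r G (inj₂ r′) = ret (inj₂ r′)

ask₃ z₀ x y z [] = ret (inj₁ [])
ask₃ z₀ x y z (G ∷ Gs) = majority z₀ (x ∷ y ∷ z ∷ flat G) >>= keep₃ z₀ x y z G Gs

keep₃ z₀ x y z G Gs r = if mem (x ∷ y ∷ z ∷ []) r then ret (inj₂ r) else (ask₃ z₀ x y z Gs >>= extend₃ r G)

-- Once the pairs have a common orientation, a reply inside one of them has the colour of `o` if it
-- is a first component and that of `i` otherwise, so it can be renamed and no exception is left.
name₃ : ∀ {n} → Fin n → Fin n → List (Fin n × Fin n) → Fin n → Fin n → Fin n → Fin n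
name₃ o i ps x y r = if mem (x ∷ y ∷ []) r then r else if mem (o ∷ map proj₁ ps) r then o else i

askKnown : ∀ {n q} → Fin n → Fin n → Fin n → List (Fin n × Fin n) → Fin n → Fin n → Fin n → Tree n q (List (Fin n × Fin n) ⊎ Fin n)
askKnown z₀ o i ps z x y = majority z₀ (x ∷ y ∷ z ∷ flat ps) >>= λ r → ret (inj₂ (name₃ o i ps x y r))

attach : ∀ {n} {pool : List (Fin n)} L → (∀ {x} → x ∈ L → x ∈ pool) → List (∃[ x ] x ∈ pool)
attach [] _ = []
attach (x ∷ xs) s = (x , s (here refl)) ∷ attach xs (s ∘ there)

map-attach : ∀ {n} {pool : List (Fin n)} L (s : ∀ {x} → x ∈ L → x ∈ pool) → map proj₁ (attach L s) ≡ L
map-attach [] s = refl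
map-attach (x ∷ xs) s = cong (x ∷_) (map-attach xs (s ∘ there))

maj : Bool → Bool → Bool → Bool
maj x y z = (x ∧ y) ∨ ((x ∧ z) ∨ (y ∧ z))

maj-two : ∀ m x y z → 2 ≤ bit (is m x) + (bit (is m y) + (bit (is m z) + 0)) → m ≡ maj x y z
maj-two true true true z _ = refl
maj-two true true false true _ = refl
maj-two true true false false (s≤s ())
maj-two true false true true _ = refl
maj-two true false true false (s≤s ())
maj-two true false false true (s≤s ())
maj-two true false false false ()
maj-two false true true true ()
maj-two false true true false (s≤s ())
maj-two false true false true (s≤s ())
maj-two false true false false _ = refl
maj-two false false true true (s≤s ())
maj-two false false true false _ = refl
maj-two false false false z _ = refl

-- Relative to `o`, the ball `o` is false and `i` is true whatever their actual colours are. A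
-- majority with `i` is then a disjunction, and one with `o` a conjunction.
rel : Bool → Bool → Bool
rel o z = not (is o z)

rel-or : ∀ o x y → rel o (maj x y (not o)) ≡ rel o x ∨ rel o y
rel-or true true true = refl
rel-or true true false = refl
rel-or true false true = refl
rel-or true false false = refl
rel-or false true true = refl
rel-or false true false = refl
rel-or false false true = refl
rel-or false false false = refl

rel-and : ∀ o x y → rel o (maj x y o) ≡ rel o x ∧ rel o y
rel-and true true true = refl
rel-and true true false = refl
rel-and true false true = refl
rel-and true false false = refl
rel-and false true true = refl
rel-and false true false = refl
rel-and false false true = refl
rel-and false false false = refl

is-rel : ∀ o a b → is (rel o a) (rel o b) ≡ is a b
is-rel true true b = not-involutive b
is-rel true false true = refl
is-rel true false false = refl
is-rel false true true = refl
is-rel false true false = refl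
is-rel false false true = refl
is-rel false false false = refl

module Oracles {c : ℕ} (rule : Rule c) {n q : ℕ} (χ : Coloring n c) (z₀ : Fin n) (H : Set) (β : Fin n → Bool)
  {d : ℕ} (d≥1 : 1 ≤ d) (q≡ : q ≡ suc (d + d))
  (forced : H → ∀ {L a} → Runs.Legal rule {n} {q} χ L → Runs.Answer rule {n} {q} χ L a →
    ∃[ m ] a ≡ just (just m) × m ∈ L × length L < 2 * cnt (λ z → is (β m) (β z)) L) where
  open Rule rule
  open Runs rule {n} {q} χ
  open Binary rule χ z₀ H β d≥1 q≡ (λ h {L} {a} → forced h {L} {a})

  Differ : List (Fin n × Fin n) → Set
  Differ ps = ∀ {a b} → (a , b) ∈ ps → β b ≡ not (β a)

  K-flat : ∀ w ps → Differ ps → K w (flat ps) ≡ length ps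
  K-flat w [] _ = refl
  K-flat w ((a , b) ∷ ps) df = trans (sym (+-assoc (bit (is w (β a))) _ _))
    (cong₂ _+_ (subst (λ v → bit (is w (β a)) + bit (is w v) ≡ 1) (sym (df (here refl))) (one w (β a))) (K-flat w ps (df ∘ there)))
    where
    one : ∀ w a → bit (is w a) + bit (is w (not a)) ≡ 1
    one true true = refl
    one true false = refl
    one false true = refl
    one false false = refl

  -- Each pair has one ball of either colour, so the pairs cancel.
  majority-of-three : ∀ {x y z ps r} → Differ ps → IsMajority (x ∷ y ∷ z ∷ flat ps) r → β r ≡ maj (β x) (β y) (β z)
  majority-of-three {x} {y} {z} {ps} {r} df (_ , m) = maj-two (β r) (β x) (β y) (β z)
    (lia (bit (is (β r) (β x)) ∷ bit (is (β r) (β y)) ∷ bit (is (β r) (β z)) ∷ K (β r) (flat ps) ∷ length ps ∷ length (flat ps) ∷ [])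
      ((con 3 ⊕ x₅ ≺ 2 ⊛ (x₀ ⊕ (x₁ ⊕ (x₂ ⊕ x₃)))) ∷ (x₃ ≈ x₄) ∷ (x₅ ≈ x₄ ⊕ x₄) ∷ []) (con 2 ≼ x₀ ⊕ (x₁ ⊕ (x₂ ⊕ con 0)))
      m (K-flat (β r) ps df) (length-flat ps))

  partner-spec : ∀ {r} G → r ∈ flat G → Differ G → partner r G ∈ flat G × β (partner r G) ≡ not (β r)
  partner-spec {r} ((a , b) ∷ G) r∈ df with r ≟ a
  ... | yes refl = there (here refl) , df (here refl)
  ... | no n₁ with r ≟ b
  ...   | yes refl = here refl , trans (sym (not-involutive (β a))) (cong not (sym (df (here refl))))
  ...   | no n₂ with r∈
  ...     | here e = ⊥-elim (n₁ e)
  ...     | there (here e) = ⊥-elim (n₂ e)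
  ...     | there (there r∈′) = let p , e = partner-spec G r∈′ (df ∘ there) in there (there p) , e

  Same : Bool → List (Fin n × Fin n) → Set
  Same v ps = ∀ {a b} → (a , b) ∈ ps → β a ≡ v × β b ≡ not v

  three : ∀ {ps : List (Fin n × Fin n)} → length ps ≡ pred d → ∀ {x y z : Fin n} → length (x ∷ y ∷ z ∷ flat ps) ≡ q
  three {ps} e = trans (cong (3 +_) (length-flat ps)) (trans (cong (λ m → 3 + (m + m)) e) (trans (lemma d≥1) (sym q≡)))
    where
    lemma : ∀ {d} → 1 ≤ d → 3 + (pred d + pred d) ≡ suc (d + d)
    lemma {suc d} _ = cong (2 +_) (sym (+-suc d d))

  module _ (P : Set) (PH : P → H) where

    GroupsOK : List (List (Fin n × Fin n)) → Set
    GroupsOK Gs = ∀ {G} → G ∈ Gs → length G ≡ pred d × Differ G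

    AskSpec : Fin n → Fin n → Fin n → List (List (Fin n × Fin n)) → List (Fin n × Fin n) ⊎ Fin n → Set
    AskSpec x y z Gs (inj₁ ps) = length ps ≡ length Gs × (P → Same (maj (β x) (β y) (β z)) ps × Unique (flat ps) ×
      (∀ {w} → w ∈ flat ps → w ∈ concatMap flat Gs))
    AskSpec x y z Gs (inj₂ r) = P → r ∈ x ∷ y ∷ z ∷ [] × β r ≡ maj (β x) (β y) (β z)

    Sat-ask₃ : ∀ x y z Gs → (P → GroupsOK Gs × Unique (x ∷ y ∷ z ∷ concatMap flat Gs)) →
      Sat (ask₃ z₀ x y z Gs) (length Gs) (AskSpec x y z Gs)
    Sat-ask₃ x y z [] ok = refl , λ _ → (λ ()) , [] , (λ ())
    Sat-ask₃ x y z (G ∷ Gs) ok = Sat-bind (majority z₀ (x ∷ y ∷ z ∷ flat G)) {k = keep₃ z₀ x y z G Gs} (Sat-majority (x ∷ y ∷ z ∷ flat G)) next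
      where
      legal : P → Legal (x ∷ y ∷ z ∷ flat G)
      legal p with ok p
      ... | g , u = Unique-++⁻ˡ (x ∷ y ∷ z ∷ flat G) u , three {G} (proj₁ (g (here refl))) {x} {y} {z}
      ok′ : P → GroupsOK Gs × Unique (x ∷ y ∷ z ∷ concatMap flat Gs)
      ok′ p with ok p
      ... | g , u = (λ G∈ → g (there G∈)) , Unique-++⁻ʳ (flat G) (Unique-↭ (shifts (x ∷ y ∷ z ∷ []) (flat G)) u)
      next : ∀ r → (Legal (x ∷ y ∷ z ∷ flat G) → H → IsMajority (x ∷ y ∷ z ∷ flat G) r) →
        Sat (keep₃ z₀ x y z G Gs r) (length Gs) (AskSpec x y z (G ∷ Gs))
      next r hr = verdict (mem (x ∷ y ∷ z ∷ []) r) refl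
        where
        extend : r ∉ x ∷ y ∷ z ∷ [] → P → ∀ ps → Same (maj (β x) (β y) (β z)) ps × Unique (flat ps) × (∀ {w} → w ∈ flat ps → w ∈ concatMap flat Gs) →
          Same (maj (β x) (β y) (β z)) ((r , partner r G) ∷ ps) × Unique (flat ((r , partner r G) ∷ ps)) ×
          (∀ {w} → w ∈ flat ((r , partner r G) ∷ ps) → w ∈ concatMap flat (G ∷ Gs))
        extend r∉ p ps (same , u , sub) =
          (λ { (here refl) → colour , trans (proj₂ pt) (cong not colour) ; (there ab∈) → same ab∈ })
          , (All.tabulate (λ { (here refl) e → loop e ; (there w∈) refl → apart r∈G w∈ }))
            ∷ (All.tabulate (λ { w∈ refl → apart (proj₁ pt) w∈ })) ∷ u
          , λ { (here refl) → ∈-++⁺ˡ r∈G ; (there (here refl)) → ∈-++⁺ˡ (proj₁ pt) ; (there (there w∈)) → ∈-++⁺ʳ (flat G) (sub w∈) }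
          where
          df = proj₂ (proj₁ (ok p) (here refl))
          mr = hr (legal p) (PH p)
          colour = majority-of-three {ps = G} df mr
          r∈G : r ∈ flat G
          r∈G with ∈-++⁻ (x ∷ y ∷ z ∷ []) (proj₁ mr)
          ... | inj₁ a = ⊥-elim (r∉ a)
          ... | inj₂ b = b
          pt = partner-spec G r∈G df
          loop : r ≢ partner r G
          loop e = clash (β r) (trans (cong β e) (proj₂ pt))
            where
            clash : ∀ b → b ≢ not b
            clash true ()
            clash false ()
          apart : ∀ {w} → w ∈ flat G → w ∈ flat ps → ⊥
          apart w∈ w∈′ = Unique-++-disjoint (flat G) (Unique-++⁻ʳ (x ∷ y ∷ z ∷ []) (proj₂ (ok p))) w∈ (sub w∈′)
        verdict : ∀ b → mem (x ∷ y ∷ z ∷ []) r ≡ b →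
          Sat (if b then ret (inj₂ r) else (ask₃ z₀ x y z Gs >>= extend₃ r G)) (length Gs) (AskSpec x y z (G ∷ Gs))
        verdict true e p = mem⁻ (x ∷ y ∷ z ∷ []) e , majority-of-three {ps = G} (proj₂ (proj₁ (ok p) (here refl))) (hr (legal p) (PH p))
        verdict false e = Sat-mono (ask₃ z₀ x y z Gs >>= extend₃ r G) (≤-reflexive (+-identityʳ _))
          (Sat-bind (ask₃ z₀ x y z Gs) {k = extend₃ r G} {b′ = 0} (Sat-ask₃ x y z Gs ok′) λ where
            (inj₂ r′) h → h
            (inj₁ ps) (len , h) → cong suc len , λ p → extend (mem-false (x ∷ y ∷ z ∷ []) e) p ps (h p)) λ _ s → s

-- Searching a non-minority ball when there are two colours

module _ {n q : ℕ} (d : ℕ) (z₀ : Fin n) where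

  Pairs′ : Set
  Pairs′ = List (Fin n × Fin n)

  search : (o i : Fin n) (orQ andQ : Fin n → Fin n → Tree n q (Pairs′ ⊎ Fin n)) (r : Fin n) (rs : List (Fin n)) →
    Tree n q (Pairs′ ⊎ (Fin n ⊎ (List (∃[ x ] x ∈ r ∷ rs) × (∃[ x ] x ∈ r ∷ rs) × List (∃[ x ] x ∈ r ∷ rs))))
  search o i orQ andQ r rs = Comparing.interpret o i orQ andQ
    (select (length (r ∷ rs)) id (r , here refl) (attach rs there) (half (length (r ∷ rs)))) (Comparing.state (r ∷ rs) [] [])

  -- Groups have d - 1 pairs because 3 + 2(d - 1) = q. There are d of them so that failing replies
  -- supply a new reference pair together with d - 1 further pairs, just enough to fill up a query.
  groups₃ : Pairs′ → List Pairs′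
  groups₃ = chunks (pred d) d

  result : ∀ {A B : Set} {r : Fin n} {rs} → A ⊎ (Fin n ⊎ (B × (∃[ x ] x ∈ r ∷ rs) × B)) → Fin n
  result {r = r} (inj₁ _) = r
  result (inj₂ (inj₁ p)) = p
  result (inj₂ (inj₂ (_ , (p , _) , _))) = p

  -- An exception happens at most once: with the oriented pairs it delivers, the search is repeated
  -- from the start and cannot fail again.
  retry : (r : Fin n) (rs : List (Fin n)) → Pairs′ ⊎ (Fin n ⊎ (List (∃[ x ] x ∈ r ∷ rs) × (∃[ x ] x ∈ r ∷ rs) × List (∃[ x ] x ∈ r ∷ rs))) → Tree n q (Fin n)
  retry r rs (inj₁ ((o , i) ∷ ps)) = search o i (askKnown z₀ o i ps i) (askKnown z₀ o i ps o) r rs >>= λ a → ret (result a)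
  retry r rs a = ret (result a)

  withPairs : Pairs′ × List (Fin n) × List (Fin n) → Tree n q (Fin n)
  withPairs ((o , i) ∷ ps , J , r ∷ rs) =
    search o i (λ x y → ask₃ z₀ x y i (groups₃ ps)) (λ x y → ask₃ z₀ x y o (groups₃ ps)) r rs >>= retry r rs >>= λ p →
    ret (if mem (r ∷ rs) p then p else r)
  withPairs _ = ret z₀

  twoColoured : List (Fin n) → Tree n q (Fin n)
  twoColoured R = grab d z₀ (suc (d * pred d)) R >>= withPairs

module TwoColoured {c : ℕ} (rule : Rule c) {n q : ℕ} (χ : Coloring n c) (z₀ : Fin n) (H : Set) (β : Fin n → Bool)
  {d : ℕ} (d≥1 : 1 ≤ d) (q≡ : q ≡ suc (d + d))
  (forced : H → ∀ {L a} → Runs.Legal rule {n} {q} χ L → Runs.Answer rule {n} {q} χ L a →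
    ∃[ m ] a ≡ just (just m) × m ∈ L × length L < 2 * cnt (λ z → is (β m) (β z)) L) where
  open Rule rule
  open Runs rule {n} {q} χ
  open Binary rule χ z₀ H β d≥1 q≡ (λ h {L} {a} → forced h {L} {a})
  open Pairs rule χ z₀ H β d≥1 q≡ (λ h {L} {a} → forced h {L} {a})
  open Oracles rule χ z₀ H β d≥1 q≡ (λ h {L} {a} → forced h {L} {a})

  module _ (P : Set) (PH : P → H) where

    Sat-askKnown : ∀ o i ps z x y → (P → ∃[ v ] Same v ((o , i) ∷ ps) × Unique (x ∷ y ∷ z ∷ flat ps) × length ps ≡ pred d) → z ∈ o ∷ i ∷ [] →
      Sat (askKnown {q = q} z₀ o i ps z x y) 1 λ { (inj₁ _) → ⊥ ; (inj₂ r) → P → r ∈ x ∷ y ∷ o ∷ i ∷ [] × β r ≡ maj (β x) (β y) (β z) }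
    Sat-askKnown o i ps z x y ok z∈ = Sat-bind (majority z₀ (x ∷ y ∷ z ∷ flat ps)) {b′ = 0} (Sat-majority (x ∷ y ∷ z ∷ flat ps)) λ m hm p → named p m hm
      where
      named : P → ∀ m → (Legal (x ∷ y ∷ z ∷ flat ps) → H → IsMajority (x ∷ y ∷ z ∷ flat ps) m) →
        let r = name₃ o i ps x y m in r ∈ x ∷ y ∷ o ∷ i ∷ [] × β r ≡ maj (β x) (β y) (β z)
      named p m hm = verdict (mem (x ∷ y ∷ []) m) (mem (o ∷ map proj₁ ps) m) refl refl
        where
        v = proj₁ (ok p)
        same = proj₁ (proj₂ (ok p))
        mm = hm (proj₁ (proj₂ (proj₂ (ok p))) , three {ps} (proj₂ (proj₂ (proj₂ (ok p)))) {x} {y} {z}) (PH p)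
        df : Differ ps
        df ab∈ = trans (proj₂ (same (there ab∈))) (cong not (sym (proj₁ (same (there ab∈)))))
        colour : β m ≡ maj (β x) (β y) (β z)
        colour = majority-of-three {ps = ps} df mm
        firsts : ∀ qs → Same v qs → m ∈ map proj₁ qs → β m ≡ v
        firsts ((a , b) ∷ qs) s (here refl) = proj₁ (s (here refl))
        firsts ((a , b) ∷ qs) s (there m∈) = firsts qs (s ∘ there) m∈
        seconds : ∀ qs → Same v qs → m ∉ map proj₁ qs → m ∈ flat qs → β m ≡ not v
        seconds ((a , b) ∷ qs) s ∉ (here refl) = ⊥-elim (∉ (here refl))
        seconds ((a , b) ∷ qs) s ∉ (there (here refl)) = proj₂ (s (here refl))
        seconds ((a , b) ∷ qs) s ∉ (there (there m∈)) = seconds qs (s ∘ there) (∉ ∘ there) m∈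
        verdict : ∀ b₁ b₂ → mem (x ∷ y ∷ []) m ≡ b₁ → mem (o ∷ map proj₁ ps) m ≡ b₂ →
          let r = if b₁ then m else if b₂ then o else i in r ∈ x ∷ y ∷ o ∷ i ∷ [] × β r ≡ maj (β x) (β y) (β z)
        verdict true _ e _ = ∈-++⁺ˡ (mem⁻ (x ∷ y ∷ []) e) , colour
        verdict false true _ e = there (there (here refl)) ,
          trans (trans (proj₁ (same (here refl))) (sym (firsts ((o , i) ∷ ps) same (mem⁻ (o ∷ map proj₁ ps) e)))) colour
        verdict false false e₁ e₂ = there (there (there (here refl))) , trans (trans (proj₂ (same (here refl))) (sym last)) colour
          where
          ∉xy = mem-false (x ∷ y ∷ []) e₁
          ∉first = mem-false (o ∷ map proj₁ ps) e₂
          last : β m ≡ not v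
          last with proj₁ mm
          ... | here e = ⊥-elim (∉xy (here e))
          ... | there (here e) = ⊥-elim (∉xy (there (here e)))
          ... | there (there (there m∈)) = seconds ps (same ∘ there) (∉first ∘ there) m∈
          ... | there (there (here refl)) = isI z∈
            where
            isI : m ∈ o ∷ i ∷ [] → β m ≡ not v
            isI (here e) = ⊥-elim (∉first (here e))
            isI (there (here refl)) = proj₂ (same (here refl))

  module Search (r : Fin n) (rs : List (Fin n)) (upool : Unique (r ∷ rs)) (P : Set)
    (o i : Fin n) (opposite : P → β i ≡ not (β o))
    (orQ andQ : Fin n → Fin n → Tree n q (List (Fin n × Fin n) ⊎ Fin n)) (Exc : List (Fin n × Fin n) → Set) (t : ℕ) where

    pool : List (Fin n)
    pool = r ∷ rs

    β′ : Fin n → Bool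
    β′ z = rel (β o) (β z)

    open Interpreting rule {n} {q} χ P β′ o i orQ andQ pool upool Exc t
    open Amortised rule {n} {q} χ P β′ o i orQ andQ pool upool Exc t
    open Running rule {n} {q} χ P β′ o i orQ andQ pool upool Exc t
    open Selection _⊑ₚ_ (λ {u} {v} {w} → ⊑ₚ-trans {u} {v} {w})
    open MedianOfMedians _⊑ₚ_ (λ {u} {v} {w} → ⊑ₚ-trans {u} {v} {w})

    S : List (∃[ x ] x ∈ pool)
    S = (r , here refl) ∷ attach rs there

    poolS : map proj₁ S ≡ pool
    poolS = cong (r ∷_) (map-attach rs there)

    lenS : length S ≡ length pool
    lenS = trans (sym (length-map proj₁ S)) (cong length poolS)

    K′ : Bool → List (∃[ x ] x ∈ pool) → ℕ
    K′ w = cnt (λ z → is w (β′ (proj₁ z)))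

    NonMin-β : ∀ {p} → NonMin β′ pool p → NonMin β pool p
    NonMin-β {p} (p∈ , h) = p∈ , ≤-trans h (*-monoʳ-≤ 2 (≤-reflexive (cnt-cong pool λ {z} _ → is-rel (β o) (β p) (β z))))

    -- If the median is false, so is everything below it; if true, so is everything above. Either
    -- side together with the median is at least half of the pool.
    median-nonMin : ∀ {L p G} → Selected id S (half (length pool)) L p G → P → NonMin β pool (proj₁ p)
    median-nonMin {L} {p} {G} (selected perm small large rank) h = NonMin-β (subst (proj₁ p ∈_) poolS (∈-map⁺ proj₁ (∈-resp-↭ (↭-sym perm) (here refl))) ,
      subst (λ m → length pool ≤ 2 * m) (sym count′) (lemma (β′ (proj₁ p)) refl))
      where
      count′ : cnt (λ z → is (β′ (proj₁ p)) (β′ z)) pool ≡ K′ (β′ (proj₁ p)) S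
      count′ = trans (cong (cnt _) (sym poolS)) (cnt-map _ proj₁ S)
      size : length pool ≡ 1 + (half (length pool) + length G)
      size = trans (sym lenS) (trans (↭-length perm) (cong suc (trans (length-++ L) (cong (_+ length G) rank))))
      hs = half-split (length pool) (length G) (s≤s z≤n) size
      split : ∀ w → K′ w S ≡ bit (is w (β′ (proj₁ p))) + (K′ w L + K′ w G)
      split w = trans (cnt-↭ _ perm) (cong (bit (is w (β′ (proj₁ p))) +_) (cnt-++ _ L G))
      lemma : ∀ w → β′ (proj₁ p) ≡ w → length pool ≤ 2 * K′ (β′ (proj₁ p)) S
      lemma false e = subst (λ w → length pool ≤ 2 * K′ w S) (sym e)
        (lia (length pool ∷ half (length pool) ∷ length G ∷ K′ false S ∷ K′ false G ∷ [])
          ((x₀ ≈ con 1 ⊕ (x₁ ⊕ x₂)) ∷ (x₂ ≼ x₁) ∷ (x₃ ≈ con 1 ⊕ (x₁ ⊕ x₄)) ∷ []) (x₀ ≼ 2 ⊛ x₃) size (proj₁ hs)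
          (trans (split false) (cong₂ (λ a b → bit a + (b + K′ false G)) (cong (is false) e) (trans (cnt-full _ L allL) rank))))
        where
        allL : ∀ {z} → z ∈ L → is false (β′ (proj₁ z)) ≡ true
        allL {z} z∈ with bool-cases (β′ (proj₁ z))
        ... | inj₂ f = cong not f
        ... | inj₁ t = case trans (sym (small z∈ h t)) e of λ ()
      lemma true e = subst (λ w → length pool ≤ 2 * K′ w S) (sym e)
        (lia (length pool ∷ half (length pool) ∷ length G ∷ K′ true S ∷ K′ true L ∷ [])
          ((x₀ ≈ con 1 ⊕ (x₁ ⊕ x₂)) ∷ (x₁ ≼ con 1 ⊕ x₂) ∷ (x₃ ≈ con 1 ⊕ (x₄ ⊕ x₂)) ∷ []) (x₀ ≼ 2 ⊛ x₃) size (proj₂ hs)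
          (trans (split true) (cong₂ (λ a b → bit a + (K′ true L + b)) e (cnt-full _ G λ z∈ → large z∈ h e))))

    searchTime : ℕ
    searchTime = unit * (length pool + C * length pool)

    Sat-search : (∀ {x y} → x ∈ pool → y ∈ pool → x ≢ y → Sat (orQ x y) t (OrSpec x y)) →
      (∀ {x y} → x ∈ pool → y ∈ pool → x ≢ y → Sat (andQ x y) t (AndSpec x y)) →
      Sat (search d z₀ o i orQ andQ r rs) searchTime λ a → (∃[ e ] a ≡ inj₁ e × Exc e) ⊎ (P → NonMin β pool (result {n} {q} d z₀ a)) × (∀ e → a ≢ inj₁ e)
    Sat-search so sa = Sat-mono (search d z₀ o i orQ andQ r rs) ≤-refl
      (Sat-interpret βo βi so sa (select (length pool) id (r , here refl) (attach rs there) (half (length pool))) (C * length pool)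
        (Comparing.state pool [] []) sel ready) λ where
          (inj₁ e) h → inj₁ (e , refl , h)
          (inj₂ (inj₁ p)) h → inj₂ ((λ π → NonMin-β (h π)) , λ _ ())
          (inj₂ (inj₂ (L , p , G))) h → inj₂ ((λ π → median-nonMin h π) , λ _ ())
      where
      βo : P → β′ o ≡ false
      βo _ = cong not (is-same (β o))
      βi : P → β′ i ≡ true
      βi π = trans (cong (rel (β o)) (opposite π)) (rel-not (β o))
        where
        rel-not : ∀ b → rel b (not b) ≡ true
        rel-not true = refl
        rel-not false = refl
      sel : SatC (select (length pool) id (r , here refl) (attach rs there) (half (length pool))) (C * length pool) (Outcome id S (half (length pool)))
      sel = SatC-mono (select (length pool) id (r , here refl) (attach rs there) (half (length pool))) (≤-reflexive (cong (C *_) lenS))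
        (SatC-select (length pool) id (r , here refl) (attach rs there) (half (length pool)) (≤-reflexive lenS)
          (≤-trans (half< (length pool) (s≤s z≤n)) (≤-reflexive (sym lenS)))) λ _ s → s
      ready : Ready (Comparing.state pool [] [])
      ready = ↭-reflexive (sym (++-identityʳ pool)) , (λ _ ()) , (λ _ ())

module Solving {c : ℕ} (rule : Rule c) {n q : ℕ} (χ : Coloring n c) (z₀ : Fin n) (H : Set) (β : Fin n → Bool)
  {d : ℕ} (d≥1 : 1 ≤ d) (q≡ : q ≡ suc (d + d))
  (forced : H → ∀ {L a} → Runs.Legal rule {n} {q} χ L → Runs.Answer rule {n} {q} χ L a →
    ∃[ m ] a ≡ just (just m) × m ∈ L × length L < 2 * cnt (λ z → is (β m) (β z)) L) where
  open Rule rule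
  open Runs rule {n} {q} χ
  open Binary rule χ z₀ H β d≥1 q≡ (λ h {L} {a} → forced h {L} {a})
  open Pairs rule χ z₀ H β d≥1 q≡ (λ h {L} {a} → forced h {L} {a})
  open Oracles rule χ z₀ H β d≥1 q≡ (λ h {L} {a} → forced h {L} {a})
  open TwoColoured rule χ z₀ H β d≥1 q≡ (λ h {L} {a} → forced h {L} {a})

  searchCost : ℕ → ℕ → ℕ
  searchCost t m = ((t + t) + (t + t)) * (m + 40 * m)

  module _ {o i : Fin n} {ps : List (Fin n × Fin n)} {J : List (Fin n)} {r : Fin n} {rs : List (Fin n)}
    (uJ : Unique (J ++ r ∷ rs)) (enough : d * pred d ≤ length ps)
    (grabbed : H → Mixed (r ∷ rs) → Grabbed ((o , i) ∷ ps) J) where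

    pool : List (Fin n)
    pool = r ∷ rs

    P : Set
    P = H × Mixed pool

    Gs : List (List (Fin n × Fin n))
    Gs = groups₃ {n} {q} d z₀ ps

    G! : P → Grabbed ((o , i) ∷ ps) J
    G! (h , m) = grabbed h m

    fresh : ∀ {x y F} → x ∈ pool → y ∈ pool → x ≢ y → Unique F → (∀ {w} → w ∈ F → w ∈ J) → Unique (x ∷ y ∷ F)
    fresh x∈ y∈ x≢y uF sub = (All.tabulate λ { (here e) → x≢y ∘ (λ f → trans f e) ; (there w∈) refl → Unique-++-disjoint J uJ (sub w∈) x∈ })
      ∷ (All.tabulate λ { w∈ refl → Unique-++-disjoint J uJ (sub w∈) y∈ }) ∷ uF

    prefix : P → Unique (o ∷ i ∷ concatMap flat Gs) × (∀ {w} → w ∈ o ∷ i ∷ concatMap flat Gs → w ∈ J)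
    prefix p with flat-chunks (pred d) d ps
    ... | rest , e = Unique-++⁻ˡ (o ∷ i ∷ concatMap flat Gs) {rest} (subst (λ l → Unique (o ∷ i ∷ l)) e (Grabbed.distinct (G! p)))
      , λ {w} w∈ → Grabbed.within (G! p) (subst (λ l → w ∈ o ∷ i ∷ l) (sym e) (∈-++⁺ˡ {xs = o ∷ i ∷ concatMap flat Gs} w∈))

    groupsOK : P → GroupsOK P proj₁ Gs
    groupsOK p {G} G∈ = chunks-length (pred d) d enough G∈ , λ ab∈ → Grabbed.differ (G! p) (there (chunks-⊆ (pred d) d G∈ ab∈))

    with-i : ∀ {x y} → x ∈ pool → y ∈ pool → x ≢ y → P → GroupsOK P proj₁ Gs × Unique (x ∷ y ∷ i ∷ concatMap flat Gs)
    with-i x∈ y∈ x≢y p = (λ {G} → groupsOK p {G}) , fresh x∈ y∈ x≢y (Unique-++⁻ʳ [ o ] (proj₁ (prefix p))) (λ w∈ → proj₂ (prefix p) (there w∈))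

    with-o : ∀ {x y} → x ∈ pool → y ∈ pool → x ≢ y → P → GroupsOK P proj₁ Gs × Unique (x ∷ y ∷ o ∷ concatMap flat Gs)
    with-o x∈ y∈ x≢y p = (λ {G} → groupsOK p {G}) , fresh x∈ y∈ x≢y (Unique-++⁻ʳ [ i ] (Unique-↭ (↭-swap o i ↭-refl) (proj₁ (prefix p))))
      λ { (here e) → proj₂ (prefix p) (here e) ; (there w∈) → proj₂ (prefix p) (there (there w∈)) }

    Exc : List (Fin n × Fin n) → Set
    Exc e = length e ≡ d × (P → ∃[ v ] Same v e × Unique (flat e) × (∀ {w} → w ∈ flat e → w ∈ J))

    upool : Unique pool
    upool = Unique-++⁻ʳ J uJ

    orQ andQ : Fin n → Fin n → Tree n q (List (Fin n × Fin n) ⊎ Fin n)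
    orQ x y = ask₃ z₀ x y i Gs
    andQ x y = ask₃ z₀ x y o Gs

    opposite : P → β i ≡ not (β o)
    opposite p = Grabbed.differ (G! p) (here refl)

    module A = Search r rs upool P o i opposite orQ andQ Exc d
    module IA = Interpreting rule {n} {q} χ P A.β′ o i orQ andQ pool upool Exc d

    reference : ∀ {x y z} → z ∈ o ∷ i ∷ [] → ∀ {w} → w ∈ x ∷ y ∷ z ∷ [] → w ∈ x ∷ y ∷ o ∷ i ∷ []
    reference z∈ (here e) = here e
    reference z∈ (there (here e)) = there (here e)
    reference z∈ (there (there (here refl))) = there (there z∈)

    exception : ∀ {x y z e} → AskSpec P proj₁ x y z Gs (inj₁ e) → (∀ {w} → P → w ∈ concatMap flat Gs → w ∈ J) → Exc e
    exception (len , f) sub = trans len (length-chunks (pred d) d ps) , λ p → let same , u , s = f p in _ , (λ {a} {b} → same {a} {b}) , u , λ w∈ → sub p (s w∈)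

    inside : ∀ {w} → P → w ∈ concatMap flat Gs → w ∈ J
    inside p w∈ = proj₂ (prefix p) (there (there w∈))

    Sat-orA : ∀ {x y} → x ∈ pool → y ∈ pool → x ≢ y → Sat (orQ x y) d (IA.OrSpec x y)
    Sat-orA {x} {y} x∈ y∈ x≢y = Sat-mono (orQ x y) (≤-reflexive (length-chunks (pred d) d ps)) (Sat-ask₃ P proj₁ x y i Gs (with-i x∈ y∈ x≢y)) λ where
      (inj₁ e) h → exception h inside
      (inj₂ w) h p → reference (there (here refl)) (proj₁ (h p)) , trans (cong (rel (β o)) (trans (proj₂ (h p)) (cong (maj (β x) (β y)) (opposite p)))) (rel-or (β o) (β x) (β y))

    Sat-andA : ∀ {x y} → x ∈ pool → y ∈ pool → x ≢ y → Sat (andQ x y) d (IA.AndSpec x y)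
    Sat-andA {x} {y} x∈ y∈ x≢y = Sat-mono (andQ x y) (≤-reflexive (length-chunks (pred d) d ps)) (Sat-ask₃ P proj₁ x y o Gs (with-o x∈ y∈ x≢y)) λ where
      (inj₁ e) h → exception h inside
      (inj₂ w) h p → reference (here refl) (proj₁ (h p)) , trans (cong (rel (β o)) (proj₂ (h p))) (rel-and (β o) (β x) (β y))

    module Known! {o′ i′ : Fin n} {qs : List (Fin n × Fin n)} (exc : Exc ((o′ , i′) ∷ qs)) where
      lenqs : length qs ≡ pred d
      lenqs = cong pred (proj₁ exc)

      v : P → Bool
      v p = proj₁ (proj₂ exc p)

      same : (p : P) → Same (v p) ((o′ , i′) ∷ qs)
      same p = proj₁ (proj₂ (proj₂ exc p))

      orQ′ andQ′ : Fin n → Fin n → Tree n q (List (Fin n × Fin n) ⊎ Fin n)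
      orQ′ = askKnown z₀ o′ i′ qs i′
      andQ′ = askKnown z₀ o′ i′ qs o′

      opposite′ : P → β i′ ≡ not (β o′)
      opposite′ p = trans (proj₂ (same p (here refl))) (cong not (sym (proj₁ (same p (here refl)))))

      module B = Search r rs upool P o′ i′ opposite′ orQ′ andQ′ (λ _ → ⊥) 1
      module IB = Interpreting rule {n} {q} χ P B.β′ o′ i′ orQ′ andQ′ pool upool (λ _ → ⊥) 1

      sub-i : ∀ {x y} → x ∈ pool → y ∈ pool → x ≢ y → P →
        ∃[ v ] Same v ((o′ , i′) ∷ qs) × Unique (x ∷ y ∷ i′ ∷ flat qs) × length qs ≡ pred d
      sub-i x∈ y∈ x≢y p = let v , same , u , s = proj₂ exc p in v , (λ {a} {b} → same {a} {b}) , fresh x∈ y∈ x≢y (Unique-++⁻ʳ [ o′ ] u) (λ w∈ → s (there w∈)) , lenqs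

      sub-o : ∀ {x y} → x ∈ pool → y ∈ pool → x ≢ y → P →
        ∃[ v ] Same v ((o′ , i′) ∷ qs) × Unique (x ∷ y ∷ o′ ∷ flat qs) × length qs ≡ pred d
      sub-o x∈ y∈ x≢y p = let v , same , u , s = proj₂ exc p in v , (λ {a} {b} → same {a} {b}) ,
        fresh x∈ y∈ x≢y (Unique-++⁻ʳ [ i′ ] (Unique-↭ (↭-swap o′ i′ ↭-refl) u)) (λ { (here e) → s (here e) ; (there w∈) → s (there (there w∈)) }) , lenqs

      Sat-orB : ∀ {x y} → x ∈ pool → y ∈ pool → x ≢ y → Sat (orQ′ x y) 1 (IB.OrSpec x y)
      Sat-orB {x} {y} x∈ y∈ x≢y = Sat-mono (orQ′ x y) ≤-refl (Sat-askKnown P proj₁ o′ i′ qs i′ x y (sub-i x∈ y∈ x≢y) (there (here refl))) λ where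
        (inj₁ e) h → h
        (inj₂ w) h p → proj₁ (h p) , trans (cong (rel (β o′)) (trans (proj₂ (h p)) (cong (maj (β x) (β y)) (opposite′ p)))) (rel-or (β o′) (β x) (β y))

      Sat-andB : ∀ {x y} → x ∈ pool → y ∈ pool → x ≢ y → Sat (andQ′ x y) 1 (IB.AndSpec x y)
      Sat-andB {x} {y} x∈ y∈ x≢y = Sat-mono (andQ′ x y) ≤-refl (Sat-askKnown P proj₁ o′ i′ qs o′ x y (sub-o x∈ y∈ x≢y) (here refl)) λ where
        (inj₁ e) h → h
        (inj₂ w) h p → proj₁ (h p) , trans (cong (rel (β o′)) (proj₂ (h p))) (rel-and (β o′) (β x) (β y))

    Sat-retry : ∀ a → (∃[ e ] a ≡ inj₁ e × Exc e) ⊎ (P → NonMin β pool (result {n} {q} d z₀ a)) × (∀ e → a ≢ inj₁ e) →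
      Sat (retry d z₀ r rs a) (searchCost 1 (length pool)) λ p → P → NonMin β pool p
    Sat-retry (inj₁ []) (inj₁ (_ , refl , (len , _))) = ⊥-elim (<⇒≱ d≥1 (≤-reflexive (sym len)))
    Sat-retry (inj₁ ((o′ , i′) ∷ qs)) (inj₁ (_ , refl , exc)) = Sat-mono (search d z₀ o′ i′ _ _ r rs >>= _) (≤-reflexive (+-identityʳ _))
      (Sat-bind (search d z₀ o′ i′ (Known!.orQ′ exc) (Known!.andQ′ exc) r rs) {b′ = 0} (Known!.B.Sat-search exc (Known!.Sat-orB exc) (Known!.Sat-andB exc)) λ where
        a (inj₁ (_ , _ , ()))
        a (inj₂ (h , _)) → h) λ _ h → h
    Sat-retry (inj₂ (inj₁ _)) (inj₂ (h , _)) = h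
    Sat-retry (inj₂ (inj₂ _)) (inj₂ (h , _)) = h
    Sat-retry (inj₁ e) (inj₂ (_ , f)) = ⊥-elim (f e refl)
    Sat-retry (inj₂ (inj₁ _)) (inj₁ (_ , () , _))
    Sat-retry (inj₂ (inj₂ _)) (inj₁ (_ , () , _))

    Sat-withPairs : Sat (withPairs d z₀ ((o , i) ∷ ps , J , pool)) (searchCost d (length pool) + searchCost 1 (length pool)) λ p →
      p ∈ pool × (H → Mixed pool → NonMin β pool p)
    Sat-withPairs = Sat-mono (withPairs d z₀ ((o , i) ∷ ps , J , pool)) (≤-reflexive (+-identityʳ _))
      (Sat-bind (search d z₀ o i orQ andQ r rs >>= retry d z₀ r rs) {b′ = 0}
        (Sat-bind (search d z₀ o i orQ andQ r rs) {k = retry d z₀ r rs} (A.Sat-search Sat-orA Sat-andA) Sat-retry) λ p h → guard p h (mem pool p) refl) λ _ h → h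
      where
      guard : ∀ p → (P → NonMin β pool p) → ∀ b → mem pool p ≡ b → let p′ = if b then p else r in
        p′ ∈ pool × (H → Mixed pool → NonMin β pool p′)
      guard p h true e = mem⁻ pool e , λ h′ m → h (h′ , m)
      guard p h false e = here refl , λ h′ m → ⊥-elim (mem-false pool e (proj₁ (h (h′ , m))))

  pairCount : ℕ
  pairCount = suc (d * pred d)

  solveCost : ℕ
  solveCost = grabTime pairCount + (searchCost d n + searchCost 1 n)

  searchCost-mono : ∀ t {m m′} → m ≤ m′ → searchCost t m ≤ searchCost t m′
  searchCost-mono t h = *-monoʳ-≤ ((t + t) + (t + t)) (+-mono-≤ h (*-monoʳ-≤ 40 h))

  Sat-twoColoured : ∀ R → Unique R → length R ≤ n → pairCount * suc q < length R →
    Sat (twoColoured d z₀ R) solveCost λ p → ∃[ J ] ∃[ pool ] R ↭ J ++ pool × length J ≡ pairCount * suc q × p ∈ pool ×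
      (H → Mixed pool → NonMin β pool p × K true J ≡ K false J)
  Sat-twoColoured R uR R≤n big = Sat-bind (grab d z₀ pairCount R) {k = withPairs d z₀} (Sat-grab pairCount R uR (<⇒≤ big) R≤n) go
    where
    go : ∀ ((ps , J , pool) : List (Fin n × Fin n) × List (Fin n) × List (Fin n)) →
      R ↭ J ++ pool × length J ≡ pairCount * suc q × length ps ≡ pairCount × (H → Mixed pool → Grabbed ps J) →
      Sat (withPairs d z₀ (ps , J , pool)) (searchCost d n + searchCost 1 n) λ p → ∃[ J ] ∃[ pool ] R ↭ J ++ pool × length J ≡ pairCount * suc q × p ∈ pool ×
        (H → Mixed pool → NonMin β pool p × K true J ≡ K false J)
    go ([] , J , pool) (_ , _ , () , _)
    go (_ ∷ _ , J , []) (p , lenJ , _ , _) = ⊥-elim (<⇒≱ big (≤-trans (≤-reflexive (trans (↭-length p) (cong length (++-identityʳ J)))) (≤-reflexive lenJ)))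
    go ((o , i) ∷ ps , J , r ∷ rs) (p , lenJ , lenps , g) = Sat-mono (withPairs d z₀ ((o , i) ∷ ps , J , r ∷ rs))
      (+-mono-≤ (searchCost-mono d small) (searchCost-mono 1 small))
      (Sat-withPairs {ps = ps} {J} (Unique-↭ p uR) (≤-reflexive (sym (suc-injective lenps))) g)
      λ x (x∈ , h) → J , r ∷ rs , p , lenJ , x∈ , λ h′ m → h h′ m , Grabbed.even (g h′ m)
      where
      small : length (r ∷ rs) ≤ n
      small = ≤-trans (≤-trans (m≤n+m _ (length J)) (≤-reflexive (trans (sym (length-++ J)) (sym (↭-length p))))) R≤n

-- The algorithm

-- For even `q` the two-coloured outcome is impossible, so the discarded balls agree and any of them
-- will do. For odd `q` it is unknown which outcome holds; the ball returned by `twoColoured` is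
-- itself a discarded one, hence correct in both.
finishBy : ∀ {n q} → Fin n → List (Fin n) → (∃[ h ] (q ≡ h + h ⊎ q ≡ suc (h + h))) → Tree n q (Reply n)
finishBy r rs (_ , inj₁ _) = ret (just r)
finishBy r rs (h , inj₂ _) = twoColoured h r (r ∷ rs) >>= λ p → ret (just p)

finish : ∀ {n q} → List (Fin n) → Tree n q (Reply n)
finish [] = ret nothing
finish {q = q} (r ∷ rs) = finishBy r rs (halve q)

afterSlide : ∀ {n q} → ℕ → Bool → List (Fin n) ⊎ (List (Fin n) × List (Fin n)) → Tree n q (Reply n)
afterSlide {n} {q} c ap (inj₁ Q) = Classification.rounds n q c Q c (allFin n) >>= λ (Cs , _) → ret (decide ap Cs)
afterSlide c ap (inj₂ (_ , R)) = finish R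

-- One program serves all four problems. The kind of target matters only after an answer NO, since
-- otherwise a non-minority ball is found, which suits either target.
solver : ∀ n q → ℕ → Bool → Tree n q (Reply n)
solver n q c ap = slide (take (suc (c * q)) (allFin n)) (take (pred q) (allFin n)) (drop (pred q) (allFin n)) [] >>= afterSlide c ap

-- Constants, running time and correctness

double-parity : ∀ h d → h + h ≢ suc (d + d)
double-parity h d e = even≢odd h d (trans (cong (h +_) (+-identityʳ h)) (trans e (cong (λ m → suc (d + m)) (sym (+-identityʳ d)))))

-- One reference pair and d groups of d - 1 pairs.
pairsFor : ℕ → ℕ
pairsFor d = suc (d * pred d)

module Constants (q c : ℕ) where
  d : ℕ
  d = half q

  -- Bounds the balls outside the final pool: the window and the balanced sets of q + 1 balls from
  -- which the pairs were taken.
  aside : ℕ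
  aside = q + pairsFor d * suc q

  size₁ : ℕ
  size₁ = suc (c * (c * suc q))

  -- The summands provide room for `Y`, make some colour class larger than any unclassified
  -- remainder, and leave the balls set aside in the minority.
  n₀ : ℕ
  n₀ = suc (c * q) + (suc (c * size₁) + (2 * aside + 1))

  slideRate sameRate : ℕ
  slideRate = (suc (c * q) + q) ^ q + 1
  sameRate = 2 * (size₁ + q) ^ pred q

  -- The factor 41 counts one open ball plus `C` = 40 comparisons per ball; it is charged with 4d
  -- for the search with groups of pairs and with 4 for its repetition.
  rate : ℕ
  rate = slideRate + (c * (size₁ * (size₁ * sameRate) + sameRate)
    + (pairsFor d * ((2 + q) * (2 + q) + 1) + (((d + d) + (d + d)) * 41 + 4 * 41)))

module Correctness {c : ℕ} (rule : Rule c) {n q : ℕ} (χ : Coloring n c) (q≥2 : 2 ≤ q) (ap : Bool)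
  (big : Constants.n₀ q c ≤ n) where
  open Rule rule
  open Runs rule {n} {q} χ
  open Constants q c
  open Sliding rule {n} {q} χ q≥2

  X Y : List (Fin n)
  X = allFin n
  Y = take (suc (c * q)) X

  size : Fin c → ℕ
  size k = cnt (has χ k) X

  uX : Unique X
  uX = UniqueP.allFin⁺ n

  lenX : length X ≡ n
  lenX = length-allFin n

  bigY : suc (c * q) ≤ n
  bigY = ≤-trans (m≤m+n _ _) big

  bigC : c * size₁ < n
  bigC = ≤-trans (≤-trans (m≤m+n _ _) (m≤n+m _ (suc (c * q)))) big

  bigA : 2 * aside + 1 ≤ n
  bigA = ≤-trans (≤-trans (m≤n+m _ (suc (c * size₁))) (m≤n+m _ (suc (c * q)))) big

  uY : Unique Y
  uY = Unique-++⁻ˡ Y {drop (suc (c * q)) X} (subst Unique (sym (take++drop≡id (suc (c * q)) X)) uX)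

  lenY : length Y ≡ suc (c * q)
  lenY = length-take≤ (suc (c * q)) X (≤-trans bigY (≤-reflexive (sym lenX)))

  common : ∃[ D ] q < mult D (map χ Y)
  common = popular q (map χ Y) (≤-reflexive (sym (trans (length-map χ Y) lenY)))

  D : Fin c
  D = proj₁ common

  many : q ≤ cnt (has χ D) Y
  many = <⇒≤ (subst (q <_) (mult-map χ D Y) (proj₂ common))

  Valid : Reply n → Set
  Valid = ValidReply (Target ap) χ Sub.⊤

  nonMinority : ∀ {p} → n ≤ 2 * size (χ p) → Valid (just p)
  nonMinority {p} h = target ap (SubP.∈⊤ , subst₂ _≤_ (sym (SubP.∣⊤∣≡n n)) (cong (2 *_) (sym (count-⊤ χ (χ p)))) h)
    where
    target : ∀ ap → NonMinority χ Sub.⊤ p → Target ap χ Sub.⊤ p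
    target false nm = nm
    target true nm = inj₂ nm

  nearly-all : ∀ {p L M} → X ↭ L ++ M → length L ≤ aside → (∀ {z} → z ∈ M → χ z ≡ χ p) → n ≤ 2 * size (χ p)
  nearly-all {p} {L} {M} perm small mono = lia (n ∷ length L ∷ length M ∷ size (χ p) ∷ aside ∷ [])
    ((x₀ ≈ x₁ ⊕ x₂) ∷ (x₁ ≼ x₄) ∷ (2 ⊛ x₄ ⊕ con 1 ≼ x₀) ∷ (x₂ ≼ x₃) ∷ []) (x₀ ≼ 2 ⊛ x₃)
    (trans (sym lenX) (trans (↭-length perm) (length-++ L))) small bigA
    (≤-trans (≤-reflexive (sym (cnt-full (has χ (χ p)) M (λ {z} z∈ → dec-true (χ z ≟ χ p) (mono z∈)))))
      (≤-trans (m≤n+m _ (cnt (has χ (χ p)) L)) (≤-reflexive (sym (trans (cnt-↭ (has χ (χ p)) perm) (cnt-++ (has χ (χ p)) L M))))))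

  module _ {W R : List (Fin n)} (perm : X ↭ W ++ R) (lenW : suc (length W) ≡ q) where

    smallW : length W ≤ aside
    smallW = ≤-trans (n≤1+n _) (≤-trans (≤-reflexive lenW) (m≤m+n q _))

    β : Fin n → Bool
    β = has χ D

    H : ℕ → Set
    H d′ = ∃[ E ] D ≢ E × OneOf D E (W ++ R) × cnt (has χ D) W ≡ d′ × cnt (has χ E) W ≡ d′

    everywhere : ∀ {E} → OneOf D E (W ++ R) → ∀ z → χ z ≡ D ⊎ χ z ≡ E
    everywhere o z = o (∈-resp-↭ perm (∈-allFin z))

    same-colour : ∀ {E} → D ≢ E → OneOf D E (W ++ R) → ∀ m z → is (β m) (β z) ≡ has χ (χ m) z
    same-colour {E} D≢E o m z with everywhere o m | everywhere o z
    ... | inj₁ a | inj₁ b rewrite a | b | dec-true (D ≟ D) refl = refl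
    ... | inj₁ a | inj₂ b rewrite a | b | dec-true (D ≟ D) refl = refl
    ... | inj₂ a | inj₁ b rewrite a | b | dec-true (D ≟ D) refl | dec-false (E ≟ D) (D≢E ∘ sym) | dec-false (D ≟ E) D≢E = refl
    ... | inj₂ a | inj₂ b rewrite a | b | dec-true (E ≟ E) refl | dec-false (E ≟ D) (D≢E ∘ sym) = refl

    K≡size : ∀ {E} → D ≢ E → OneOf D E (W ++ R) → ∀ m L → cnt (λ z → is (β m) (β z)) L ≡ cnt (has χ (χ m)) L
    K≡size D≢E o m L = cnt-cong L λ {z} _ → same-colour D≢E o m z

    -- Among an odd number of balls of two colours one has an absolute majority, which excludes NO
    -- by `fromAbs`; a reply leads strictly by `strict`, and with two colours this means a majority.
    forced : ∀ {d′} → q ≡ suc (d′ + d′) → H d′ → ∀ {L a} → Legal L → Answer L a →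
      ∃[ m ] a ≡ just (just m) × m ∈ L × length L < 2 * cnt (λ z → is (β m) (β z)) L
    forced {d′} q≡ (E , D≢E , o , _) {L} {nothing} l a = ⊥-elim (a l)
    forced {d′} q≡ (E , D≢E , o , _) {L} {just nothing} l (_ , none) = ⊥-elim (absurd (suc d′ ≤? mult D (map χ L)))
      where
      V = map χ L
      lenV : length V ≡ q
      lenV = trans (length-map χ L) (proj₂ l)
      wins : ∀ {k} → suc d′ ≤ mult k V → ⊥
      wins {k} h = none (∈-mult (≤-trans (s≤s z≤n) h)) (fromAbs (lia (length V ∷ q ∷ d′ ∷ mult k V ∷ [])
        ((x₀ ≈ x₁) ∷ (x₁ ≈ con 1 ⊕ (x₂ ⊕ x₂)) ∷ (x₂ ≺ x₃) ∷ []) (x₀ ≺ 2 ⊛ x₃) lenV q≡ h))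
      both : mult D V + mult E V ≡ q
      both = trans (cong₂ _+_ (mult-map χ D L) (mult-map χ E L)) (trans (two-colours {L = L} D≢E λ {z} _ → everywhere o z) (proj₂ l))
      absurd : Dec (suc d′ ≤ mult D V) → ⊥
      absurd (yes h) = wins h
      absurd (no h) = wins (lia (mult D V ∷ mult E V ∷ q ∷ d′ ∷ []) ((x₀ ≼ x₃) ∷ (x₀ ⊕ x₁ ≈ x₂) ∷ (x₂ ≈ con 1 ⊕ (x₃ ⊕ x₃)) ∷ []) (x₃ ≺ x₁)
        (s≤s⁻¹ (≰⇒> h)) both q≡)
    forced {d′} q≡ (E , D≢E , o , _) {L} {just (just m)} l (_ , m∈ , w) = m , refl , m∈ ,
      subst (λ k → length L < 2 * k) (sym (K≡size D≢E o m L)) (top (everywhere o m))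
      where
      more : ∀ {A B} → A ≢ B → (∀ z → χ z ≡ A ⊎ χ z ≡ B) → χ m ≡ A → length L < 2 * cnt (has χ (χ m)) L
      more {A} {B} A≢B o′ refl = lia (cnt (has χ A) L ∷ cnt (has χ B) L ∷ length L ∷ []) ((x₀ ⊕ x₁ ≈ x₂) ∷ (x₁ ≺ x₀) ∷ []) (x₂ ≺ 2 ⊛ x₀)
        (two-colours {L = L} A≢B λ {z} _ → o′ z) (subst₂ _<_ (mult-map χ B L) (mult-map χ A L) (strict w B (A≢B ∘ sym)))
      top : χ m ≡ D ⊎ χ m ≡ E → length L < 2 * cnt (has χ (χ m)) L
      top (inj₁ e) = more D≢E (everywhere o) e
      top (inj₂ e) = more (D≢E ∘ sym) (λ z → OneOf-sym {L = [ z ]} (λ { (here refl) → everywhere o z }) (here refl)) e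

    -- The window and `J` contribute equally to both colours, so half of the pool extends to half of
    -- all balls. If the pool is not mixed, it agrees with `p` and outnumbers everything set aside.
    balanced-rest : ∀ {d′ J pool p} → H d′ → R ↭ J ++ pool → length J ≤ pairsFor d * suc q → p ∈ pool →
      ((∃[ r ] r ∈ pool × β r ≡ true) × (∃[ r ] r ∈ pool × β r ≡ false) →
        NonMin β pool p × cnt (λ z → is true (β z)) J ≡ cnt (λ z → is false (β z)) J) → n ≤ 2 * size (χ p)
    balanced-rest {d′} {J} {pool} {p} (E , D≢E , o , wD , wE) pR smallJ p∈ f = cases (0 <? K true pool) (0 <? K false pool)
      where
      K : Bool → List (Fin n) → ℕ
      K w L = cnt (λ z → is w (β z)) L
      perm′ : X ↭ (W ++ J) ++ pool
      perm′ = ↭-trans perm (↭-trans (PermP.++⁺ˡ W pR) (↭-reflexive (sym (++-assoc W J pool))))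
      small : length (W ++ J) ≤ aside
      small = ≤-trans (≤-reflexive (length-++ W)) (+-mono-≤ (≤-trans (n≤1+n _) (≤-reflexive lenW)) smallJ)
      to-colour : ∀ {z} → β z ≡ β p → χ z ≡ χ p
      to-colour {z} e with everywhere o z | everywhere o p
      ... | inj₁ a | inj₁ b = trans a (sym b)
      ... | inj₂ a | inj₂ b = trans a (sym b)
      ... | inj₁ a | inj₂ b = case trans (sym (dec-true (χ z ≟ D) a)) (trans e (dec-false (χ p ≟ D) λ c → D≢E (trans (sym c) b))) of λ ()
      ... | inj₂ a | inj₁ b = case trans (sym (dec-false (χ z ≟ D) λ c → D≢E (trans (sym c) a))) (trans e (dec-true (χ p ≟ D) b)) of λ ()
      mono : ∀ w → ¬ 0 < K w pool → n ≤ 2 * size (χ p)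
      mono w h = nearly-all {L = W ++ J} {pool} perm′ small λ z∈ → to-colour (trans (colour z∈) (sym (colour p∈)))
        where
        colour : ∀ {z} → z ∈ pool → β z ≡ not w
        colour z∈ = opposite w (cnt-zero⁻ (λ z → is w (β z)) (n≤0⇒n≡0 (≮⇒≥ h)) z∈)
          where
          opposite : ∀ a {b} → is a b ≡ false → b ≡ not a
          opposite true e = e
          opposite false {true} _ = refl
      cases : Dec (0 < K true pool) → Dec (0 < K false pool) → n ≤ 2 * size (χ p)
      cases (no h) _ = mono true h
      cases (yes _) (no h) = mono false h
      cases (yes h₁) (yes h₂) with cnt-witness _ pool h₁ | cnt-witness _ pool h₂
      ... | r , r∈ , e | r′ , r′∈ , e′ with f ((r , r∈ , e) , (r′ , r′∈ , trans (sym (not-involutive _)) (cong not e′)))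
      ...   | (_ , nm) , even = lia (n ∷ K (β p) W ∷ length W ∷ K (β p) J ∷ length J ∷ K (β p) pool ∷ length pool ∷ size (χ p) ∷ [])
              ((x₀ ≈ x₂ ⊕ (x₄ ⊕ x₆)) ∷ (x₂ ≈ 2 ⊛ x₁) ∷ (x₄ ≈ 2 ⊛ x₃) ∷ (x₆ ≼ 2 ⊛ x₅) ∷ (x₇ ≈ x₁ ⊕ (x₃ ⊕ x₅)) ∷ []) (x₀ ≼ 2 ⊛ x₇)
              (trans (sym lenX) (trans (↭-length perm′) (trans (length-++ (W ++ J)) (trans (cong (_+ length pool) (length-++ W)) (+-assoc (length W) _ _)))))
              (twice W (trans wD (trans (sym wE) (cnt-cong W λ {z} _ → other z))) (β p)) (twice J even (β p)) nm
              (trans (sym (K≡size D≢E o p X)) (trans (cnt-↭ (λ z → is (β p) (β z)) perm′) (trans (cnt-++ _ (W ++ J) pool) (trans (cong (_+ K (β p) pool) (cnt-++ _ W J)) (+-assoc (K (β p) W) _ _)))))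
        where
        other : ∀ z → has χ E z ≡ not (β z)
        other z with everywhere o z
        ... | inj₁ a = trans (dec-false (χ z ≟ E) λ c → D≢E (trans (sym a) c)) (cong not (sym (dec-true (χ z ≟ D) a)))
        ... | inj₂ a = trans (dec-true (χ z ≟ E) a) (cong not (sym (dec-false (χ z ≟ D) λ c → D≢E (trans (sym c) a))))
        twice : ∀ L → K true L ≡ K false L → ∀ w → length L ≡ 2 * K w L
        twice L e true = lia (length L ∷ K true L ∷ K false L ∷ []) ((x₁ ⊕ x₂ ≈ x₀) ∷ (x₁ ≈ x₂) ∷ []) (x₀ ≈ 2 ⊛ x₁) (cnt-not β L) e
        twice L e false = lia (length L ∷ K true L ∷ K false L ∷ []) ((x₁ ⊕ x₂ ≈ x₀) ∷ (x₁ ≈ x₂) ∷ []) (x₀ ≈ 2 ⊛ x₂) (cnt-not β L) e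

    finishCost : ℕ
    finishCost = pairsFor d * (n * ((2 + q) * (2 + q)) + 1) + (((d + d) + (d + d)) * (n + 40 * n) + 4 * (n + 40 * n))

    lenR : length W + length R ≡ n
    lenR = trans (sym (length-++ W)) (trans (sym (↭-length perm)) lenX)

    Sat-finish : Settled {Y} uY {D} many W R → Sat (finish R) finishCost Valid
    Sat-finish settled = go R refl
      where
      W≤ : length R ≤ n
      W≤ = ≤-trans (m≤n+m _ (length W)) (≤-reflexive lenR)
      enough : pairsFor d * suc q < length R
      enough = lia (length W ∷ length R ∷ n ∷ q ∷ pairsFor d * suc q ∷ aside ∷ [])
        ((x₀ ⊕ x₁ ≈ x₂) ∷ (con 1 ⊕ x₀ ≈ x₃) ∷ (2 ⊛ x₅ ⊕ con 1 ≼ x₂) ∷ (x₅ ≈ x₃ ⊕ x₄) ∷ []) (x₄ ≺ x₁) lenR lenW bigA refl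
      go : ∀ R′ → R′ ≡ R → Sat (finish R′) finishCost Valid
      go [] refl = ⊥-elim (n≮0 enough)
      go (r ∷ rs) refl = by (halve q) refl
        where
        by : ∀ s → s ≡ halve q → Sat (finishBy r rs s) finishCost Valid
        by (h , inj₁ e) eqh = nonMinority {r} (simple settled)
          where
          simple : Settled {Y} uY {D} many W R → n ≤ 2 * size (χ r)
          simple (inj₁ (k , mono)) = nearly-all perm smallW λ z∈ → trans (mono z∈) (sym (mono (here refl)))
          simple (inj₂ (E , d′ , _ , e′ , _)) = ⊥-elim (double-parity h d′ (trans (sym e) e′))
        by (h , inj₂ e) eqh = Sat-mono (twoColoured h r (r ∷ rs) >>= _) (≤-trans (≤-reflexive (+-identityʳ _)) (≤-reflexive (cong costWith (cong proj₁ eqh))))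
            (Sat-bind (twoColoured h r (r ∷ rs)) {b′ = 0} (Solving.Sat-twoColoured rule χ r (H h) β h≥1 e (λ x {L} {a} → forced e x {L} {a}) (r ∷ rs)
              (Unique-++⁻ʳ W (Unique-↭ perm uX)) W≤ (subst (λ m → pairsFor m * suc q < length R) (sym (cong proj₁ eqh)) enough)) λ p res → nonMinority {p} (conclude′ p res)) λ _ v → v
          where
          costWith : ℕ → ℕ
          costWith m = pairsFor m * (n * ((2 + q) * (2 + q)) + 1) + (((m + m) + (m + m)) * (n + 40 * n) + 4 * (n + 40 * n))
          h≥1 : 1 ≤ h
          h≥1 = n≢0⇒n>0 λ h≡0 → lia⊥ (q ∷ h ∷ []) ((x₁ ≈ con 0) ∷ (x₀ ≈ con 1 ⊕ (x₁ ⊕ x₁)) ∷ (con 2 ≼ x₀) ∷ []) h≡0 e q≥2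
          conclude′ : ∀ p → (∃[ J ] ∃[ pool ] R ↭ J ++ pool × length J ≡ pairsFor h * suc q × p ∈ pool ×
            (H h → _ → NonMin β pool p × cnt (λ z → is true (β z)) J ≡ cnt (λ z → is false (β z)) J)) → n ≤ 2 * size (χ p)
          conclude′ p (J , pool , pR , lenJ , p∈ , f) = final settled
            where
            final : Settled {Y} uY {D} many W R → n ≤ 2 * size (χ p)
            final (inj₁ (k , mono)) = nearly-all perm smallW λ z∈ → trans (mono z∈) (sym (mono (∈-resp-↭ (↭-sym pR) (∈-++⁺ʳ J p∈))))
            final (inj₂ (E , d′ , D≢E , e′ , o , wD , wE)) = balanced-rest {h} hyp pR
              (≤-reflexive (trans lenJ (cong (λ m → pairsFor m * suc q) (cong proj₁ eqh)))) p∈ (f hyp)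
              where
              same : d′ ≡ h
              same = lia (d′ ∷ h ∷ q ∷ []) ((x₂ ≈ con 1 ⊕ (x₀ ⊕ x₀)) ∷ (x₂ ≈ con 1 ⊕ (x₁ ⊕ x₁)) ∷ []) (x₀ ≈ x₁) e′ e
              hyp : H h
              hyp = E , D≢E , (λ z∈ → o z∈) , trans wD same , trans wE same

  Sat-solver : Sat (solver n q c ap) (rate * n) Valid
  Sat-solver = Sat-mono (solver n q c ap) time (Sat-bind (slide Y W₀ xs []) {k = afterSlide c ap}
      (Sat-slide uY many W₀ xs [] (subst Unique (sym (take++drop≡id (pred q) X)) uX) lenW₀
        (dominated (λ ()) λ _ _ _ → inj₁ refl)) next) λ _ v → v
    where
    W₀ = take (pred q) X
    xs = drop (pred q) X
    q≤n : q ≤ n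
    q≤n = lia (q ∷ pairsFor d * suc q ∷ aside ∷ n ∷ []) ((x₂ ≈ x₀ ⊕ x₁) ∷ (2 ⊛ x₂ ⊕ con 1 ≼ x₃) ∷ []) (x₀ ≼ x₃) refl bigA
    q+ : suc (pred q) ≡ q
    q+ = suc-pred q {{>-nonZero (≤-trans (s≤s z≤n) q≥2)}}
    lenW₀ : suc (length W₀) ≡ q
    lenW₀ = trans (cong suc (length-take≤ (pred q) X (≤-trans pred[n]≤n (≤-trans q≤n (≤-reflexive (sym lenX)))))) q+
    n≥1 : 1 ≤ n
    n≥1 = ≤-trans (≤-trans (s≤s z≤n) q≥2) q≤n
    rest : ℕ
    rest = c * Classification.timeRound n q c
      + (pairsFor d * (n * ((2 + q) * (2 + q)) + 1) + (((d + d) + (d + d)) * (n + 40 * n) + 4 * (n + 40 * n)))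
    time : length xs * stepTime uY many + rest ≤ rate * n
    time = ≤-trans (+-mono-≤ bound₁ (+-mono-≤ bound₂ (+-mono-≤ bound₃ bound₄))) (≤-reflexive distribute)
      where
      grow : ∀ a → a ≤ a * n
      grow a = ≤-trans (≤-reflexive (sym (*-identityʳ a))) (*-monoʳ-≤ a n≥1)
      bound₁ : length xs * stepTime uY many ≤ slideRate * n
      bound₁ = ≤-trans (*-mono-≤ (≤-trans (≤-reflexive (length-drop (pred q) X)) (≤-trans (m∸n≤m _ (pred q)) (≤-reflexive lenX)))
        (≤-reflexive (cong (λ m → (m + q) ^ q + 1) lenY))) (≤-reflexive (*-comm n slideRate))
      bound₂ : c * Classification.timeRound n q c ≤ c * (size₁ * (size₁ * sameRate) + sameRate) * n
      bound₂ = ≤-trans (*-monoʳ-≤ c (≤-trans (+-mono-≤ (grow (size₁ * (size₁ * sameRate))) (≤-reflexive (*-comm n sameRate)))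
        (≤-reflexive (sym (*-distribʳ-+ n (size₁ * (size₁ * sameRate)) sameRate))))) (≤-reflexive (sym (*-assoc c (size₁ * (size₁ * sameRate) + sameRate) n)))
      bound₃ : pairsFor d * (n * ((2 + q) * (2 + q)) + 1) ≤ pairsFor d * ((2 + q) * (2 + q) + 1) * n
      bound₃ = ≤-trans (*-monoʳ-≤ (pairsFor d) (≤-trans (+-mono-≤ (≤-reflexive (*-comm n ((2 + q) * (2 + q)))) (grow 1))
        (≤-reflexive (sym (*-distribʳ-+ n ((2 + q) * (2 + q)) 1))))) (≤-reflexive (sym (*-assoc (pairsFor d) ((2 + q) * (2 + q) + 1) n)))
      bound₄ : ((d + d) + (d + d)) * (n + 40 * n) + 4 * (n + 40 * n) ≤ (((d + d) + (d + d)) * 41 + 4 * 41) * n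
      bound₄ = ≤-reflexive (trans (cong₂ _+_ (sym (*-assoc ((d + d) + (d + d)) 41 n)) (sym (*-assoc 4 41 n)))
        (sym (*-distribʳ-+ n (((d + d) + (d + d)) * 41) (4 * 41))))
      distribute : slideRate * n + (c * (size₁ * (size₁ * sameRate) + sameRate) * n
        + (pairsFor d * ((2 + q) * (2 + q) + 1) * n + (((d + d) + (d + d)) * 41 + 4 * 41) * n)) ≡ rate * n
      distribute = sym (trans (*-distribʳ-+ n slideRate _) (cong (slideRate * n +_)
        (trans (*-distribʳ-+ n (c * (size₁ * (size₁ * sameRate) + sameRate)) _) (cong (c * (size₁ * (size₁ * sameRate) + sameRate) * n +_)
          (*-distribʳ-+ n (pairsFor d * ((2 + q) * (2 + q) + 1)) _)))))
    next : ∀ a → Slid uY many (W₀ ++ (xs ++ [])) a → Sat (afterSlide c ap a) rest Valid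
    next (inj₁ Q) (legal , none) = Sat-mono (Classification.rounds n q c Q c (allFin n) >>= _) (≤-trans (≤-reflexive (+-identityʳ _)) (m≤m+n _ _))
      (Sat-bind (Classification.rounds n q c Q c (allFin n)) {b′ = 0} (Classify.Sat-classify rule χ q≥2 legal none) λ (Cs , _) cl →
        Decide.decide-valid rule χ q≥2 legal none ap bigC cl) λ _ v → v
    next (inj₂ (W , R)) (p , len , inv) = Sat-mono (finish R) (m≤n+m _ (c * Classification.timeRound n q c))
      (Sat-finish (↭-trans (↭-reflexive (sym (trans (cong (W₀ ++_) (++-identityʳ xs)) (take++drop≡id (pred q) X)))) p) len (settled uY many len inv)) λ _ v → v

minQueries : ∀ {c} (rule : Rule c) q → 2 ≤ q → ∀ ap n → Constants.n₀ q c ≤ n →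
  MinQueries≤ n q c (Rule.Type rule) (Target ap) (Constants.rate q c * n)
minQueries {c} rule q q≥2 ap n big = toAlgorithm (solver n q c ap)
  , (λ χ o m run → proj₁ (Runs.Sat-run rule χ (Correctness.Sat-solver rule χ q≥2 ap big) run))
  , (λ χ o m run → proj₂ (Runs.Sat-run rule χ (Correctness.Sat-solver rule χ q≥2 ap big) run))

theorem1p3 : ∀ (q c : ℕ) → 2 ≤ q → 1 ≤ c →
    ∃[ n₀ ] ∃[ K ] (∀ (n : ℕ) → n₀ ≤ n →
    MB≤ n q c (K * n) × MC≤ n q c (K * n) × PB≤ n q c (K * n) × PC≤ n q c (K * n))
theorem1p3 q c q≥2 _ = Constants.n₀ q c , Constants.rate q c , λ n big →
  minQueries (majorityRule c) q q≥2 false n big , minQueries (majorityRule c) q q≥2 true n big ,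
  minQueries (pluralityRule c) q q≥2 false n big , minQueries (pluralityRule c) q q≥2 true n big
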